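{- Let $n,r,m\in\mathbb{N}$ with $\omega(n)=m$. Then: (1) for every integer $k\ge 6$, $$\mathsf{s}_{kn}(C_n^3)\le (k+3)n+a_3 n^{1-\frac1m};$$ (2) for every integer $k\ge 18$, $$\mathsf{s}_{kn}(C_n^4)\le (k+4)n+a_4 n^{1-\frac1m};$$ (3) for every $k\in\mathbb{N}$ and fixed $r\ge 5$, $$\mathsf{s}_{k\mathsf{p}(n,r)n}(C_n^r)\le (k\,\mathsf{p}(n,r)+r)n+a_r n^{1-\frac1m}.$$
   Context: $\mathbb{N}$ denotes the positive integers; $\omega(n)$ is the number of distinct prime divisors of $n$. $C_n$ is the cyclic group of order $n$ and $C_n^r$ is the direct sum of $r$ copies of it (exponent $n$). A sequence over a finite abelian group $G$ is a finite unordered sequence of elements of $G$ with repetition allowed; its length is the number of terms counted with multiplicity, a subsequence is a sub-multiset, and a sequence is zero-sum if its terms sum to $0$. For a finite abelian group $G$ with exponent $e$ and $k\in\mathbb{N}$, $\mathsf{s}_{ke}(G)$ is the smallest positive integer $t$ such that every sequence over $G$ of length at least $t$ has a zero-sum subsequence of length exactly $ke$; $\mathsf{s}(G)=\mathsf{s}_e(G)$. For $n\ge 2$, $\mathsf{M}(n)$ is the largest prime power divisor of $n$. If $\mathsf{M}(n)=p^a$ with $p$ prime, then $\mathsf{p}(n,r)=\min\{p^t : t\in\mathbb{N},\ p^t\ge r\}$. Constant $a_r$: by a theorem of Alon and Dubiner there is an absolute constant $c>0$ such that $\mathsf{s}(C_n^r)\le (cr\log_2 r)^r n$ for all $n\in\mathbb{N}$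 and $r\ge 2$. Fix such a $c$ and put $a_r=(cr\log_2 r)^r-r$. -}

module Defs where

open import Algebra.Bundles using (AbelianGroup)
import Algebra.Construct.Pointwise as Pointwise
open import Data.Fin.Base using (Fin; toℕ; finToFun; funToFin)
import Data.Fin.Properties as Fin
open import Data.Integer.Base as ℤ using (+_)
import Data.Integer.Properties as ℤ
open import Data.List.Base using (List; []; _∷_; length; filter; foldr; take; upTo)
open import Data.List.Properties using (length-take)
open import Data.List.Relation.Binary.Pointwise as PW using ([]; _∷_)
open import Data.List.Relation.Binary.Sublist.Propositional using (_⊆_; []; _∷_; _∷ʳ_; ⊆-trans)
open import Data.List.Relation.Binary.Sublist.Propositional.Properties using (take-⊆; filter-⊆)
open import Data.List.Relation.Unary.All as All using (All; []; _∷_)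
open import Data.List.Relation.Unary.All.Properties using (all-filter; take⁺; filter⁺)
open import Data.Nat.Base as ℕ using (ℕ; zero; suc; NonZero)
open import Data.Nat.DivMod
  using (_mod_; _%_; %-distribˡ-+; m%n%n≡m%n; m<n⇒m%n≡m; m%n<n; n%n≡0; m*n%n≡0)
open import Data.Nat.Divisibility using (_∣_; _∣?_)
open import Data.Nat.Induction using (<-rec)
open import Data.Nat.Logarithm
  using (⌊log₂_⌋; ⌊log₂⌋-mono-≤; ⌊log₂⌊n/2⌋⌋≡⌊log₂n⌋∸1; ⌊log₂[2^n]⌋≡n)
open import Data.Nat.Primality using (Prime; prime?)
import Data.Nat.Properties as ℕ
open import Data.Product.Base using (_×_; _,_; proj₁; ∃-syntax)
open import Data.Rational.Base as ℚ using (ℚ; 0ℚ; 1ℚ; ½; Positive; _/_; ∣_∣)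
import Data.Rational.Properties as ℚ
open import Data.Rational.Solver using (module +-*-Solver)
open import Data.Rational.Unnormalised.Base as ℚᵘ using (mkℚᵘ)
import Data.Rational.Unnormalised.Properties as ℚᵘ
open import Data.Sum.Base using (inj₁; inj₂)
open import Level using (Level; 0ℓ)
open import Relation.Binary.PropositionalEquality
  using (_≡_; refl; sym; trans; cong; cong₂; subst; subst₂; isEquivalence; module ≡-Reasoning)
open import Relation.Nullary using (Dec; yes; no; ¬_; contradiction; map′; _×-dec_; _⊎-dec_; ¬?)

private
  variable
    a ℓ : Level

-- Real numbers are Cauchy sequences of rationals (with a modulus of convergence);
-- two sequences denote the same real when each is ≤ℝ the other.

IsCauchy : (ℕ → ℚ) → Set
IsCauchy x = ∀ ε → .{{Positive ε}} →
  ∃[ N ] ∀ i j → N ℕ.≤ i → N ℕ.≤ j → ∣ x i ℚ.- x j ∣ ℚ.≤ ε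

record ℝ : Set where
  constructor mkℝ
  field
    seq      : ℕ → ℚ
    isCauchy : IsCauchy seq

open ℝ public

infix 4 _≤ℝ_ _<ℝ_

_≤ℝ_ : ℝ → ℝ → Set
x ≤ℝ y = ∀ ε → .{{Positive ε}} → ∃[ N ] ∀ i → N ℕ.≤ i → seq x i ℚ.≤ seq y i ℚ.+ ε

_<ℝ_ : ℝ → ℝ → Set
x <ℝ y = ∃[ ε ] Positive ε × ∃[ N ] ∀ i → N ℕ.≤ i → seq x i ℚ.+ ε ℚ.≤ seq y i

open +-*-Solver

half+half : ∀ ε → ½ ℚ.* ε ℚ.+ ½ ℚ.* ε ≡ ε
half+half ε = trans (sym (ℚ.*-distribʳ-+ ε ½ ½)) (ℚ.*-identityˡ ε)

cauchy-+ : ∀ x y → IsCauchy x → IsCauchy y → IsCauchy (λ i → x i ℚ.+ y i)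
cauchy-+ x y cx cy ε
  with M , p ← cx (½ ℚ.* ε) {{ℚ.pos*pos⇒pos ½ ε}}
     | N , q ← cy (½ ℚ.* ε) {{ℚ.pos*pos⇒pos ½ ε}}
  = M ℕ.⊔ N , λ i j M⊔N≤i M⊔N≤j → begin
    ∣ (x i ℚ.+ y i) ℚ.- (x j ℚ.+ y j) ∣
      ≡⟨ cong ∣_∣ (solve 4 (λ a b c d → (a :+ b) :- (c :+ d) := (a :- c) :+ (b :- d))
                     refl (x i) (y i) (x j) (y j)) ⟩
    ∣ (x i ℚ.- x j) ℚ.+ (y i ℚ.- y j) ∣
      ≤⟨ ℚ.∣p+q∣≤∣p∣+∣q∣ (x i ℚ.- x j) (y i ℚ.- y j) ⟩
    ∣ x i ℚ.- x j ∣ ℚ.+ ∣ y i ℚ.- y j ∣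
      ≤⟨ ℚ.+-mono-≤ (p i j (ℕ.m⊔n≤o⇒m≤o M N M⊔N≤i) (ℕ.m⊔n≤o⇒m≤o M N M⊔N≤j))
                    (q i j (ℕ.m⊔n≤o⇒n≤o M N M⊔N≤i) (ℕ.m⊔n≤o⇒n≤o M N M⊔N≤j)) ⟩
    ½ ℚ.* ε ℚ.+ ½ ℚ.* ε ≡⟨ half+half ε ⟩
    ε ∎
  where open ℚ.≤-Reasoning

cauchy-neg : ∀ x → IsCauchy x → IsCauchy (λ i → ℚ.- x i)
cauchy-neg x cx ε with N , p ← cx ε = N , λ i j N≤i N≤j →
  subst (ℚ._≤ ε)
    (trans (sym (ℚ.∣-p∣≡∣p∣ (x i ℚ.- x j)))
           (cong ∣_∣ (solve 2 (λ a b → :- (a :- b) := :- a :- :- b) refl (x i) (x j))))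
    (p i j N≤i N≤j)

cauchy-bounded : ∀ x → IsCauchy x →
  ∃[ B ] Positive B × ∃[ N ] ∀ i → N ℕ.≤ i → ∣ x i ∣ ℚ.≤ B
cauchy-bounded x cx with N , p ← cx 1ℚ =
  ∣ x N ∣ ℚ.+ 1ℚ , ℚ.nonNeg+pos⇒pos ∣ x N ∣ {{ℚ.∣-∣-nonNeg (x N)}} 1ℚ , N , λ i N≤i → begin
    ∣ x i ∣ ≡⟨ cong ∣_∣ (solve 2 (λ a b → a := b :+ (a :- b)) refl (x i) (x N)) ⟩
    ∣ x N ℚ.+ (x i ℚ.- x N) ∣ ≤⟨ ℚ.∣p+q∣≤∣p∣+∣q∣ (x N) (x i ℚ.- x N) ⟩
    ∣ x N ∣ ℚ.+ ∣ x i ℚ.- x N ∣ ≤⟨ ℚ.+-monoʳ-≤ ∣ x N ∣ (p i N N≤i ℕ.≤-refl) ⟩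
    ∣ x N ∣ ℚ.+ 1ℚ ∎
  where open ℚ.≤-Reasoning

*-≤ : ∀ p q r s → ℚ.NonNegative q → ℚ.NonNegative r →
      p ℚ.≤ r → q ℚ.≤ s → p ℚ.* q ℚ.≤ r ℚ.* s
*-≤ p q r s q≥0 r≥0 p≤r q≤s =
  ℚ.≤-trans (ℚ.*-monoʳ-≤-nonNeg q {{q≥0}} p≤r) (ℚ.*-monoˡ-≤-nonNeg r {{r≥0}} q≤s)

cancel-scale : ∀ B .{{_ : Positive B}} e → B ℚ.* (e ℚ.* (ℚ.1/ B) {{ℚ.pos⇒nonZero B}}) ≡ e
cancel-scale B e = begin
  B ℚ.* (e ℚ.* 1/B) ≡⟨ cong (B ℚ.*_) (ℚ.*-comm e 1/B) ⟩
  B ℚ.* (1/B ℚ.* e) ≡⟨ ℚ.*-assoc B 1/B e ⟨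
  B ℚ.* 1/B ℚ.* e   ≡⟨ cong (ℚ._* e) (ℚ.*-inverseʳ B {{ℚ.pos⇒nonZero B}}) ⟩
  1ℚ ℚ.* e          ≡⟨ ℚ.*-identityˡ e ⟩
  e                 ∎
  where
  open ≡-Reasoning
  1/B : ℚ
  1/B = (ℚ.1/ B) {{ℚ.pos⇒nonZero B}}

scale : ∀ B → Positive B → ∀ ε → Positive ε → ∃[ δ ] Positive δ × B ℚ.* δ ≡ ε
scale B B>0 ε ε>0 =
  ε ℚ.* (ℚ.1/ B) {{ℚ.pos⇒nonZero B {{B>0}}}} ,
  ℚ.pos*pos⇒pos ε {{ε>0}} ((ℚ.1/ B) {{ℚ.pos⇒nonZero B {{B>0}}}}) {{ℚ.1/pos⇒pos B {{B>0}}}} ,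
  cancel-scale B {{B>0}} ε

diff-* : ∀ a b c d → a ℚ.* b ℚ.- c ℚ.* d ≡ a ℚ.* (b ℚ.- d) ℚ.+ d ℚ.* (a ℚ.- c)
diff-* = solve 4 (λ a b c d → a :* b :- c :* d := a :* (b :- d) :+ d :* (a :- c)) refl

diff-*-≤ : ∀ a b c d A δA B δB → Positive A → Positive B →
  ∣ a ∣ ℚ.≤ A → ∣ b ℚ.- d ∣ ℚ.≤ δA → ∣ d ∣ ℚ.≤ B → ∣ a ℚ.- c ∣ ℚ.≤ δB →
  ∣ a ℚ.* b ℚ.- c ℚ.* d ∣ ℚ.≤ A ℚ.* δA ℚ.+ B ℚ.* δB
diff-*-≤ a b c d A δA B δB A>0 B>0 h₁ h₂ h₃ h₄ = begin
  ∣ a ℚ.* b ℚ.- c ℚ.* d ∣ ≡⟨ cong ∣_∣ (diff-* a b c d) ⟩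
  ∣ a ℚ.* u ℚ.+ d ℚ.* v ∣ ≤⟨ ℚ.∣p+q∣≤∣p∣+∣q∣ (a ℚ.* u) (d ℚ.* v) ⟩
  ∣ a ℚ.* u ∣ ℚ.+ ∣ d ℚ.* v ∣ ≡⟨ cong₂ ℚ._+_ (ℚ.∣p*q∣≡∣p∣*∣q∣ a u) (ℚ.∣p*q∣≡∣p∣*∣q∣ d v) ⟩
  ∣ a ∣ ℚ.* ∣ u ∣ ℚ.+ ∣ d ∣ ℚ.* ∣ v ∣
    ≤⟨ ℚ.+-mono-≤ {∣ a ∣ ℚ.* ∣ u ∣} {A ℚ.* δA} {∣ d ∣ ℚ.* ∣ v ∣} {B ℚ.* δB}
         (*-≤ ∣ a ∣ ∣ u ∣ A δA (ℚ.∣-∣-nonNeg u) (ℚ.pos⇒nonNeg A {{A>0}}) h₁ h₂)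
         (*-≤ ∣ d ∣ ∣ v ∣ B δB (ℚ.∣-∣-nonNeg v) (ℚ.pos⇒nonNeg B {{B>0}}) h₃ h₄) ⟩
  A ℚ.* δA ℚ.+ B ℚ.* δB ∎
  where
  open ℚ.≤-Reasoning
  u v : ℚ
  u = b ℚ.- d
  v = a ℚ.- c

cauchy-* : ∀ x y → IsCauchy x → IsCauchy y → IsCauchy (λ i → x i ℚ.* y i)
cauchy-* x y cx cy ε =
  let A , A>0 , K , a = cauchy-bounded x cx
      B , B>0 , L , b = cauchy-bounded y cy
      δA , δA>0 , A*δA≡½ε = scale A A>0 (½ ℚ.* ε) (ℚ.pos*pos⇒pos ½ ε)
      δB , δB>0 , B*δB≡½ε = scale B B>0 (½ ℚ.* ε) (ℚ.pos*pos⇒pos ½ ε)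
      M , p = cx δB {{δB>0}}
      N , q = cy δA {{δA>0}}
      K⊔L = K ℕ.⊔ L
      M⊔N = M ℕ.⊔ N
  in K⊔L ℕ.⊔ M⊔N , λ i j h k →
    let K⊔L≤i = ℕ.m⊔n≤o⇒m≤o K⊔L M⊔N h
        K⊔L≤j = ℕ.m⊔n≤o⇒m≤o K⊔L M⊔N k
        M⊔N≤i = ℕ.m⊔n≤o⇒n≤o K⊔L M⊔N h
        M⊔N≤j = ℕ.m⊔n≤o⇒n≤o K⊔L M⊔N k
    in subst (∣ x i ℚ.* y i ℚ.- x j ℚ.* y j ∣ ℚ.≤_)
         (trans (cong₂ ℚ._+_ A*δA≡½ε B*δB≡½ε) (half+half ε))
         (diff-*-≤ (x i) (y i) (x j) (y j) A δA B δB A>0 B>0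
           (a i (ℕ.m⊔n≤o⇒m≤o K L K⊔L≤i))
           (q i j (ℕ.m⊔n≤o⇒n≤o M N M⊔N≤i) (ℕ.m⊔n≤o⇒n≤o M N M⊔N≤j))
           (b j (ℕ.m⊔n≤o⇒n≤o K L K⊔L≤j))
           (p i j (ℕ.m⊔n≤o⇒m≤o M N M⊔N≤i) (ℕ.m⊔n≤o⇒m≤o M N M⊔N≤j)))

cauchy-const : ∀ q → IsCauchy (λ _ → q)
cauchy-const q ε = 0 , λ _ _ _ _ → begin
  ∣ q ℚ.- q ∣ ≡⟨ cong ∣_∣ (ℚ.+-inverseʳ q) ⟩
  0ℚ         ≤⟨ ℚ.<⇒≤ (ℚ.positive⁻¹ ε) ⟩
  ε          ∎
  where open ℚ.≤-Reasoning

infixl 6 _+ℝ_ _-ℝ_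
infixl 7 _*ℝ_
infixr 8 _^ℝ_

fromℕ : ℕ → ℝ
fromℕ n = mkℝ (λ _ → + n / 1) (cauchy-const (+ n / 1))

0ℝ : ℝ
0ℝ = fromℕ 0

_+ℝ_ : ℝ → ℝ → ℝ
x +ℝ y = mkℝ (λ i → seq x i ℚ.+ seq y i) (cauchy-+ (seq x) (seq y) (isCauchy x) (isCauchy y))

_-ℝ_ : ℝ → ℝ → ℝ
x -ℝ y = mkℝ (λ i → seq x i ℚ.- seq y i)
  (cauchy-+ (seq x) (λ i → ℚ.- seq y i) (isCauchy x) (cauchy-neg (seq y) (isCauchy y)))

_*ℝ_ : ℝ → ℝ → ℝ
x *ℝ y = mkℝ (λ i → seq x i ℚ.* seq y i) (cauchy-* (seq x) (seq y) (isCauchy x) (isCauchy y))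

_^ℝ_ : ℝ → ℕ → ℝ
x ^ℝ zero  = fromℕ 1
x ^ℝ suc n = x *ℝ x ^ℝ n

/-≤ : ∀ a b c d → a ℕ.* suc d ℕ.≤ c ℕ.* suc b → + a / suc b ℚ.≤ + c / suc d
/-≤ a b c d h = ℚ.toℚᵘ-cancel-≤ (begin
  ℚ.toℚᵘ (+ a / suc b) ≃⟨ ℚ.toℚᵘ-fromℚᵘ (mkℚᵘ (+ a) b) ⟩
  mkℚᵘ (+ a) b         ≤⟨ ℚᵘ.*≤* (subst₂ ℤ._≤_ (ℤ.pos-* a (suc d)) (ℤ.pos-* c (suc b)) (ℤ.+≤+ h)) ⟩
  mkℚᵘ (+ c) d         ≃⟨ ℚ.toℚᵘ-fromℚᵘ (mkℚᵘ (+ c) d) ⟨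
  ℚ.toℚᵘ (+ c / suc d) ∎)
  where open ℚᵘ.≤-Reasoning

suc-/ : ∀ a b → + suc a / suc b ≡ + a / suc b ℚ.+ + 1 / suc b
suc-/ a b = ℚ.toℚᵘ-injective (begin
  ℚ.toℚᵘ (+ suc a / suc b) ≈⟨ ℚ.toℚᵘ-fromℚᵘ (mkℚᵘ (+ suc a) b) ⟩
  mkℚᵘ (+ suc a) b ≈⟨ ℚᵘ.*≡* eq ⟩
  mkℚᵘ (+ a) b ℚᵘ.+ mkℚᵘ (+ 1) b
    ≈⟨ ℚᵘ.+-cong (ℚ.toℚᵘ-fromℚᵘ (mkℚᵘ (+ a) b)) (ℚ.toℚᵘ-fromℚᵘ (mkℚᵘ (+ 1) b)) ⟨
  ℚ.toℚᵘ (+ a / suc b) ℚᵘ.+ ℚ.toℚᵘ (+ 1 / suc b) ≈⟨ ℚ.toℚᵘ-homo-+ (+ a / suc b) (+ 1 / suc b) ⟨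
  ℚ.toℚᵘ (+ a / suc b ℚ.+ + 1 / suc b) ∎)
  where
  open import Relation.Binary.Reasoning.Setoid ℚᵘ.≃-setoid
  eq : + suc a ℤ.* + (suc b ℕ.* suc b) ≡ (+ a ℤ.* + suc b ℤ.+ + 1 ℤ.* + suc b) ℤ.* + suc b
  eq = trans (cong (+ suc a ℤ.*_) (ℤ.pos-* (suc b) (suc b)))
      (trans (sym (ℤ.*-assoc (+ suc a) (+ suc b) (+ suc b)))
             (cong (ℤ._* + suc b)
               (trans (cong (ℤ._* + suc b) (trans (cong +_ (ℕ.+-comm 1 a)) (ℤ.pos-+ a 1)))
                      (ℤ.*-distribʳ-+ (+ suc b) (+ a) (+ 1)))))

∣-∣-≤ : ∀ p q ε → p ℚ.- q ℚ.≤ ε → q ℚ.- p ℚ.≤ ε → ∣ p ℚ.- q ∣ ℚ.≤ ε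
∣-∣-≤ p q ε p-q≤ε q-p≤ε with ℚ.∣p∣≡p∨∣p∣≡-p (p ℚ.- q)
... | inj₁ eq = subst (ℚ._≤ ε) (sym eq) p-q≤ε
... | inj₂ eq = subst (ℚ._≤ ε)
  (sym (trans eq (solve 2 (λ a b → :- (a :- b) := b :- a) refl p q))) q-p≤ε

1/≤ : ∀ ε → .{{Positive ε}} → ∀ i → ℚ.denominatorℕ ε ℕ.≤ i → + 1 / suc i ℚ.≤ ε
1/≤ ε@(ℚ.mkℚ (+ suc a) d c) i d≤i = subst (+ 1 / suc i ℚ.≤_) (ℚ.fromℚᵘ-toℚᵘ ε)
  (/-≤ 1 i (suc a) d (begin
    1 ℕ.* suc d ≡⟨ ℕ.*-identityˡ (suc d) ⟩
    suc d ≤⟨ d≤i ⟩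
    i ≤⟨ ℕ.n≤1+n i ⟩
    suc i ≤⟨ ℕ.m≤n*m (suc i) (suc a) ⟩
    suc a ℕ.* suc i ∎))
  where open ℕ.≤-Reasoning

cauchy-quotient : (f : ℕ → ℕ) → (∀ p q → .{{NonZero p}} → .{{NonZero q}} → f p ℕ.* q ℕ.≤ suc (f q) ℕ.* p) →
  IsCauchy (λ i → + f (suc i) / suc i)
cauchy-quotient f h ε = ℚ.denominatorℕ ε , λ i j d≤i d≤j → ∣-∣-≤ (x i) (x j) ε (side i j d≤j) (side j i d≤i)
  where
  x : ℕ → ℚ
  x i = + f (suc i) / suc i
  side : ∀ i j → ℚ.denominatorℕ ε ℕ.≤ j → x i ℚ.- x j ℚ.≤ ε
  side i j d≤j = begin
    x i ℚ.- x j ≤⟨ ℚ.+-monoˡ-≤ (ℚ.- x j) (/-≤ (f (suc i)) i (suc (f (suc j))) j (h (suc i) (suc j))) ⟩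
    + suc (f (suc j)) / suc j ℚ.- x j ≡⟨ cong (ℚ._- x j) (suc-/ (f (suc j)) j) ⟩
    x j ℚ.+ + 1 / suc j ℚ.- x j ≡⟨ solve 2 (λ a b → a :+ b :- a := b) refl (x j) (+ 1 / suc j) ⟩
    + 1 / suc j ≤⟨ 1/≤ ε j d≤j ⟩
    ε ∎
    where open ℚ.≤-Reasoning

2^⌊log₂n⌋≤n : ∀ n → .{{NonZero n}} → 2 ℕ.^ ⌊log₂ n ⌋ ℕ.≤ n
2^⌊log₂n⌋≤n = <-rec _ go
  where
  open ℕ.≤-Reasoning
  go : ∀ n → (∀ {k} → k ℕ.< n → .{{NonZero k}} → 2 ℕ.^ ⌊log₂ k ⌋ ℕ.≤ k) →
       .{{NonZero n}} → 2 ℕ.^ ⌊log₂ n ⌋ ℕ.≤ n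
  go 1 _ = ℕ.≤-refl
  go n@(suc (suc m)) rec = begin
    2 ℕ.^ ⌊log₂ n ⌋ ≤⟨ ℕ.^-monoʳ-≤ 2 (ℕ.m≤n+m∸n ⌊log₂ n ⌋ 1) ⟩
    2 ℕ.^ suc (⌊log₂ n ⌋ ℕ.∸ 1) ≡⟨ cong (λ l → 2 ℕ.^ suc l) (⌊log₂⌊n/2⌋⌋≡⌊log₂n⌋∸1 n) ⟨
    2 ℕ.* 2 ℕ.^ ⌊log₂ half ⌋ ≤⟨ ℕ.*-monoʳ-≤ 2 (rec (ℕ.⌊n/2⌋<n (suc m))) ⟩
    2 ℕ.* half ≡⟨ cong (half ℕ.+_) (ℕ.+-identityʳ half) ⟩
    half ℕ.+ half ≤⟨ ℕ.+-monoʳ-≤ half (ℕ.⌊n/2⌋≤⌈n/2⌉ n) ⟩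
    half ℕ.+ ℕ.⌈ n /2⌉ ≡⟨ ℕ.⌊n/2⌋+⌈n/2⌉≡n n ⟩
    n ∎
    where
    half : ℕ
    half = ℕ.⌊ n /2⌋

n<2^1+⌊log₂n⌋ : ∀ n → n ℕ.< 2 ℕ.^ suc ⌊log₂ n ⌋
n<2^1+⌊log₂n⌋ n = ℕ.≰⇒> λ 2^≤n → ℕ.1+n≰n
  (subst (ℕ._≤ ⌊log₂ n ⌋) (⌊log₂[2^n]⌋≡n (suc ⌊log₂ n ⌋)) (⌊log₂⌋-mono-≤ 2^≤n))

^-cancel-< : ∀ b → .{{NonZero b}} → ∀ {u v} → b ℕ.^ u ℕ.< b ℕ.^ v → u ℕ.< v
^-cancel-< b h = ℕ.≰⇒> λ v≤u → ℕ.<⇒≱ h (ℕ.^-monoʳ-≤ b v≤u)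

log-quotient : ∀ r p q → .{{NonZero p}} → .{{NonZero q}} →
  ⌊log₂ r ℕ.^ p ⌋ ℕ.* q ℕ.≤ suc ⌊log₂ r ℕ.^ q ⌋ ℕ.* p
log-quotient zero (suc _) q = ℕ.z≤n
log-quotient r@(suc _) p q = ℕ.<⇒≤ (^-cancel-< 2 (begin-strict
  2 ℕ.^ (⌊log₂ r ℕ.^ p ⌋ ℕ.* q) ≡⟨ ℕ.^-*-assoc 2 ⌊log₂ r ℕ.^ p ⌋ q ⟨
  (2 ℕ.^ ⌊log₂ r ℕ.^ p ⌋) ℕ.^ q ≤⟨ ℕ.^-monoˡ-≤ q (2^⌊log₂n⌋≤n (r ℕ.^ p) {{ℕ.m^n≢0 r p}}) ⟩
  (r ℕ.^ p) ℕ.^ q ≡⟨ ℕ.^-*-assoc r p q ⟩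
  r ℕ.^ (p ℕ.* q) ≡⟨ cong (r ℕ.^_) (ℕ.*-comm p q) ⟩
  r ℕ.^ (q ℕ.* p) ≡⟨ ℕ.^-*-assoc r q p ⟨
  (r ℕ.^ q) ℕ.^ p <⟨ ℕ.^-monoˡ-< p (n<2^1+⌊log₂n⌋ (r ℕ.^ q)) ⟩
  (2 ℕ.^ suc ⌊log₂ r ℕ.^ q ⌋) ℕ.^ p ≡⟨ ℕ.^-*-assoc 2 (suc ⌊log₂ r ℕ.^ q ⌋) p ⟩
  2 ℕ.^ (suc ⌊log₂ r ℕ.^ q ⌋ ℕ.* p) ∎))
  where open ℕ.≤-Reasoning

-- ⌊log₂ (rᵖ)⌋ / p = ⌊p·log₂ r⌋ / p tends to log₂ r as p → ∞.  (log₂ 0 is a junk value.)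
log₂ : ℕ → ℝ
log₂ r = mkℝ (λ i → + ⌊log₂ r ℕ.^ suc i ⌋ / suc i)
             (cauchy-quotient (λ p → ⌊log₂ r ℕ.^ p ⌋) (log-quotient r))

searchRoot : (m a b : ℕ) → ℕ
searchRoot m a zero    = zero
searchRoot m a (suc b) with suc b ℕ.^ m ℕ.≤? a
... | yes _ = suc b
... | no  _ = searchRoot m a b

-- The largest b with b ^ m ≤ a, for m ≥ 1.
⌊root⌋ : ℕ → ℕ → ℕ
⌊root⌋ m a = searchRoot m a a

searchRoot-^≤ : ∀ m a b → .{{NonZero m}} → searchRoot m a b ℕ.^ m ℕ.≤ a
searchRoot-^≤ (suc m) a zero = ℕ.z≤n
searchRoot-^≤ m a (suc b) with suc b ℕ.^ m ℕ.≤? a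
... | yes h = h
... | no  _ = searchRoot-^≤ m a b

searchRoot-max : ∀ m a b c → c ℕ.≤ b → c ℕ.^ m ℕ.≤ a → c ℕ.≤ searchRoot m a b
searchRoot-max m a zero c c≤b _ = c≤b
searchRoot-max m a (suc b) c c≤1+b h with suc b ℕ.^ m ℕ.≤? a
... | yes _ = c≤1+b
... | no ¬p with ℕ.m≤n⇒m<n∨m≡n c≤1+b
...   | inj₁ c<1+b = searchRoot-max m a b c (ℕ.s≤s⁻¹ c<1+b) h
...   | inj₂ refl  = contradiction h ¬p

m≤m^n : ∀ m n → .{{NonZero n}} → m ℕ.≤ m ℕ.^ n
m≤m^n zero    n       = ℕ.z≤n
m≤m^n m@(suc _) (suc n) = ℕ.m≤m*n m (m ℕ.^ n) {{ℕ.m^n≢0 m n}}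

<1+⌊root⌋^ : ∀ m a → .{{NonZero m}} → a ℕ.< suc (⌊root⌋ m a) ℕ.^ m
<1+⌊root⌋^ m a = ℕ.≰⇒> λ h → ℕ.1+n≰n
  (searchRoot-max m a a (suc (⌊root⌋ m a)) (ℕ.≤-trans (m≤m^n (suc (⌊root⌋ m a)) m) h) h)

^-distribʳ-* : ∀ m a b → (a ℕ.* b) ℕ.^ m ≡ a ℕ.^ m ℕ.* b ℕ.^ m
^-distribʳ-* zero a b = refl
^-distribʳ-* (suc m) a b = trans (cong (a ℕ.* b ℕ.*_) (^-distribʳ-* m a b))
  (ℕ.[m*n]*[o*p]≡[m*o]*[n*p] a b (a ℕ.^ m) (b ℕ.^ m))

root-quotient : ∀ m a → .{{NonZero m}} → ∀ p q → .{{NonZero p}} → .{{NonZero q}} →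
  ⌊root⌋ m (a ℕ.* p ℕ.^ m) ℕ.* q ℕ.≤ suc (⌊root⌋ m (a ℕ.* q ℕ.^ m)) ℕ.* p
root-quotient m a p q = ℕ.<⇒≤ (ℕ.≰⇒> λ v≤u → ℕ.<⇒≱ lt (ℕ.^-monoˡ-≤ m v≤u))
  where
  u v : ℕ
  u = ⌊root⌋ m (a ℕ.* p ℕ.^ m)
  v = suc (⌊root⌋ m (a ℕ.* q ℕ.^ m))
  open ℕ.≤-Reasoning
  lt : (u ℕ.* q) ℕ.^ m ℕ.< (v ℕ.* p) ℕ.^ m
  lt = begin-strict
    (u ℕ.* q) ℕ.^ m ≡⟨ ^-distribʳ-* m u q ⟩
    u ℕ.^ m ℕ.* q ℕ.^ m ≤⟨ ℕ.*-monoˡ-≤ (q ℕ.^ m) (searchRoot-^≤ m (a ℕ.* p ℕ.^ m) (a ℕ.* p ℕ.^ m)) ⟩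
    a ℕ.* p ℕ.^ m ℕ.* q ℕ.^ m ≡⟨ ℕ.*-assoc a (p ℕ.^ m) (q ℕ.^ m) ⟩
    a ℕ.* (p ℕ.^ m ℕ.* q ℕ.^ m) ≡⟨ cong (a ℕ.*_) (ℕ.*-comm (p ℕ.^ m) (q ℕ.^ m)) ⟩
    a ℕ.* (q ℕ.^ m ℕ.* p ℕ.^ m) ≡⟨ ℕ.*-assoc a (q ℕ.^ m) (p ℕ.^ m) ⟨
    a ℕ.* q ℕ.^ m ℕ.* p ℕ.^ m
      <⟨ ℕ.*-monoˡ-< (p ℕ.^ m) {{ℕ.m^n≢0 p m}} (<1+⌊root⌋^ m (a ℕ.* q ℕ.^ m)) ⟩
    v ℕ.^ m ℕ.* p ℕ.^ m ≡⟨ ^-distribʳ-* m v p ⟨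
    (v ℕ.* p) ℕ.^ m ∎

-- The real m-th root a^(1/m), as the limit of ⌊p·a^(1/m)⌋ / p with
-- ⌊p·a^(1/m)⌋ = ⌊root⌋ m (a·pᵐ).
root : (m : ℕ) → .{{NonZero m}} → ℕ → ℝ
root m a = mkℝ (λ i → + ⌊root⌋ m (a ℕ.* suc i ℕ.^ m) / suc i)
               (cauchy-quotient (λ p → ⌊root⌋ m (a ℕ.* p ℕ.^ m)) (root-quotient m a))

-- n^(1 - 1/m) = (n^(m-1))^(1/m).
_^[1-1/_] : ℕ → (m : ℕ) → .{{NonZero m}} → ℝ
n ^[1-1/ m ] = root m (n ℕ.^ (m ℕ.∸ 1))

module _ (n : ℕ) .{{_ : NonZero n}} where

  toℕ-mod : ∀ a → toℕ (a mod n) ≡ a % n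
  toℕ-mod a = Fin.toℕ-fromℕ< (m%n<n a n)

  mod-cong : ∀ {a b} → a % n ≡ b % n → a mod n ≡ b mod n
  mod-cong {a} {b} eq = Fin.toℕ-injective (trans (toℕ-mod a) (trans eq (sym (toℕ-mod b))))

  mod-toℕ : ∀ (i : Fin n) → toℕ i mod n ≡ i
  mod-toℕ i = Fin.toℕ-injective (trans (toℕ-mod (toℕ i)) (m<n⇒m%n≡m (Fin.toℕ<n i)))

  mod-+ˡ : ∀ a b → (toℕ (a mod n) ℕ.+ b) mod n ≡ (a ℕ.+ b) mod n
  mod-+ˡ a b = mod-cong (begin
    (toℕ (a mod n) ℕ.+ b) % n        ≡⟨ cong (λ c → (c ℕ.+ b) % n) (toℕ-mod a) ⟩
    (a % n ℕ.+ b) % n                ≡⟨ %-distribˡ-+ (a % n) b n ⟩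
    (a % n % n ℕ.+ b % n) % n        ≡⟨ cong (λ c → (c ℕ.+ b % n) % n) (m%n%n≡m%n a n) ⟩
    (a % n ℕ.+ b % n) % n            ≡⟨ %-distribˡ-+ a b n ⟨
    (a ℕ.+ b) % n                    ∎)
    where open ≡-Reasoning

  mod-+ʳ : ∀ a b → (a ℕ.+ toℕ (b mod n)) mod n ≡ (a ℕ.+ b) mod n
  mod-+ʳ a b = trans (cong (_mod n) (ℕ.+-comm a _))
    (trans (mod-+ˡ b a) (cong (_mod n) (ℕ.+-comm b a)))

  C : AbelianGroup 0ℓ 0ℓ
  C = record
    { Carrier = Fin n
    ; _≈_     = _≡_
    ; _∙_     = _+ₙ_
    ; ε       = 0 mod n
    ; _⁻¹     = λ i → (n ℕ.∸ toℕ i) mod n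
    ; isAbelianGroup = record
      { isGroup = record
        { isMonoid = record
          { isSemigroup = record
            { isMagma = record { isEquivalence = isEquivalence ; ∙-cong = cong₂ _+ₙ_ }
            ; assoc = λ i j k →
                trans (mod-+ˡ (toℕ i ℕ.+ toℕ j) (toℕ k))
                (trans (cong (_mod n) (ℕ.+-assoc (toℕ i) (toℕ j) (toℕ k)))
                       (sym (mod-+ʳ (toℕ i) (toℕ j ℕ.+ toℕ k))))
            }
          ; identity = (λ i → trans (mod-+ˡ 0 (toℕ i)) (mod-toℕ i))
                     , (λ i → trans (mod-+ʳ (toℕ i) 0)
                                (trans (cong (_mod n) (ℕ.+-identityʳ (toℕ i))) (mod-toℕ i)))
          }
        ; inverse = (λ i → trans (mod-+ˡ (n ℕ.∸ toℕ i) (toℕ i))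
                             (trans (cong (_mod n) (ℕ.m∸n+n≡m (Fin.toℕ≤n i))) n-mod))
                  , (λ i → trans (mod-+ʳ (toℕ i) (n ℕ.∸ toℕ i))
                             (trans (cong (_mod n) (ℕ.m+[n∸m]≡n (Fin.toℕ≤n i))) n-mod))
        ; ⁻¹-cong = cong λ i → (n ℕ.∸ toℕ i) mod n
        }
      ; comm = λ i j → cong (_mod n) (ℕ.+-comm (toℕ i) (toℕ j))
      }
    }
    where
    _+ₙ_ : Fin n → Fin n → Fin n
    i +ₙ j = (toℕ i ℕ.+ toℕ j) mod n
    n-mod : n mod n ≡ 0 mod n
    n-mod = mod-cong (trans (n%n≡0 n) (sym (m*n%n≡0 0 n)))

C^ : (n r : ℕ) .{{_ : NonZero n}} → AbelianGroup 0ℓ 0ℓ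
C^ n r = Pointwise.abelianGroup (Fin r) (C n)

module _ (G : AbelianGroup a ℓ) where
  open AbelianGroup G using (Carrier; _≈_; _∙_; ε)

  σ : List Carrier → Carrier
  σ = foldr _∙_ ε

  -- A finite unordered sequence is represented by a list in any order: the
  -- sub-multisets of S are, up to order, exactly the sublists of S.
  HasZeroSum : ℕ → List Carrier → Set _
  HasZeroSum l S = ∃[ T ] T ⊆ S × length T ≡ l × σ T ≈ ε

  Forces : ℕ → ℕ → Set _
  Forces l t = ∀ S → t ℕ.≤ length S → HasZeroSum l S

  Is𝗌 : ℕ → ℕ → Set _
  Is𝗌 l t = 1 ℕ.≤ t × Forces l t × (∀ u → 1 ℕ.≤ u → Forces l u → t ℕ.≤ u)

least : ∀ {p} {P : ℕ → Set p} → (∀ t → Dec (P t)) → ∀ b → 1 ℕ.≤ b → P b →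
  ∃[ t ] 1 ℕ.≤ t × P t × (∀ u → 1 ℕ.≤ u → P u → t ℕ.≤ u)
least {P = P} P? b 1≤b Pb =
  go (b ℕ.∸ 1) 1 (ℕ.m∸n+n≡m 1≤b) ℕ.≤-refl λ _ 1≤u _ → 1≤u
  where
  go : ∀ d t → d ℕ.+ t ≡ b → 1 ℕ.≤ t → (∀ u → 1 ℕ.≤ u → P u → t ℕ.≤ u) →
    ∃[ t ] 1 ℕ.≤ t × P t × (∀ u → 1 ℕ.≤ u → P u → t ℕ.≤ u)
  go zero    t refl 1≤t min = t , 1≤t , Pb , min
  go (suc d) t eq   1≤t min with P? t
  ... | yes Pt = t , 1≤t , Pt , min
  ... | no ¬Pt = go d (suc t) (trans (ℕ.+-suc d t) eq) (ℕ.m≤n⇒m≤1+n 1≤t) λ u 1≤u Pu →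
    ℕ.≤∧≢⇒< (min u 1≤u Pu) λ { refl → ¬Pt Pu }

length-filter-¬ : ∀ {A : Set a} {P : A → Set ℓ} (P? : ∀ x → Dec (P x)) S →
  length (filter P? S) ℕ.+ length (filter (λ x → ¬? (P? x)) S) ≡ length S
length-filter-¬ P? [] = refl
length-filter-¬ P? (x ∷ S) with P? x
... | yes _ = cong suc (length-filter-¬ P? S)
... | no  _ = trans (ℕ.+-suc _ _) (cong suc (length-filter-¬ P? S))

pigeonhole : ∀ {A : Set a} (colour : A → ℕ) N l S →
  All (λ x → colour x ℕ.< N) S → N ℕ.* l ℕ.< length S →
  ∃[ c ] ∃[ T ] T ⊆ S × length T ≡ l × All (λ x → colour x ≡ c) T
pigeonhole colour zero l (x ∷ S) (() ∷ _) _
pigeonhole colour (suc N) l S colour< big with l ℕ.≤? length (filter (λ x → colour x ℕ.≟ N) S)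
... | yes l≤ = N , take l S₌ , ⊆-trans (take-⊆ l S₌) (filter-⊆ P? S) ,
               trans (length-take l S₌) (ℕ.m≤n⇒m⊓n≡m l≤) , take⁺ l (all-filter P? S)
  where
  P? : ∀ x → Dec (colour x ≡ N)
  P? x = colour x ℕ.≟ N
  S₌ : List _
  S₌ = filter P? S
... | no l≰ =
  let c , T , T⊆ , len , same = pigeonhole colour N l S≠ S≠< enough
  in c , T , ⊆-trans T⊆ (filter-⊆ ¬P? S) , len , same
  where
  P? : ∀ x → Dec (colour x ≡ N)
  P? x = colour x ℕ.≟ N
  ¬P? : ∀ x → Dec (¬ colour x ≡ N)
  ¬P? x = ¬? (P? x)
  S≠ : List _
  S≠ = filter ¬P? S
  S≠< : All (λ x → colour x ℕ.< N) S≠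
  S≠< = All.map (λ (c<1+N , c≢N) → ℕ.≤∧≢⇒< (ℕ.s≤s⁻¹ c<1+N) c≢N)
    (All.zip (filter⁺ ¬P? colour< , all-filter ¬P? S))
  enough : N ℕ.* l ℕ.< length S≠
  enough = ℕ.+-cancelˡ-< l _ _ (begin-strict
    l ℕ.+ N ℕ.* l <⟨ big ⟩
    length S ≡⟨ length-filter-¬ P? S ⟨
    length (filter P? S) ℕ.+ length S≠ ≤⟨ ℕ.+-monoˡ-≤ (length S≠) (ℕ.≰⇒≥ l≰) ⟩
    l ℕ.+ length S≠ ∎)
    where open ℕ.≤-Reasoning

module ForcesDecidable (G : AbelianGroup a ℓ)
  (_≈?_ : ∀ x y → Dec (AbelianGroup._≈_ G x y))
  {N : ℕ} (decode : Fin N → AbelianGroup.Carrier G) (code : AbelianGroup.Carrier G → Fin N)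
  (decode-code : ∀ x → AbelianGroup._≈_ G (decode (code x)) x)
  where

  open AbelianGroup G hiding (refl; sym; trans)

  HasSum : Carrier → ℕ → List Carrier → Set _
  HasSum g l S = ∃[ T ] T ⊆ S × length T ≡ l × σ G T ≈ g

  hasSum? : ∀ g l S → Dec (HasSum g l S)
  hasSum? g zero    []      = map′ (λ ε≈g → [] , [] , refl , ε≈g) (λ { (_ , [] , _ , ε≈g) → ε≈g }) (ε ≈? g)
  hasSum? g (suc l) []      = no λ { (_ , [] , () , _) }
  hasSum? g zero    (x ∷ S) = map′
    (λ (T , T⊆S , len , eq) → T , x ∷ʳ T⊆S , len , eq)
    (λ { (T , _ ∷ʳ T⊆S , len , eq) → T , T⊆S , len , eq ; (_ , _ ∷ _ , () , _) })
    (hasSum? g zero S)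
  hasSum? g (suc l) (x ∷ S) = map′
    (λ { (inj₁ (T , T⊆S , len , eq)) → T , x ∷ʳ T⊆S , len , eq
       ; (inj₂ (T , T⊆S , len , eq)) → x ∷ T , refl ∷ T⊆S , cong suc len ,
           trans′ (∙-congˡ eq) (trans′ (sym′ (assoc x (x ⁻¹) g))
             (trans′ (∙-congʳ (inverseʳ x)) (identityˡ g))) })
    (λ { (T , _ ∷ʳ T⊆S , len , eq) → inj₁ (T , T⊆S , len , eq)
       ; (_ ∷ T , refl ∷ T⊆S , len , eq) → inj₂ (T , T⊆S , ℕ.suc-injective len ,
           trans′ (sym′ (identityˡ (σ G T))) (trans′ (∙-congʳ (sym′ (inverseˡ x)))
             (trans′ (assoc (x ⁻¹) x (σ G T)) (∙-congˡ eq)))) })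
    (hasSum? g (suc l) S ⊎-dec hasSum? (x ⁻¹ ∙ g) l S)
    where open AbelianGroup G using () renaming (trans to trans′; sym to sym′)

  ⊆-resp : ∀ {S S′ T} → PW.Pointwise _≈_ S S′ → T ⊆ S →
    ∃[ T′ ] T′ ⊆ S′ × length T′ ≡ length T × σ G T′ ≈ σ G T
  ⊆-resp [] [] = [] , [] , refl , AbelianGroup.refl G
  ⊆-resp (_∷_ {y = y} _ S≈S′) (_ ∷ʳ T⊆S) =
    let T′ , T′⊆ , len , eq = ⊆-resp S≈S′ T⊆S in T′ , y ∷ʳ T′⊆ , len , eq
  ⊆-resp (_∷_ {y = y} x≈y S≈S′) (refl ∷ T⊆S) =
    let T′ , T′⊆ , len , eq = ⊆-resp S≈S′ T⊆S
    in y ∷ T′ , refl ∷ T′⊆ , cong suc len , ∙-cong (AbelianGroup.sym G x≈y) eq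

  allOfLength? : ∀ {p} (P : List Carrier → Set p) → (∀ S → Dec (P S)) →
    (∀ {S S′} → PW.Pointwise _≈_ S S′ → P S → P S′) →
    ∀ t → Dec (∀ S → length S ≡ t → P S)
  allOfLength? P P? resp zero = map′ (λ { p [] refl → p }) (λ p → p [] refl) (P? [])
  allOfLength? P P? resp (suc t) = map′
    (λ { p (x ∷ S) eq → resp (decode-code x ∷ PW.refl (AbelianGroup.refl G)) (p (code x) S (ℕ.suc-injective eq)) })
    (λ p i S eq → p (decode i ∷ S) (cong suc eq))
    (Fin.all? λ i → allOfLength? (λ S → P (decode i ∷ S)) (λ S → P? (decode i ∷ S))
      (λ S≈S′ → resp (AbelianGroup.refl G ∷ S≈S′)) t)

  forces? : ∀ l t → Dec (Forces G l t)
  forces? l t = map′ truncate (λ p S eq → p S (ℕ.≤-reflexive (sym eq)))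
    (allOfLength? (HasZeroSum G l) (hasSum? ε l) resp t)
    where
    truncate : (∀ S → length S ≡ t → HasZeroSum G l S) → Forces G l t
    truncate p S t≤ =
      let T , T⊆ , len , eq = p (take t S) (trans (length-take t S) (ℕ.m≤n⇒m⊓n≡m t≤))
      in T , ⊆-trans T⊆ (take-⊆ t S) , len , eq
    resp : ∀ {S S′} → PW.Pointwise _≈_ S S′ → HasZeroSum G l S → HasZeroSum G l S′
    resp S≈S′ (T , T⊆ , len , eq) =
      let T′ , T′⊆ , len′ , eq′ = ⊆-resp S≈S′ T⊆
      in T′ , T′⊆ , trans len′ len , AbelianGroup.trans G eq′ eq

module _ (n r : ℕ) .{{_ : NonZero n}} where
  open AbelianGroup (C^ n r) using (Carrier; _≈_; ε)

  σ-constant : ∀ i (c : Fin n) T → All (λ x → x i ≡ c) T →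
    σ (C^ n r) T i ≡ (length T ℕ.* toℕ c) mod n
  σ-constant i c [] [] = refl
  σ-constant i c (x ∷ T) (refl ∷ same) =
    trans (cong (λ j → (toℕ (x i) ℕ.+ toℕ j) mod n) (σ-constant i c T same))
          (mod-+ʳ n (toℕ (x i)) (length T ℕ.* toℕ (x i)))

  code : Carrier → Fin (n ℕ.^ r)
  code = funToFin

  code-injective : ∀ x y → code x ≡ code y → x ≈ y
  code-injective x y eq i = trans (sym (Fin.finToFun-funToFin x i))
    (trans (cong (λ c → finToFun c i) eq) (Fin.finToFun-funToFin y i))

  forces-large : ∀ k → Forces (C^ n r) (k ℕ.* n) (suc (n ℕ.^ r ℕ.* (k ℕ.* n)))
  forces-large k S big
    with pigeonhole (λ x → toℕ (code x)) (n ℕ.^ r) (k ℕ.* n) S (All.universal (λ x → Fin.toℕ<n (code x)) S) big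
  ... | _ , [] , T⊆ , len , same = [] , T⊆ , len , λ _ → refl
  ... | _ , T@(x ∷ _) , T⊆ , len , same@(cx ∷ _) = T , T⊆ , len , λ i →
    trans (σ-constant i (x i) T
            (All.map (λ {y} cy → code-injective y x (Fin.toℕ-injective (trans cy (sym cx))) i) same))
          (mod-cong n (begin
            (length T ℕ.* toℕ (x i)) % n     ≡⟨ cong (λ l → (l ℕ.* toℕ (x i)) % n) len ⟩
            (k ℕ.* n ℕ.* toℕ (x i)) % n      ≡⟨ cong (_% n) (lem k (toℕ (x i))) ⟩
            (k ℕ.* toℕ (x i) ℕ.* n) % n      ≡⟨ m*n%n≡0 (k ℕ.* toℕ (x i)) n ⟩
            0                                ≡⟨ m*n%n≡0 0 n ⟨
            0 % n                            ∎))
    where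
    open ≡-Reasoning
    lem : ∀ a b → a ℕ.* n ℕ.* b ≡ a ℕ.* b ℕ.* n
    lem a b = trans (ℕ.*-assoc a n b) (trans (cong (a ℕ.*_) (ℕ.*-comm n b)) (sym (ℕ.*-assoc a b n)))

  𝗌-exists : ∀ k → ∃[ t ] Is𝗌 (C^ n r) (k ℕ.* n) t
  𝗌-exists k = least (forces? (k ℕ.* n)) _ (ℕ.s≤s ℕ.z≤n) (forces-large k)
    where
    open ForcesDecidable (C^ n r) (λ x y → Fin.all? λ i → x i Fin.≟ y i)
      finToFun code Fin.finToFun-funToFin

-- 𝗌 k n r is s_{kn}(C_n^r); for k = 1 it is s(C_n^r).
𝗌 : (k n r : ℕ) .{{_ : NonZero n}} → ℕ
𝗌 k n r = proj₁ (𝗌-exists n r k)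

ω : ℕ → ℕ
ω n = length (filter (λ p → prime? p ×-dec p ∣? n) (upTo (suc n)))

IsPrimePower : ℕ → Set
IsPrimePower q = ∃[ p ] ∃[ a ] Prime p × 1 ℕ.≤ a × q ≡ p ℕ.^ a

Is𝖬 : ℕ → ℕ → Set
Is𝖬 n M = (IsPrimePower M × M ∣ n) × (∀ q → IsPrimePower q → q ∣ n → q ℕ.≤ M)

-- M(n) = pᵃ and v = min { pᵗ : t ≥ 1, pᵗ ≥ r }, that is, v = p(n,r).
Is𝗉 : ℕ → ℕ → ℕ → Set
Is𝗉 n r v = ∃[ p ] ∃[ a ] Prime p × 1 ℕ.≤ a × Is𝖬 n (p ℕ.^ a) ×
  ∃[ t ] 1 ℕ.≤ t × v ≡ p ℕ.^ t × r ℕ.≤ v × (∀ u → 1 ℕ.≤ u → r ℕ.≤ p ℕ.^ u → v ℕ.≤ p ℕ.^ u)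

-- (c·r·log₂ r)^r
𝖠 : ℝ → ℕ → ℝ
𝖠 c r = (c *ℝ fromℕ r *ℝ log₂ r) ^ℝ r

𝖺 : ℝ → ℕ → ℝ
𝖺 c r = 𝖠 c r -ℝ fromℕ r

-- The property for which the Alon–Dubiner theorem provides some c > 0.
IsAlonDubinerConstant : ℝ → Set
IsAlonDubinerConstant c = 0ℝ <ℝ c ×
  (∀ n r → .{{_ : NonZero n}} → 2 ℕ.≤ r → fromℕ (𝗌 1 n r) ≤ℝ 𝖠 c r *ℝ fromℕ n)

{-# OPTIONS --safe #-}
module Submission where

-- Call (c + r) q − r = cq + D(C_q^r) − 1 the length of level c.  By the polynomial method (finite
-- differences modulo p, as in Olson's theorem), for q = pᵃ a sequence S over C_q^r of level c
-- satisfies Σ (−1)^|T| f(|T|/q) ≡ 0 (mod p), summed over its zero-sum subsequences T with q ∣ |T|,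
-- for every integer-valued polynomial f of degree < c.  Choosing f to vanish at unwanted lengths
-- forces zero-sum subsequences of the other lengths jq; removing one leaves level c − j, and
-- inside one, complements are again zero-sum.  In this way every level k with pᵗ ∣ k, pᵗ ≥ r, has
-- a zero-sum subsequence of length kq, and, for p ≥ 5, so do k = 3, 4 for r = 3 and k = 4, 7 (or
-- 4, 5 if p = 5) for r = 4, hence all k ≥ 6 and all k ≥ 18.  For p = 2 and p = 3 subsequences of
-- length q are removed one at a time, using s(C_q^r) ≤ 2^r (q − 1) + 1 and, from bounds on caps in
-- 𝔽₃³ and 𝔽₃⁴, s(C_q^3) ≤ 9 (q − 1) + 1 and s(C_q^4) ≤ 23 (q − 1) + 1.
-- For general n take a prime power q ∣ n with n ≤ q^ω(n): group a long sequence over C_n^r into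
-- blocks of n/q terms with sum zero modulo n/q, and apply the above to the sums of the blocks.

open import Defs
open import Algebra.Bundles using (AbelianGroup)
open import Data.Bool.Base using (if_then_else_)
open import Data.Fin.Base as Fin using (Fin; zero; suc; toℕ; combine; finToFun; funToFin)
import Data.Fin.Properties as Fin
open import Data.Integer.Base as ℤ using (ℤ; +_)
import Data.Integer.Divisibility.Signed as ℤ
import Data.Integer.Properties as ℤ
import Data.Integer.Tactic.RingSolver as ℤ-Ring
open import Data.List.Base using (List; []; _∷_; [_]; _++_; length; map; concat; filter; take; lookup; upTo; allFin)
open import Data.List.Properties using (length-++; length-map; length-take; length-tabulate; map-++; ++-identityʳ)
open import Data.List.Membership.Propositional using (_∈_)
open import Data.List.Membership.Propositional.Properties using (∈-++⁻; ∈-filter⁺; ∈-upTo⁺)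
open import Data.List.Relation.Binary.Permutation.Propositional as ↭ using (_↭_; ↭-refl; ↭-sym; ↭-trans; ↭-prep)
import Data.List.Relation.Binary.Permutation.Propositional.Properties as ↭
open import Data.List.Relation.Binary.Sublist.Propositional using (_⊆_; []; _∷_; _∷ʳ_; ⊆-trans; minimum)
open import Data.List.Relation.Binary.Sublist.Propositional.Properties
  using (++⁺; take-⊆; filter-⊆; length-mono-≤; All-resp-⊆)
open import Data.List.Relation.Unary.All as All using (All; []; _∷_)
import Data.List.Relation.Unary.All.Properties as All
open import Data.List.Relation.Unary.AllPairs.Core using ([]; _∷_)
open import Data.List.Relation.Unary.Any as Any using (Any; here; there)
open import Data.List.Relation.Unary.Unique.Propositional using (Unique)
import Data.List.Relation.Unary.Unique.Propositional.Properties as Unique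
open import Data.Nat.Base as ℕ using (ℕ; zero; suc; NonZero; _+_; _*_; _∸_; _^_; _!; _≤_; _<_; z≤n; s≤s)
open import Data.Nat.Combinatorics
  using (nCn≡1; k>n⇒nCk≡0; nCk+nC[k+1]≡[n+1]C[k+1]; nCk≡n!/k![n-k]!; k![n∸k]!∣n!)
  renaming (_C_ to _choose_)
open import Data.Nat.Divisibility as ∣ using (_∣_; _∣?_; divides; ∣⇒≤; m%n≡0⇒n∣m; n∣m⇒m%n≡0)
open import Data.Nat.DivMod
  using (_/_; _%_; _mod_; 0/n≡0; n/n≡1; m/n*n≡m; +-distrib-/-∣ˡ; %-distribˡ-+)
open import Data.Nat.GeneralisedArithmetic using (iterate)
open import Data.Nat.Induction using (<-rec)
open import Data.Nat.ListAction using (sum; product)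
open import Data.Nat.ListAction.Properties using (sum-++; sum-↭)
open import Data.Nat.Primality
  using (Prime; prime?; prime[2]; ¬prime[1]; euclidsLemma; prime⇒irreducible; prime⇒nonTrivial; prime⇒nonZero)
open import Data.Nat.Primality.Factorisation using (factorise; PrimeFactorisation)
import Data.Nat.Properties as ℕ
import Data.Nat.Tactic.RingSolver as ℕ-Ring
open import Data.List.Membership.DecPropositional ℕ._≟_ using (_∈?_)
open import Data.Product.Base using (_×_; _,_; proj₁; proj₂; ∃-syntax)
open import Data.Rational.Base as ℚ using (ℚ; 1ℚ) renaming (_/_ to _/ℚ_)
import Data.Rational.Properties as ℚ
open import Data.Rational.Solver using (module +-*-Solver)
open import Data.Sum.Base using (_⊎_; inj₁; inj₂)
open import Data.Unit.Base using (⊤; tt)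
open import Data.Vec.Base as Vec using (Vec; []; _∷_)
import Data.Vec.Properties as Vec
open import Function.Base using (_∘_)
open import Relation.Binary.PropositionalEquality
  using (_≡_; _≢_; refl; sym; trans; cong; cong₂; subst; module ≡-Reasoning)
open import Relation.Nullary using (Dec; yes; no; does; ¬_; ¬?; contradiction; _×-dec_)
open import Relation.Nullary.Decidable using (True; toWitness; from-yes; from-no; _→-dec_; _⊎-dec_)

-- Polynomials modulo p

-- The error term stems from the cofactor n′ = n/q alone. With m = ω(n), n ≤ q^m gives n′ ≤ n^(1 -
-- 1/m). The grouping costs s(C_{n′}^r) ≤ A n′ terms, where A = (c r log₂ r)^r, and the -r in the
-- level (k + r) q - r saves r n′; hence a_r = A - r. Enlarging n′ to n^(1 - 1/m) requires a_r ≥ 0,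
-- which also follows from Alon-Dubiner, at n = 2, because s(C_2^r) > 2r. The polynomials in the
-- derivations are products of factors j - e and must not vanish at 0 modulo p, so p may divide no
-- root e. This is why p = 2 and p = 3 stand apart, and p = 5 for the level 7. There the levels
-- known directly are multiples of p, and reaching all k takes steps of one q. A bound s(C_q^r) ≤ m′
-- (q - 1) + 1 permits the step from k to k + 1 once m′ ≤ k + 1 + r; for p = 3 and r = 4, starting
-- at k = 18, this asks for exactly m′ ≤ 23. For p ≥ 5 the ranges of k are those of numerical
-- semigroups: 3 and 4 generate all integers from 6 on, 4 and 7 all from 18 on, as 17 = 4 · 7 - 4 -
-- 7 is the last gap.

∣0 : ∀ {i} → i ℤ.∣ ℤ.0ℤ
∣0 = ℤ.divides ℤ.0ℤ refl

Δ : {X : Set} → (X → X) → (X → ℤ) → X → ℤ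
Δ s F x = F (s x) ℤ.- F x

Δ^ : {X : Set} → ℕ → (X → X) → (X → ℤ) → X → ℤ
Δ^ zero    s F = F
Δ^ (suc n) s F = Δ^ n s (Δ s F)

module FiniteDifferences (p : ℕ) where

  -- F is a polynomial of degree < n modulo p.  The action is arbitrary (in particular, not
  -- commutative) because it will be _∷_ on lists.
  Deg< : {A X : Set} (_·_ : A → X → X) → ℕ → (X → ℤ) → Set
  Deg< _·_ zero    F = ∀ x → + p ℤ.∣ F x
  Deg< _·_ (suc n) F = ∀ a → Deg< _·_ n (Δ (a ·_) F)

  module _ {A X : Set} {_·_ : A → X → X} where

    deg-resp : ∀ n {F G} → (∀ x → + p ℤ.∣ F x ℤ.- G x) → Deg< _·_ n F → Deg< _·_ n G
    deg-resp zero    {F} {G} F≡G dF x =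
      subst (+ p ℤ.∣_) (lem (F x) (G x)) (ℤ.∣m∣n⇒∣m-n (dF x) (F≡G x))
      where
      lem : ∀ f g → f ℤ.- (f ℤ.- g) ≡ g
      lem = ℤ-Ring.solve-∀
    deg-resp (suc n) {F} {G} F≡G dF a = deg-resp n
      (λ x → subst (+ p ℤ.∣_) (lem (F (a · x)) (G (a · x)) (F x) (G x))
        (ℤ.∣m∣n⇒∣m-n (F≡G (a · x)) (F≡G x)))
      (dF a)
      where
      lem : ∀ f g f′ g′ → f ℤ.- g ℤ.- (f′ ℤ.- g′) ≡ f ℤ.- f′ ℤ.- (g ℤ.- g′)
      lem = ℤ-Ring.solve-∀

    deg-cong : ∀ n {F G} → (∀ x → F x ≡ G x) → Deg< _·_ n F → Deg< _·_ n G
    deg-cong n {F} {G} F≡G = deg-resp n λ x →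
      subst (+ p ℤ.∣_) (sym (ℤ.i≡j⇒i-j≡0 (F≡G x))) ∣0

    deg-suc : ∀ n {F} → Deg< _·_ n F → Deg< _·_ (suc n) F
    deg-suc zero    dF a x = ℤ.∣m∣n⇒∣m-n (dF (a · x)) (dF x)
    deg-suc (suc n) dF a = deg-suc n (dF a)

    deg-mono : ∀ {m n F} → m ≤ n → Deg< _·_ m F → Deg< _·_ n F
    deg-mono {n = zero}  z≤n dF = dF
    deg-mono {n = suc n} z≤n dF = deg-suc n (deg-mono {n = n} z≤n dF)
    deg-mono (s≤s m≤n) dF a = deg-mono m≤n (dF a)

    deg-+ : ∀ n {F G} → Deg< _·_ n F → Deg< _·_ n G → Deg< _·_ n (λ x → F x ℤ.+ G x)
    deg-+ zero    dF dG x = ℤ.∣m∣n⇒∣m+n (dF x) (dG x)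
    deg-+ (suc n) {F} {G} dF dG a = deg-cong n
      (λ x → lem (F (a · x)) (F x) (G (a · x)) (G x))
      (deg-+ n {Δ (a ·_) F} {Δ (a ·_) G} (dF a) (dG a))
      where
      lem : ∀ f f′ g g′ → (f ℤ.- f′) ℤ.+ (g ℤ.- g′) ≡ (f ℤ.+ g) ℤ.- (f′ ℤ.+ g′)
      lem = ℤ-Ring.solve-∀

    deg-shift : ∀ n a {F} → Deg< _·_ n F → Deg< _·_ n (λ x → F (a · x))
    deg-shift zero    a dF x = dF (a · x)
    deg-shift (suc n) a {F} dF = deg-cong (suc n) (λ x → lem (F x) (F (a · x)))
      (deg-+ (suc n) {F} {Δ (a ·_) F} dF (deg-suc n (dF a)))
      where
      lem : ∀ f f′ → f ℤ.+ (f′ ℤ.- f) ≡ f′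
      lem = ℤ-Ring.solve-∀

    -- Leibniz rule: Δ(FG) is ΔF times a shift of G plus F times ΔG, and both summands lose a
    -- degree. Bounding one factor by < m and the other by ≤ n lets the bounds add up without
    -- subtraction.
    deg-* : ∀ m n {F G} → Deg< _·_ m F → Deg< _·_ (suc n) G →
      Deg< _·_ (m + n) (λ x → F x ℤ.* G x)
    deg-* zero    n {G = G} dF dG = deg-mono {n = n} z≤n λ x → ℤ.∣m⇒∣m*n (G x) (dF x)
    deg-* (suc m) n {F} {G} dF dG a = deg-cong (m + n)
      (λ x → lem (F (a · x)) (F x) (G (a · x)) (G x))
      (deg-+ (m + n) (deg-* m n {Δ (a ·_) F} {λ x → G (a · x)} (dF a) (deg-shift (suc n) a {G} dG)) (rest n (dG a)))
      where
      lem : ∀ f f′ g g′ → (f ℤ.- f′) ℤ.* g ℤ.+ f′ ℤ.* (g ℤ.- g′) ≡ f ℤ.* g ℤ.- f′ ℤ.* g′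
      lem = ℤ-Ring.solve-∀
      rest : ∀ n → Deg< _·_ n (Δ (a ·_) G) → Deg< _·_ (m + n) (λ x → F x ℤ.* Δ (a ·_) G x)
      rest zero    d = deg-mono {m = 0} z≤n λ x → ℤ.∣n⇒∣m*n (F x) (d x)
      rest (suc n) d = subst (λ l → Deg< _·_ l (λ x → F x ℤ.* Δ (a ·_) G x)) (sym (ℕ.+-suc m n)) (deg-* (suc m) n {F} {Δ (a ·_) G} dF d)

  -- Length and coordinate sums are equivariant from `_∷_` to addition, so functions of lists
  -- inherit their degree from functions on ℕ.
  deg-pullback : {A B X Y : Set} {_·_ : A → X → X} {_⊙_ : B → Y → Y} (g : A → B) (φ : X → Y) →
    (∀ a x → φ (a · x) ≡ g a ⊙ φ x) → ∀ n {F} → Deg< _⊙_ n F → Deg< _·_ n (λ x → F (φ x))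
  deg-pullback g φ eq zero dF x = dF (φ x)
  deg-pullback g φ eq (suc n) {F} dF a =
    deg-cong n (λ x → cong (λ y → F y ℤ.- F (φ x)) (sym (eq a x)))
      (deg-pullback g φ eq n (dF (g a)))

  ∣⇒deg : ∀ n {X : Set} {s : X → X} {F} → (∀ x → + p ℤ.∣ Δ^ n s F x) → Deg< (λ (_ : ⊤) → s) n F
  ∣⇒deg zero    d = d
  ∣⇒deg (suc n) d _ = ∣⇒deg n d

  deg⇒∣ : ∀ n {X : Set} {s : X → X} {F} → Deg< (λ (_ : ⊤) → s) n F → ∀ x → + p ℤ.∣ Δ^ n s F x
  deg⇒∣ zero    d = d
  deg⇒∣ (suc n) d = deg⇒∣ n (d tt)

  -- Δ_a is a sum of a translates of Δ₁.
  deg-ℕ : ∀ n {h : ℕ → ℤ} → Deg< (λ (_ : ⊤) → suc) n h → Deg< ℕ._+_ n h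
  deg-ℕ zero    d = d
  deg-ℕ (suc n) {h} d zero = deg-mono {m = 0} {n = n} z≤n λ x →
    subst (+ p ℤ.∣_) (sym (ℤ.i≡j⇒i-j≡0 {h x} refl)) ∣0
  deg-ℕ (suc n) {h} d (suc a) = deg-cong n (λ x → lem (h (suc (a + x))) (h (a + x)) (h x))
    (deg-+ n (deg-shift n a {Δ suc h} (deg-ℕ n (d tt))) (deg-ℕ (suc n) {h} d a))
    where
    lem : ∀ f g k → (f ℤ.- g) ℤ.+ (g ℤ.- k) ≡ f ℤ.- k
    lem = ℤ-Ring.solve-∀

  -- This is the sum of (-1)^(|S| - |T|) F(T) over the sublists T of S.
  Δ⋆ : {A : Set} → List A → (List A → ℤ) → ℤ
  Δ⋆ []      F = F []
  Δ⋆ (x ∷ S) F = Δ⋆ S (Δ (x ∷_) F)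

  Δ⋆-- : {A : Set} (S : List A) (F G : List A → ℤ) →
    Δ⋆ S (λ T → F T ℤ.- G T) ≡ Δ⋆ S F ℤ.- Δ⋆ S G
  Δ⋆-- []      F G = refl
  Δ⋆-- (x ∷ S) F G = trans (Δ⋆-cong S λ T → lem (F (x ∷ T)) (G (x ∷ T)) (F T) (G T))
    (Δ⋆-- S (Δ (x ∷_) F) (Δ (x ∷_) G))
    where
    lem : ∀ f g f′ g′ → f ℤ.- g ℤ.- (f′ ℤ.- g′) ≡ f ℤ.- f′ ℤ.- (g ℤ.- g′)
    lem = ℤ-Ring.solve-∀
    Δ⋆-cong : ∀ S {F G} → (∀ T → F T ≡ G T) → Δ⋆ S F ≡ Δ⋆ S G
    Δ⋆-cong []      F≡G = F≡G []
    Δ⋆-cong (x ∷ S) F≡G = Δ⋆-cong S λ T → cong₂ ℤ._-_ (F≡G (x ∷ T)) (F≡G T)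

  deg-Δ⋆ : {A : Set} (S : List A) {F : List A → ℤ} → Deg< _∷_ (length S) F → + p ℤ.∣ Δ⋆ S F
  deg-Δ⋆ []      d = d []
  deg-Δ⋆ (x ∷ S) d = deg-Δ⋆ S (d x)

  Δ⋆-nonzero : {A : Set} (S : List A) (F : List A → ℤ) → ¬ + p ℤ.∣ Δ⋆ S F →
    ∃[ T ] T ⊆ S × ¬ + p ℤ.∣ F T
  Δ⋆-nonzero []      F ≢0 = [] , [] , ≢0
  Δ⋆-nonzero (x ∷ S) F ≢0 with + p ℤ.∣? Δ⋆ S F
  ... | no  p∤ = let T , T⊆S , FT≢0 = Δ⋆-nonzero S F p∤ in T , x ∷ʳ T⊆S , FT≢0
  ... | yes p∣ =
    let T , T⊆S , FT≢0 = Δ⋆-nonzero S (F ∘ (x ∷_)) λ p∣′ →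
          ≢0 (subst (+ p ℤ.∣_) (sym (Δ⋆-- S (F ∘ (x ∷_)) F)) (ℤ.∣m∣n⇒∣m-n p∣′ p∣))
    in x ∷ T , refl ∷ T⊆S , FT≢0

  -- Split the sublists by whether they contain the head x. If those without x already sum to 0,
  -- recurse; otherwise those with x have a nonzero sum, so F is nonzero at one of them.
  nonempty-nonzero : {A : Set} (S : List A) (F : List A → ℤ) →
    + p ℤ.∣ Δ⋆ S F → ¬ + p ℤ.∣ F [] → ∃[ T ] T ⊆ S × 1 ≤ length T × ¬ + p ℤ.∣ F T
  nonempty-nonzero []      F p∣ F[]≢0 = contradiction p∣ F[]≢0
  nonempty-nonzero (x ∷ S) F p∣ F[]≢0 with + p ℤ.∣? Δ⋆ S F
  ... | yes p∣′ = let T , T⊆S , T≢[] , FT≢0 = nonempty-nonzero S F p∣′ F[]≢0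
                  in T , x ∷ʳ T⊆S , T≢[] , FT≢0
  ... | no p∤ =
    let T , T⊆S , FT≢0 = Δ⋆-nonzero S (F ∘ (x ∷_)) λ p∣′ →
          p∤ (subst (+ p ℤ.∣_) (lem (Δ⋆ S (F ∘ (x ∷_))) (Δ⋆ S F))
            (ℤ.∣m∣n⇒∣m-n p∣′ (subst (+ p ℤ.∣_) (Δ⋆-- S (F ∘ (x ∷_)) F) p∣)))
    in x ∷ T , refl ∷ T⊆S , s≤s z≤n , FT≢0
    where
    lem : ∀ f g → f ℤ.- (f ℤ.- g) ≡ g
    lem = ℤ-Ring.solve-∀

-- Newton's forward difference formula

Σ≤ : ℕ → (ℕ → ℤ) → ℤ
Σ≤ zero    t = t 0
Σ≤ (suc n) t = t 0 ℤ.+ Σ≤ n (t ∘ suc)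

Σ≤-cong : ∀ n {t u} → (∀ i → t i ≡ u i) → Σ≤ n t ≡ Σ≤ n u
Σ≤-cong zero    eq = eq 0
Σ≤-cong (suc n) eq = cong₂ ℤ._+_ (eq 0) (Σ≤-cong n (eq ∘ suc))

Σ≤-+ : ∀ n t u → Σ≤ n (λ i → t i ℤ.+ u i) ≡ Σ≤ n t ℤ.+ Σ≤ n u
Σ≤-+ zero    t u = refl
Σ≤-+ (suc n) t u = trans (cong (λ s → (t 0 ℤ.+ u 0) ℤ.+ s) (Σ≤-+ n (t ∘ suc) (u ∘ suc)))
  (lem (t 0) (u 0) (Σ≤ n (t ∘ suc)) (Σ≤ n (u ∘ suc)))
  where
  lem : ∀ a b c d → (a ℤ.+ b) ℤ.+ (c ℤ.+ d) ≡ (a ℤ.+ c) ℤ.+ (b ℤ.+ d)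
  lem = ℤ-Ring.solve-∀

Σ≤-last : ∀ n t → Σ≤ (suc n) t ≡ Σ≤ n t ℤ.+ t (suc n)
Σ≤-last zero    t = refl
Σ≤-last (suc n) t = trans (cong (λ s → t 0 ℤ.+ s) (Σ≤-last n (t ∘ suc)))
  (sym (ℤ.+-assoc (t 0) (Σ≤ n (t ∘ suc)) (t (suc (suc n)))))

binomialSum : ℕ → (ℕ → ℤ) → ℤ
binomialSum n t = Σ≤ n λ i → + (n choose i) ℤ.* t i

binomialSum-suc : ∀ n t → binomialSum (suc n) t ≡ binomialSum n t ℤ.+ binomialSum n (t ∘ suc)
binomialSum-suc n t = begin
  c 0 ℤ.+ Σ≤ n (λ i → + (suc n choose suc i) ℤ.* t (suc i))
    ≡⟨ cong (λ s → c 0 ℤ.+ s) (Σ≤-cong n pascal) ⟩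
  c 0 ℤ.+ Σ≤ n (λ i → + (n choose i) ℤ.* t (suc i) ℤ.+ c (suc i))
    ≡⟨ cong (λ s → c 0 ℤ.+ s) (Σ≤-+ n (λ i → + (n choose i) ℤ.* t (suc i)) (c ∘ suc)) ⟩
  c 0 ℤ.+ (B ℤ.+ Σ≤ n (c ∘ suc))
    ≡⟨ lem (c 0) B (Σ≤ n (c ∘ suc)) ⟩
  Σ≤ (suc n) c ℤ.+ B
    ≡⟨ cong (ℤ._+ B) (Σ≤-last n c) ⟩
  Σ≤ n c ℤ.+ c (suc n) ℤ.+ B
    ≡⟨ cong (λ x → Σ≤ n c ℤ.+ x ℤ.+ B) (cong (λ k → + k ℤ.* t (suc n)) (k>n⇒nCk≡0 (ℕ.n<1+n n))) ⟩
  Σ≤ n c ℤ.+ + 0 ℤ.* t (suc n) ℤ.+ B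
    ≡⟨ cong (ℤ._+ B) (ℤ.+-identityʳ (Σ≤ n c)) ⟩
  Σ≤ n c ℤ.+ B ∎
  where
  open ≡-Reasoning
  c : ℕ → ℤ
  c i = + (n choose i) ℤ.* t i
  B : ℤ
  B = binomialSum n (t ∘ suc)
  lem : ∀ a b d → a ℤ.+ (b ℤ.+ d) ≡ a ℤ.+ d ℤ.+ b
  lem = ℤ-Ring.solve-∀
  pascal : ∀ i → + (suc n choose suc i) ℤ.* t (suc i) ≡ + (n choose i) ℤ.* t (suc i) ℤ.+ c (suc i)
  pascal i = trans
    (cong (λ k → + k ℤ.* t (suc i)) (sym (nCk+nC[k+1]≡[n+1]C[k+1] n i)))
    (ℤ.*-distribʳ-+ (t (suc i)) (+ (n choose i)) (+ (n choose suc i)))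

Δ^-s : ∀ n {X : Set} (s : X → X) F x → Δ^ n s F (s x) ≡ Δ^ n s F x ℤ.+ Δ^ (suc n) s F x
Δ^-s zero    s F x = lem (F x) (F (s x))
  where
  lem : ∀ a b → b ≡ a ℤ.+ (b ℤ.- a)
  lem = ℤ-Ring.solve-∀
Δ^-s (suc n) s F x = Δ^-s n s (Δ s F) x

-- The shift is 1 + Δ, expanded by the binomial theorem. At n = p only the two extreme terms survive
-- modulo p.
newton : ∀ n {X : Set} (s : X → X) F x → F (iterate s x n) ≡ binomialSum n λ i → Δ^ i s F x
newton zero    s F x = sym (ℤ.*-identityˡ (F x))
newton (suc n) s F x = begin
  F (iterate s (s x) n)
    ≡⟨ newton n s F (s x) ⟩
  Σ≤ n (λ i → + (n choose i) ℤ.* Δ^ i s F (s x))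
    ≡⟨ Σ≤-cong n (λ i → trans (cong (λ s → + (n choose i) ℤ.* s) (Δ^-s i s F x))
         (ℤ.*-distribˡ-+ (+ (n choose i)) (Δ^ i s F x) (Δ^ (suc i) s F x))) ⟩
  Σ≤ n (λ i → + (n choose i) ℤ.* Δ^ i s F x ℤ.+ + (n choose i) ℤ.* Δ^ (suc i) s F x)
    ≡⟨ Σ≤-+ n (λ i → + (n choose i) ℤ.* Δ^ i s F x) (λ i → + (n choose i) ℤ.* Δ^ (suc i) s F x) ⟩
  binomialSum n (λ i → Δ^ i s F x) ℤ.+ binomialSum n (λ i → Δ^ (suc i) s F x)
    ≡⟨ binomialSum-suc n (λ i → Δ^ i s F x) ⟨
  binomialSum (suc n) (λ i → Δ^ i s F x) ∎
  where open ≡-Reasoning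

Δ^-+ : ∀ a b {X : Set} (s : X → X) F → Δ^ (a + b) s F ≡ Δ^ b s (Δ^ a s F)
Δ^-+ zero    b s F = refl
Δ^-+ (suc a) b s F = Δ^-+ a b s (Δ s F)

Δ^-cong : ∀ n {X : Set} (s : X → X) {F G} → (∀ x → F x ≡ G x) → ∀ x → Δ^ n s F x ≡ Δ^ n s G x
Δ^-cong zero    s F≡G = F≡G
Δ^-cong (suc n) s F≡G = Δ^-cong n s λ x → cong₂ ℤ._-_ (F≡G (s x)) (F≡G x)

-- Functions supported on the multiples of q

onMultiples : (q : ℕ) → .{{NonZero q}} → (ℕ → ℤ) → ℕ → ℤ
onMultiples q f x with q ∣? x
... | yes _ = f (x / q)
... | no  _ = ℤ.0ℤ

module _ (q : ℕ) .{{_ : NonZero q}} where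

  onMultiples-+ : ∀ f x → onMultiples q f (q + x) ≡ onMultiples q (f ∘ suc) x
  onMultiples-+ f x with q ∣? q + x | q ∣? x
  ... | yes _ | yes q∣x =
    cong f (trans (+-distrib-/-∣ˡ x (∣.∣-refl)) (cong (ℕ._+ x / q) (n/n≡1 q)))
  ... | yes q∣q+x | no q∤x = contradiction (∣.∣m+n∣m⇒∣n q∣q+x ∣.∣-refl) q∤x
  ... | no q∤q+x | yes q∣x = contradiction (∣.∣m∣n⇒∣m+n ∣.∣-refl q∣x) q∤q+x
  ... | no _ | no _ = refl

  onMultiples-Δ : ∀ f x → Δ (q ℕ.+_) (onMultiples q f) x ≡ onMultiples q (Δ suc f) x
  onMultiples-Δ f x = trans (cong (ℤ._- onMultiples q f x) (onMultiples-+ f x)) lem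
    where
    lem : onMultiples q (f ∘ suc) x ℤ.- onMultiples q f x ≡ onMultiples q (Δ suc f) x
    lem with q ∣? x
    ... | yes _ = refl
    ... | no  _ = refl

  onMultiples-Δ^ : ∀ c f x → Δ^ c (q ℕ.+_) (onMultiples q f) x ≡ onMultiples q (Δ^ c suc f) x
  onMultiples-Δ^ zero    f x = refl
  onMultiples-Δ^ (suc c) f x = trans (Δ^-cong c (q ℕ.+_) (onMultiples-Δ f) x)
    (onMultiples-Δ^ c (Δ suc f) x)

  onMultiples-∣ : ∀ {p} f → (∀ j → + p ℤ.∣ f j) → ∀ x → + p ℤ.∣ onMultiples q f x
  onMultiples-∣ f p∣f x with q ∣? x
  ... | yes _ = p∣f (x / q)
  ... | no  _ = ∣0

  onMultiples-nonzero : ∀ {p} f x → ¬ + p ℤ.∣ onMultiples q f x → q ∣ x × ¬ + p ℤ.∣ f (x / q)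
  onMultiples-nonzero f x p∤ with q ∣? x
  ... | yes q∣x = q∣x , p∤
  ... | no  _   = contradiction ∣0 p∤

  onMultiples-0 : ∀ f → onMultiples q f 0 ≡ f 0
  onMultiples-0 f with q ∣? 0
  ... | yes _   = cong f (0/n≡0 q)
  ... | no  q∤0 = contradiction (q ∣.∣0) q∤0

ZeroSum : {A : Set} {r : ℕ} → ℕ → (A → Fin r → ℕ) → List A → Set
ZeroSum n w T = ∀ i → n ∣ sum (map (λ x → w x i) T)

-- Differences modulo a prime and the polynomial method

module ModuloPrime {p : ℕ} (pp : Prime p) where
  open FiniteDifferences p

  private instance
    p≢0 : NonZero p
    p≢0 = prime⇒nonZero pp

  p∤k! : ∀ k → k < p → ¬ p ∣ k !
  p∤k! zero    k<p p∣ = ℕ.<⇒≱ (ℕ.nonTrivial⇒n>1 p {{prime⇒nonTrivial pp}}) (∣⇒≤ p∣)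
  p∤k! (suc k) k<p p∣ with euclidsLemma (suc k) (k !) pp p∣
  ... | inj₁ p∣k  = ℕ.<⇒≱ k<p (∣⇒≤ p∣k)
  ... | inj₂ p∣k! = p∤k! k (ℕ.<-trans (ℕ.n<1+n k) k<p) p∣k!

  p∣pCk : ∀ k → 1 ≤ k → k < p → p ∣ p choose k
  p∣pCk k 1≤k k<p with euclidsLemma (p choose k) d pp (subst (p ∣_) (sym eq) p∣p!)
    where
    d : ℕ
    d = k ! * (p ∸ k) !
    instance
      d≢0 : NonZero d
      d≢0 = ℕ.m*n≢0 (k !) ((p ∸ k) !) {{k ℕ.!≢0}} {{(p ∸ k) ℕ.!≢0}}
    eq : (p choose k) * d ≡ p !
    eq = trans (cong (ℕ._* d) (nCk≡n!/k![n-k]! (ℕ.<⇒≤ k<p))) (m/n*n≡m (k![n∸k]!∣n! (ℕ.<⇒≤ k<p)))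
    p∣p! : p ∣ p !
    p∣p! = lem p where
      lem : ∀ n .{{_ : NonZero n}} → n ∣ n !
      lem (suc n) = ∣.m∣m*n (n !)
  ... | inj₁ p∣ = p∣
  ... | inj₂ p∣d with euclidsLemma (k !) ((p ∸ k) !) pp p∣d
  ...   | inj₁ p∣k! = contradiction p∣k! (p∤k! k k<p)
  ...   | inj₂ p∣ = contradiction p∣ (p∤k! (p ∸ k) (ℕ.∸-monoʳ-< 1≤k (ℕ.<⇒≤ k<p)))

  private
    _≡ₚ_ : {X : Set} → (X → ℤ) → (X → ℤ) → Set
    F ≡ₚ G = ∀ x → + p ℤ.∣ F x ℤ.- G x

  Δ^-≡ₚ : ∀ n {X : Set} (s : X → X) {F G} → F ≡ₚ G → Δ^ n s F ≡ₚ Δ^ n s G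
  Δ^-≡ₚ zero    s F≡G = F≡G
  Δ^-≡ₚ (suc n) s {F} {G} F≡G = Δ^-≡ₚ n s λ x →
    subst (+ p ℤ.∣_) (lem (F (s x)) (G (s x)) (F x) (G x)) (ℤ.∣m∣n⇒∣m-n (F≡G (s x)) (F≡G x))
    where
    lem : ∀ f g f′ g′ → f ℤ.- g ℤ.- (f′ ℤ.- g′) ≡ f ℤ.- f′ ℤ.- (g ℤ.- g′)
    lem = ℤ-Ring.solve-∀

  ≡ₚ-trans : {X : Set} {F G H : X → ℤ} → F ≡ₚ G → G ≡ₚ H → F ≡ₚ H
  ≡ₚ-trans {F = F} {G} {H} F≡G G≡H x =
    subst (+ p ℤ.∣_) (lem (F x) (G x) (H x)) (ℤ.∣m∣n⇒∣m+n (F≡G x) (G≡H x))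
    where
    lem : ∀ f g h → (f ℤ.- g) ℤ.+ (g ℤ.- h) ≡ f ℤ.- h
    lem = ℤ-Ring.solve-∀

  ≡⇒≡ₚ : {X : Set} {F G : X → ℤ} → (∀ x → F x ≡ G x) → F ≡ₚ G
  ≡⇒≡ₚ F≡G x = subst (+ p ℤ.∣_) (sym (ℤ.i≡j⇒i-j≡0 (F≡G x))) ∣0

  Σ≤-head : ∀ n c → (∀ i → 1 ≤ i → i ≤ n → + p ℤ.∣ c i) → + p ℤ.∣ Σ≤ n c ℤ.- c 0
  Σ≤-head zero    c p∣c = ≡⇒≡ₚ {X = ⊤} (λ _ → refl {x = c 0}) tt
  Σ≤-head (suc n) c p∣c =
    subst (+ p ℤ.∣_) (trans (lem (Σ≤ n c) (c 0) (c (suc n))) (cong (ℤ._- c 0) (sym (Σ≤-last n c))))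
      (ℤ.∣m∣n⇒∣m+n (Σ≤-head n c λ i 1≤i i≤n → p∣c i 1≤i (ℕ.m≤n⇒m≤1+n i≤n))
                    (p∣c (suc n) (s≤s z≤n) ℕ.≤-refl))
    where
    lem : ∀ a b d → a ℤ.- b ℤ.+ d ≡ a ℤ.+ d ℤ.- b
    lem = ℤ-Ring.solve-∀

  binomialSum-p : ∀ n t → suc n ≡ p → + p ℤ.∣ t 0 ℤ.+ t p ℤ.- binomialSum p t
  binomialSum-p n t refl = subst (+ p ℤ.∣_) eq (ℤ.∣m⇒∣-m (Σ≤-head n c p∣c))
    where
    c : ℕ → ℤ
    c i = + (p choose i) ℤ.* t i
    p∣c : ∀ i → 1 ≤ i → i ≤ n → + p ℤ.∣ c i
    p∣c i 1≤i i≤n = ℤ.∣m⇒∣m*n {m = + (p choose i)} (t i) (ℤ.∣ᵤ⇒∣ (p∣pCk i 1≤i (s≤s i≤n)))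
    lem : ∀ s a b → ℤ.- (s ℤ.- + 1 ℤ.* a) ≡ a ℤ.+ b ℤ.- (s ℤ.+ + 1 ℤ.* b)
    lem = ℤ-Ring.solve-∀
    eq : ℤ.- (Σ≤ n c ℤ.- c 0) ≡ t 0 ℤ.+ t p ℤ.- binomialSum p t
    eq = trans (lem (Σ≤ n c) (t 0) (t p))
      (cong (λ s → t 0 ℤ.+ t p ℤ.- s)
        (trans (cong (λ k → Σ≤ n c ℤ.+ + k ℤ.* t p) (sym (nCn≡1 p))) (sym (Σ≤-last n c))))

  -- Frobenius for operators: (1 + Δ)^p ≡ 1 + Δ^p. Expanding the shift in powers of Δ, rather than Δ
  -- in powers of the shift, avoids the signs that would set p = 2 apart.
  Δ^-p : {X : Set} (s : X → X) (F : X → ℤ) → Δ^ p s F ≡ₚ Δ (λ x → iterate s x p) F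
  Δ^-p s F x = subst (+ p ℤ.∣_)
    (trans (cong (λ y → F x ℤ.+ Δ^ p s F x ℤ.- y) (sym (newton p s F x)))
           (lem (F x) (Δ^ p s F x) (F (iterate s x p))))
    (binomialSum-p (ℕ.pred p) (λ i → Δ^ i s F x) (ℕ.suc-pred p))
    where
    lem : ∀ a b d → a ℤ.+ b ℤ.- d ≡ b ℤ.- (d ℤ.- a)
    lem = ℤ-Ring.solve-∀

  Δ^-* : ∀ m n {X : Set} (s t : X → X) → (∀ F → Δ^ n s F ≡ₚ Δ t F) →
    ∀ F → Δ^ (m * n) s F ≡ₚ Δ^ m t F
  Δ^-* zero    n s t eq F = ≡⇒≡ₚ {F = F} λ _ → refl
  Δ^-* (suc m) n s t eq F x = subst (λ G → + p ℤ.∣ G x ℤ.- Δ^ m t (Δ t F) x) (sym (Δ^-+ n (m * n) s F))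
    (≡ₚ-trans {F = Δ^ (m * n) s (Δ^ n s F)} {Δ^ (m * n) s (Δ t F)} {Δ^ m t (Δ t F)}
      (Δ^-≡ₚ (m * n) s {Δ^ n s F} {Δ t F} (eq F)) (Δ^-* m n s t eq (Δ t F)) x)

  Δ^-p^ : ∀ a (F : ℕ → ℤ) → Δ^ (p ^ a) suc F ≡ₚ Δ (p ^ a ℕ.+_) F
  Δ^-p^ zero    F = ≡⇒≡ₚ {F = Δ suc F} λ _ → refl
  Δ^-p^ (suc a) F x = subst (λ y → + p ℤ.∣ Δ^ (p ^ suc a) suc F x ℤ.- (F y ℤ.- F x)) (iterate-+ p x)
    (≡ₚ-trans {F = Δ^ (p ^ suc a) suc F} {Δ^ p (p ^ a ℕ.+_) F} {Δ (λ y → iterate (p ^ a ℕ.+_) y p) F}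
      (Δ^-* p (p ^ a) suc (p ^ a ℕ.+_) (Δ^-p^ a) F) (Δ^-p (p ^ a ℕ.+_) F) x)
    where
    iterate-+ : ∀ n x → iterate (p ^ a ℕ.+_) x n ≡ n * p ^ a + x
    iterate-+ zero    x = refl
    iterate-+ (suc n) x = trans (iterate-+ n (p ^ a + x))
      (trans (sym (ℕ.+-assoc (n * p ^ a) (p ^ a) x))
             (cong (ℕ._+ x) (ℕ.+-comm (n * p ^ a) (p ^ a))))

  module _ (a : ℕ) where

    private
      q : ℕ
      q = p ^ a
      instance
        q≢0 : NonZero q
        q≢0 = ℕ.m^n≢0 p a

    -- Modulo p, cq differences of step 1 are c differences of step q, and these act on f as c
    -- differences of step 1.
    deg-onMultiples : ∀ c f → (∀ j → + p ℤ.∣ Δ^ c suc f j) →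
      Deg< ℕ._+_ (c * q) (onMultiples q f)
    deg-onMultiples c f p∣ = deg-ℕ (c * q) (∣⇒deg (c * q) λ x →
      subst (+ p ℤ.∣_) (lem (Δ^ (c * q) suc (onMultiples q f) x) (Δ^ c (q ℕ.+_) (onMultiples q f) x))
        (ℤ.∣m∣n⇒∣m+n (Δ^-* c q suc (q ℕ.+_) (Δ^-p^ a) (onMultiples q f) x)
          (subst (+ p ℤ.∣_) (sym (onMultiples-Δ^ q c f x)) (onMultiples-∣ q (Δ^ c suc f) p∣ x))))
      where
      lem : ∀ u v → u ℤ.- v ℤ.+ v ≡ u
      lem = ℤ-Ring.solve-∀

    module _ {A : Set} where

      zeroSumIndicator : ∀ {r} → (A → Fin r → ℕ) → List A → ℤ
      zeroSumIndicator {zero}  w T = ℤ.1ℤ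
      zeroSumIndicator {suc r} w T =
        onMultiples q (λ _ → ℤ.1ℤ) (sum (map (λ x → w x zero) T)) ℤ.* zeroSumIndicator (λ x i → w x (suc i)) T

      zeroSumIndicator-[] : ∀ {r} (w : A → Fin r → ℕ) → zeroSumIndicator w [] ≡ ℤ.1ℤ
      zeroSumIndicator-[] {zero}  w = refl
      zeroSumIndicator-[] {suc r} w =
        cong₂ ℤ._*_ (onMultiples-0 q (λ _ → ℤ.1ℤ)) (zeroSumIndicator-[] (λ x i → w x (suc i)))

      zeroSumIndicator-nonzero : ∀ {r} (w : A → Fin r → ℕ) T →
        ¬ + p ℤ.∣ zeroSumIndicator w T → ZeroSum q w T
      zeroSumIndicator-nonzero {suc r} w T p∤ zero =
        proj₁ (onMultiples-nonzero q (λ _ → ℤ.1ℤ) _ λ p∣ → p∤ (ℤ.∣m⇒∣m*n _ p∣))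
      zeroSumIndicator-nonzero {suc r} w T p∤ (suc i) =
        zeroSumIndicator-nonzero (λ x i → w x (suc i)) T
          (λ p∣ → p∤ (ℤ.∣n⇒∣m*n (onMultiples q (λ _ → ℤ.1ℤ) _) p∣)) i

      -- Each coordinate contributes an indicator of degree at most q - 1, and r (q - 1) = D(C_q^r)
      -- - 1 is the part of a level that depends on r.
      deg-zeroSumIndicator : ∀ {r} (w : A → Fin r → ℕ) →
        Deg< _∷_ (suc (r * ℕ.pred q)) (zeroSumIndicator w)
      deg-zeroSumIndicator {zero}  w _ T = ∣0
      deg-zeroSumIndicator {suc r} w =
        subst (λ d → Deg< _∷_ d (zeroSumIndicator w)) eq
          (deg-* {_·_ = _∷_} q (r * ℕ.pred q)
            {λ T → onMultiples q (λ _ → ℤ.1ℤ) (sum (map (λ x → w x zero) T))}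
            {zeroSumIndicator (λ x i → w x (suc i))}
            (deg-pullback {_⊙_ = ℕ._+_} (λ x → w x zero) (λ T → sum (map (λ x → w x zero) T))
              (λ _ _ → refl) q
              (subst (λ d → Deg< ℕ._+_ d (onMultiples q (λ _ → ℤ.1ℤ))) (ℕ.+-identityʳ q)
                (deg-onMultiples 1 (λ _ → ℤ.1ℤ) λ _ → ∣0)))
            (deg-zeroSumIndicator (λ x i → w x (suc i))))
        where
        eq : q + r * ℕ.pred q ≡ suc (ℕ.pred q + r * ℕ.pred q)
        eq = cong (ℕ._+ r * ℕ.pred q) (sym (ℕ.suc-pred q))

      -- The polynomial method: the signed count of the zero-sum T ⊆ S with q ∣ |T|, weighted by
      -- f(|T|/q), vanishes modulo p, so the empty sequence cannot be the only contribution.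
      zeroSum-exists : ∀ {r} (w : A → Fin r → ℕ) c f → (∀ j → + p ℤ.∣ Δ^ c suc f j) →
        ¬ + p ℤ.∣ f 0 → ∀ S → (c + r) * q ≤ length S + r →
        ∃[ T ] T ⊆ S × 1 ≤ length T × ∃[ j ] length T ≡ j * q × ZeroSum q w T × ¬ + p ℤ.∣ f j
      zeroSum-exists {r} w c f p∣ f0≢0 S long =
        let T , T⊆S , T≢[] , FT≢0 = nonempty-nonzero S F (deg-Δ⋆ S
                                      (deg-mono {_·_ = _∷_} {m = c * q + r * ℕ.pred q} {F = F} bound degF)) F[]≢0
            q∣ , f≢0 = onMultiples-nonzero q f (length T) λ p∣ → FT≢0 (ℤ.∣m⇒∣m*n _ p∣)
        in T , T⊆S , T≢[] , length T / q , sym (m/n*n≡m q∣) ,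
           zeroSumIndicator-nonzero w T (λ p∣ → FT≢0 (ℤ.∣n⇒∣m*n (onMultiples q f (length T)) p∣)) , f≢0
        where
        F : List A → ℤ
        F T = onMultiples q f (length T) ℤ.* zeroSumIndicator w T
        degF : Deg< _∷_ (c * q + r * ℕ.pred q) F
        degF = deg-* {_·_ = _∷_} (c * q) (r * ℕ.pred q)
          {λ T → onMultiples q f (length T)} {zeroSumIndicator w}
          (deg-pullback {_⊙_ = ℕ._+_} (λ _ → 1) length (λ _ _ → refl) (c * q) (deg-onMultiples c f p∣))
          (deg-zeroSumIndicator w)
        F[]≢0 : ¬ + p ℤ.∣ F []
        F[]≢0 p∣F = f0≢0 (subst (+ p ℤ.∣_)
          (trans (cong₂ ℤ._*_ (onMultiples-0 q f) (zeroSumIndicator-[] w)) (ℤ.*-identityʳ (f 0))) p∣F)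
        bound : c * q + r * ℕ.pred q ≤ length S
        bound = ℕ.+-cancelʳ-≤ r _ _ (begin
          c * q + r * ℕ.pred q + r ≡⟨ ℕ.+-assoc (c * q) _ r ⟩
          c * q + (r * ℕ.pred q + r)
            ≡⟨ cong (c * q ℕ.+_) (trans (ℕ.+-comm _ r) (sym (ℕ.*-suc r (ℕ.pred q)))) ⟩
          c * q + r * suc (ℕ.pred q) ≡⟨ cong (λ s → c * q + r * s) (ℕ.suc-pred q) ⟩
          c * q + r * q ≡⟨ ℕ.*-distribʳ-+ q c r ⟨
          (c + r) * q ≤⟨ long ⟩
          length S + r ∎)
          where open ℕ.≤-Reasoning

-- Zero-sum subsequences as sub-multisets

⊆⇒↭ : {A : Set} {T S : List A} → T ⊆ S → ∃[ R ] T ++ R ↭ S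
⊆⇒↭ []           = [] , ↭-refl
⊆⇒↭ {T = T} (y ∷ʳ T⊆S) = let R , eq = ⊆⇒↭ T⊆S in y ∷ R , ↭-trans (↭.shift y T R) (↭-prep y eq)
⊆⇒↭ (refl ∷ T⊆S) = let R , eq = ⊆⇒↭ T⊆S in R , ↭-prep _ eq

⊆-↭ : {A : Set} {T S S′ : List A} → T ⊆ S → S ↭ S′ → ∃[ T′ ] T′ ⊆ S′ × T ↭ T′
⊆-↭ T⊆S ↭.refl = _ , T⊆S , ↭-refl
⊆-↭ (_ ∷ʳ T⊆S) (↭.prep x eq) = let T′ , T′⊆ , eq′ = ⊆-↭ T⊆S eq in T′ , x ∷ʳ T′⊆ , eq′
⊆-↭ (refl ∷ T⊆S) (↭.prep x eq) =
  let T′ , T′⊆ , eq′ = ⊆-↭ T⊆S eq in x ∷ T′ , refl ∷ T′⊆ , ↭-prep x eq′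
⊆-↭ (_ ∷ʳ _ ∷ʳ T⊆S) (↭.swap x y eq) =
  let T′ , T′⊆ , eq′ = ⊆-↭ T⊆S eq in T′ , y ∷ʳ x ∷ʳ T′⊆ , eq′
⊆-↭ (_ ∷ʳ refl ∷ T⊆S) (↭.swap x y eq) =
  let T′ , T′⊆ , eq′ = ⊆-↭ T⊆S eq in y ∷ T′ , refl ∷ x ∷ʳ T′⊆ , ↭-prep y eq′
⊆-↭ (refl ∷ _ ∷ʳ T⊆S) (↭.swap x y eq) =
  let T′ , T′⊆ , eq′ = ⊆-↭ T⊆S eq in x ∷ T′ , y ∷ʳ refl ∷ T′⊆ , ↭-prep x eq′
⊆-↭ (refl ∷ refl ∷ T⊆S) (↭.swap x y eq) =
  let T′ , T′⊆ , eq′ = ⊆-↭ T⊆S eq in y ∷ x ∷ T′ , refl ∷ refl ∷ T′⊆ , ↭.swap x y eq′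
⊆-↭ T⊆S (↭.trans eq₁ eq₂) =
  let T₁ , T₁⊆ , eq₁′ = ⊆-↭ T⊆S eq₁
      T₂ , T₂⊆ , eq₂′ = ⊆-↭ T₁⊆ eq₂
  in T₂ , T₂⊆ , ↭-trans eq₁′ eq₂′

++-⊆ : {A : Set} (T R : List A) → T ⊆ T ++ R
++-⊆ []      []      = []
++-⊆ []      (x ∷ R) = x ∷ʳ ++-⊆ [] R
++-⊆ (x ∷ T) R       = refl ∷ ++-⊆ T R

⊆-map⁻ : {A B : Set} (f : A → B) {T : List B} (S : List A) → T ⊆ map f S →
  ∃[ T′ ] T′ ⊆ S × T ≡ map f T′
⊆-map⁻ f []      []            = [] , [] , refl
⊆-map⁻ f (x ∷ S) (_ ∷ʳ T⊆)    = let T′ , T′⊆ , eq = ⊆-map⁻ f S T⊆ in T′ , x ∷ʳ T′⊆ , eq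
⊆-map⁻ f (x ∷ S) (refl ∷ T⊆)  = let T′ , T′⊆ , eq = ⊆-map⁻ f S T⊆ in x ∷ T′ , refl ∷ T′⊆ , cong (f x ∷_) eq

concat-↭ : {A : Set} {X Y : List (List A)} → X ↭ Y → concat X ↭ concat Y
concat-↭ ↭.refl         = ↭-refl
concat-↭ (↭.prep x eq)  = ↭.++⁺ˡ x (concat-↭ eq)
concat-↭ (↭.swap x y eq) = ↭-trans (↭.shifts x y) (↭.++⁺ˡ y (↭.++⁺ˡ x (concat-↭ eq)))
concat-↭ (↭.trans eq₁ eq₂) = ↭-trans (concat-↭ eq₁) (concat-↭ eq₂)

concat-++ : {A : Set} (X Y : List (List A)) → concat (X ++ Y) ↭ concat X ++ concat Y
concat-++ []      Y = ↭-refl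
concat-++ (x ∷ X) Y = ↭-trans (↭.++⁺ˡ x (concat-++ X Y)) (↭-sym (↭.++-assoc x (concat X) (concat Y)))

rest-length : {A : Set} (T : List A) {R S : List A} {k : ℕ} →
  T ++ R ↭ S → length T ≡ k → length S ≡ k + length R
rest-length T eq refl = trans (sym (↭.↭-length eq)) (length-++ T)

-- Unlike HasZeroSum, HasBlock keeps the complement R of the subsequence T.
HasBlock : {A : Set} {r : ℕ} → ℕ → (A → Fin r → ℕ) → ℕ → List A → Set
HasBlock n w l S = ∃[ T ] ∃[ R ] T ++ R ↭ S × length T ≡ l × ZeroSum n w T

module _ {A : Set} {r : ℕ} {n : ℕ} {w : A → Fin r → ℕ} where

  private
    ∑ : Fin r → List A → ℕ
    ∑ i T = sum (map (λ x → w x i) T)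

  ∑-++ : ∀ i T R → ∑ i (T ++ R) ≡ ∑ i T + ∑ i R
  ∑-++ i T R = trans (cong sum (map-++ (λ x → w x i) T R)) (sum-++ (map (λ x → w x i) T) _)

  zeroSum-↭ : ∀ {T T′} → T ↭ T′ → ZeroSum n w T → ZeroSum n w T′
  zeroSum-↭ eq z i = subst (n ∣_) (sum-↭ (↭.map⁺ (λ x → w x i) eq)) (z i)

  zeroSum-++ : ∀ {T U} → ZeroSum n w T → ZeroSum n w U → ZeroSum n w (T ++ U)
  zeroSum-++ {T} {U} zT zU i = subst (n ∣_) (sym (∑-++ i T U)) (∣.∣m∣n⇒∣m+n (zT i) (zU i))

  ⊆⇒block : ∀ {T S l} → T ⊆ S → length T ≡ l → ZeroSum n w T → HasBlock n w l S
  ⊆⇒block T⊆S len z = let R , eq = ⊆⇒↭ T⊆S in _ , R , eq , len , z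

  block-⊆ : ∀ {S l} → HasBlock n w l S → ∃[ T ] T ⊆ S × length T ≡ l × ZeroSum n w T
  block-⊆ (T , R , eq , len , z) =
    let T′ , T′⊆S , T↭T′ = ⊆-↭ (++-⊆ T R) eq
    in T′ , T′⊆S , trans (↭.↭-length (↭-sym T↭T′)) len , zeroSum-↭ T↭T′ z

  block-widen : ∀ {T R S l} → T ++ R ↭ S → HasBlock n w l T → HasBlock n w l S
  block-widen {T} {R} eq (U , V , eq′ , len , z) =
    U , V ++ R , ↭-trans (↭-sym (↭.++-assoc U V R)) (↭-trans (↭.++⁺ʳ R eq′) eq) , len , z

  block-rest : ∀ {T R S l} → T ++ R ↭ S → HasBlock n w l R → HasBlock n w l S
  block-rest {T} {R} eq = block-widen (↭-trans (↭.++-comm R T) eq)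

  block-+ : ∀ {T R S k l} → T ++ R ↭ S → length T ≡ k → ZeroSum n w T →
    HasBlock n w l R → HasBlock n w (k + l) S
  block-+ {T} eq refl z (U , V , eq′ , refl , z′) =
    T ++ U , V , ↭-trans (↭.++-assoc T U V) (↭-trans (↭.++⁺ˡ T eq′) eq) ,
    length-++ T , zeroSum-++ {T} {U} z z′

  block-complement : ∀ {T k l} → length T ≡ k + l → ZeroSum n w T → HasBlock n w k T → HasBlock n w l T
  block-complement {T} {k} {l} len z (U , V , eq , refl , zU) =
    V , U , ↭-trans (↭.++-comm V U) eq ,
    ℕ.+-cancelˡ-≡ k _ _ (trans (sym (length-++ U)) (trans (↭.↭-length eq) len)) ,
    λ i → ∣.∣m+n∣m⇒∣n (subst (n ∣_) (∑-++ i U V) (zeroSum-↭ (↭-sym eq) z i)) (zU i)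

-- The label type is arbitrary and group elements enter only as integer weights, so that in
-- `forcing-*` whole blocks can serve as terms.
Forcing : (n r l t : ℕ) → Set₁
Forcing n r l t = ∀ {A : Set} (w : A → Fin r → ℕ) S → t ≤ length S → HasBlock n w l S

forcing-mono : ∀ {n r l t t′} → t ≤ t′ → Forcing n r l t → Forcing n r l t′
forcing-mono t≤t′ F w S long = F w S (ℕ.≤-trans t≤t′ long)

module _ {n r l t : ℕ} (F : Forcing n r l t) where

  -- After u removals of l terms, t terms are still left for one more block.
  blocks : {A : Set} (w : A → Fin r → ℕ) → ∀ u S → u * l + t ≤ length S →
    ∃[ X ] ∃[ R ] concat X ++ R ↭ S × length X ≡ suc u ×
      All (λ B → length B ≡ l × ZeroSum n w B) X
  blocks w zero S long =
    let T , R , eq , len , z = F w S long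
    in T ∷ [] , R , subst (λ U → U ++ R ↭ S) (sym (++-identityʳ T)) eq , refl , (len , z) ∷ []
  blocks w (suc u) S long =
    let T , R , eq , len , z = F w S (ℕ.≤-trans (ℕ.m≤n+m t (l + u * l)) long)
        X , R′ , eq′ , len′ , zs = blocks w u R (ℕ.+-cancelˡ-≤ l _ _ (begin
          l + (u * l + t)  ≡⟨ ℕ.+-assoc l (u * l) t ⟨
          l + u * l + t    ≤⟨ long ⟩
          length S         ≡⟨ rest-length T eq len ⟩
          l + length R     ∎))
    in T ∷ X , R′ ,
       ↭-trans (↭.++-assoc T (concat X) R′) (↭-trans (↭.++⁺ˡ T eq′) eq) ,
       cong suc len′ , (len , z) ∷ zs
    where open ℕ.≤-Reasoning

-- Block sums divided by n₁ are the weights of a new sequence with blocks as terms; a choice of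
-- blocks that is zero-sum modulo n₂ concatenates to one that is zero-sum modulo n₁ n₂. The `suc u`
-- blocks required are supplied by `blocks`.
forcing-* : ∀ {n₁ n₂ r l₁ l₂ t₁ u} → .{{NonZero n₁}} →
  Forcing n₁ r l₁ t₁ → Forcing n₂ r l₂ (suc u) → Forcing (n₁ * n₂) r (l₂ * l₁) (u * l₁ + t₁)
forcing-* {n₁} {n₂} {r} {l₁} {u = u} F₁ F₂ {A} w S long =
  let X , R , eq , len , zs = blocks F₁ w u S long
      Y , Z , eq′ , len′ , z = F₂ blockSum X (ℕ.≤-reflexive (sym len))
      zsY = All.++⁻ˡ Y (↭.All-resp-↭ (↭-sym eq′) zs)
  in concat Y , concat Z ++ R ,
     ↭-trans (↭-sym (↭.++-assoc (concat Y) (concat Z) R))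
       (↭-trans (↭.++⁺ʳ R (↭-trans (↭-sym (concat-++ Y Z)) (concat-↭ eq′))) eq) ,
     trans (length-concat Y zsY) (cong (_* l₁) len′) ,
     λ i → subst (n₁ * n₂ ∣_) (sum-concat i Y zsY) (∣.*-monoʳ-∣ n₁ (z i))
  where
  blockSum : List A → Fin r → ℕ
  blockSum B i = sum (map (λ x → w x i) B) / n₁
  IsBlock : List A → Set
  IsBlock B = length B ≡ l₁ × ZeroSum n₁ w B
  length-concat : ∀ Y → All IsBlock Y → length (concat Y) ≡ length Y * l₁
  length-concat []      []               = refl
  length-concat (B ∷ Y) ((len , _) ∷ zs) = trans (length-++ B) (cong₂ _+_ len (length-concat Y zs))
  sum-concat : ∀ i Y → All IsBlock Y →
    n₁ * sum (map (λ B → blockSum B i) Y) ≡ sum (map (λ x → w x i) (concat Y))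
  sum-concat i []      []             = ℕ.*-zeroʳ n₁
  sum-concat i (B ∷ Y) ((_ , z) ∷ zs) = begin
    n₁ * (blockSum B i + sum (map (λ B → blockSum B i) Y))
      ≡⟨ ℕ.*-distribˡ-+ n₁ (blockSum B i) _ ⟩
    n₁ * blockSum B i + n₁ * sum (map (λ B → blockSum B i) Y)
      ≡⟨ cong₂ _+_ (trans (ℕ.*-comm n₁ _) (m/n*n≡m (z i))) (sum-concat i Y zs) ⟩
    sum (map (λ x → w x i) B) + sum (map (λ x → w x i) (concat Y))
      ≡⟨ ∑-++ {n = n₁} {w} i B (concat Y) ⟨
    sum (map (λ x → w x i) (B ++ concat Y)) ∎
    where open ≡-Reasoning

module _ {n r : ℕ} .{{_ : NonZero n}} where
  open AbelianGroup (C^ n r) using (Carrier)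

  σ≡sum-mod : ∀ T i → σ (C^ n r) T i ≡ sum (map (λ x → toℕ (x i)) T) mod n
  σ≡sum-mod []      i = refl
  σ≡sum-mod (x ∷ T) i = trans (cong (λ j → (toℕ (x i) + toℕ j) mod n) (σ≡sum-mod T i))
    (mod-+ʳ n (toℕ (x i)) _)

  forcing⇒forces : ∀ {l t} → Forcing n r l t → Forces (C^ n r) l t
  forcing⇒forces F S long =
    let T , T⊆S , len , z = block-⊆ (F (λ x i → toℕ (x i)) S long)
    in T , T⊆S , len , λ i → trans (σ≡sum-mod T i)
         (mod-cong n (trans (n∣m⇒m%n≡0 _ n (z i)) (sym (n∣m⇒m%n≡0 0 n (n ∣.∣0)))))

  forces⇒forcing : ∀ {l t} → Forces (C^ n r) l t → Forcing n r l t
  forces⇒forcing F {A} w S long =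
    let T , T⊆ , len , z = F (map reduce S) (subst (_ ≤_) (sym (length-map reduce S)) long)
        T′ , T′⊆ , eq = ⊆-map⁻ reduce S T⊆
    in ⊆⇒block T′⊆ (trans (sym (length-map reduce T′)) (trans (cong length (sym eq)) len)) λ i →
         m%n≡0⇒n∣m _ n (begin
           sum (map (λ x → w x i) T′) % n            ≡⟨ toℕ-mod n _ ⟨
           toℕ (sum (map (λ x → w x i) T′) mod n)   ≡⟨ cong toℕ (σ-reduce T′ i) ⟨
           toℕ (σ (C^ n r) (map reduce T′) i)       ≡⟨ cong (λ U → toℕ (σ (C^ n r) U i)) eq ⟨
           toℕ (σ (C^ n r) T i)                     ≡⟨ cong toℕ (z i) ⟩
           toℕ (0 mod n)                            ≡⟨ toℕ-mod n 0 ⟩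
           0 % n                                    ≡⟨ n∣m⇒m%n≡0 0 n (n ∣.∣0) ⟩
           0                                        ∎)
    where
    open ≡-Reasoning
    reduce : A → Carrier
    reduce x i = w x i mod n
    σ-reduce : ∀ T i → σ (C^ n r) (map reduce T) i ≡ sum (map (λ x → w x i) T) mod n
    σ-reduce []      i = refl
    σ-reduce (x ∷ T) i = trans (cong (λ j → (toℕ (w x i mod n) + toℕ j) mod n) (σ-reduce T i))
      (trans (mod-+ʳ n (toℕ (w x i mod n)) _) (mod-+ˡ n (w x i) _))

-- Prime powers: levels

-- |S| ≥ (c + r) q − r, without truncated subtraction.
Level : {A : Set} (q r c : ℕ) → List A → Set
Level q r c S = (c + r) * q ≤ length S + r

Attains : (q r k : ℕ) → Set₁
Attains q r k = ∀ {A : Set} (w : A → Fin r → ℕ) S → Level q r k S → HasBlock q w (k * q) S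

level-rest : ∀ {A : Set} {q r} c d (T : List A) {R S} → T ++ R ↭ S → length T ≡ d * q →
  Level q r (d + c) S → Level q r c R
level-rest {q = q} {r} c d T {R} {S} eq len lev = ℕ.+-cancelˡ-≤ (d * q) _ _ (begin
  d * q + (c + r) * q     ≡⟨ ℕ.*-distribʳ-+ q d (c + r) ⟨
  (d + (c + r)) * q       ≡⟨ cong (_* q) (ℕ.+-assoc d c r) ⟨
  (d + c + r) * q         ≤⟨ lev ⟩
  length S + r            ≡⟨ cong (_+ r) (rest-length T eq len) ⟩
  d * q + length R + r    ≡⟨ ℕ.+-assoc (d * q) (length R) r ⟩
  d * q + (length R + r)  ∎)
  where open ℕ.≤-Reasoning

level-mono : ∀ {A : Set} {q r} {c d} (S : List A) → c ≤ d → Level q r d S → Level q r c S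
level-mono {q = q} {r} S c≤d = ℕ.≤-trans (ℕ.*-monoˡ-≤ q (ℕ.+-monoˡ-≤ r c≤d))

attains-remove : ∀ {q r} k l {A : Set} {w : A → Fin r → ℕ} {S} → Level q r (k + l) S →
  HasBlock q w (k * q) S → Attains q r l → HasBlock q w ((k + l) * q) S
attains-remove {q} k l {w = w} {S} lev (T , R , eq , len , z) Al =
  subst (λ m → HasBlock q w m S) (sym (ℕ.*-distribʳ-+ q k l))
    (block-+ eq len z (Al w R (level-rest l k T eq len lev)))

attains-+ : ∀ {q r} k l → Attains q r k → Attains q r l → Attains q r (k + l)
attains-+ k l Ak Al w S lev =
  attains-remove k l lev (Ak w S (level-mono S (ℕ.m≤m+n k l) lev)) Al

attains-* : ∀ {q r k} → Attains q r k → ∀ m → Attains q r (suc m * k)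
attains-* {q} {r} {k} Ak zero    = subst (Attains q r) (sym (ℕ.+-identityʳ k)) Ak
attains-* {k = k} Ak (suc m) = attains-+ k (suc m * k) Ak (attains-* {k = k} Ak m)

attains⇒forcing : ∀ {q r k} → Attains q r k → Forcing q r (k * q) ((k + r) * q ∸ r)
attains⇒forcing {q} {r} {k} Ak w S long = Ak w S (begin
  (k + r) * q              ≤⟨ ℕ.m≤n+m∸n ((k + r) * q) r ⟩
  r + ((k + r) * q ∸ r)    ≤⟨ ℕ.+-monoʳ-≤ r long ⟩
  r + length S             ≡⟨ ℕ.+-comm r (length S) ⟩
  length S + r             ∎)
  where open ℕ.≤-Reasoning

module PrimePower {p : ℕ} (pp : Prime p) (a : ℕ) (r : ℕ) (1≤r : 1 ≤ r) where
  open FiniteDifferences p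
  open ModuloPrime pp

  q : ℕ
  q = p ^ a

  private
    instance
      p≢0 : NonZero p
      p≢0 = prime⇒nonZero pp
      q≢0 : NonZero q
      q≢0 = ℕ.m^n≢0 p a

  -- S is first cut to exactly L = (c + r) q - r terms: then jq ≤ L < (c + r) q, strictly because r
  -- ≥ 1, which gives j < c + r.
  level-block : ∀ {A : Set} (w : A → Fin r → ℕ) c f → (∀ j → + p ℤ.∣ Δ^ c suc f j) →
    ¬ + p ℤ.∣ f 0 → ∀ S → Level q r c S →
    ∃[ j ] 1 ≤ j × j < c + r × HasBlock q w (j * q) S × ¬ + p ℤ.∣ f j
  level-block w c f p∣ f0≢0 S lev =
    let T , T⊆ , T≢[] , j , len , z , fj≢0 = zeroSum-exists a w c f p∣ f0≢0 (take L S)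
          (subst (λ l → (c + r) * q ≤ l + r) (sym length-S′)
            (ℕ.≤-trans (ℕ.m≤n+m∸n ((c + r) * q) r) (ℕ.≤-reflexive (ℕ.+-comm r L))))
    in j , positive j (subst (1 ≤_) len T≢[]) ,
       ℕ.*-cancelʳ-< q _ _ (begin-strict
         j * q           ≡⟨ len ⟨
         length T        ≤⟨ length-mono-≤ T⊆ ⟩
         length (take L S) ≡⟨ length-S′ ⟩
         L               <⟨ ℕ.∸-monoʳ-< {(c + r) * q} {r} {0} 1≤r r≤ ⟩
         (c + r) * q     ∎) ,
       ⊆⇒block (⊆-trans T⊆ (take-⊆ L S)) len z , fj≢0
    where
    open ℕ.≤-Reasoning
    L : ℕ
    L = (c + r) * q ∸ r
    length-S′ : length (take L S) ≡ L
    length-S′ = trans (length-take L S)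
      (ℕ.m≤n⇒m⊓n≡m (ℕ.m≤n+o⇒m∸n≤o ((c + r) * q) r (ℕ.≤-trans lev (ℕ.≤-reflexive (ℕ.+-comm (length S) r)))))
    r≤ : r ≤ (c + r) * q
    r≤ = ℕ.≤-trans (ℕ.m≤n+m r c) (ℕ.m≤m*n (c + r) q)
    positive : ∀ j → 1 ≤ j * q → 1 ≤ j
    positive (suc j) _ = s≤s z≤n

  -- The indicator of the multiples of pᵗ has degree < pᵗ modulo p, and pᵗ is its only
  -- multiple strictly between 0 and pᵗ + r.
  attains-p^ : ∀ t → r ≤ p ^ t → Attains q r (p ^ t)
  attains-p^ t r≤p^t w S lev =
    let j , 1≤j , j< , blk , f≢0 = level-block w (p ^ t) f
          (deg⇒∣ (p ^ t) (subst (λ n → Deg< (λ (_ : ⊤) → suc) n f) (ℕ.*-identityˡ (p ^ t))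
            (deg-pullback (λ _ → 1) (λ x → x) (λ _ _ → refl) (1 * p ^ t) {f}
              (deg-onMultiples t 1 (λ _ → ℤ.1ℤ) λ _ → ∣0))))
          (λ p∣ → p∤1 (subst (+ p ℤ.∣_) (onMultiples-0 (p ^ t) (λ _ → ℤ.1ℤ)) p∣)) S lev
        p^t∣j , _ = onMultiples-nonzero (p ^ t) (λ _ → ℤ.1ℤ) j f≢0
    in subst (λ j → HasBlock q w (j * q) S) (only-multiple p^t∣j 1≤j (ℕ.<-≤-trans j< (ℕ.+-monoʳ-≤ (p ^ t) r≤p^t))) blk
    where
    instance
      p^t≢0 : NonZero (p ^ t)
      p^t≢0 = ℕ.m^n≢0 p t
    f : ℕ → ℤ
    f = onMultiples (p ^ t) (λ _ → ℤ.1ℤ)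
    p∤1 : ¬ + p ℤ.∣ ℤ.1ℤ
    p∤1 p∣1 = ℕ.<⇒≱ (ℕ.nonTrivial⇒n>1 p {{prime⇒nonTrivial pp}}) (∣⇒≤ (ℤ.∣⇒∣ᵤ p∣1))
    only-multiple : ∀ {m j} → m ∣ j → 1 ≤ j → j < m + m → j ≡ m
    only-multiple {m} (divides zero refl) () _
    only-multiple {m} (divides (suc zero) eq) _ _ = trans eq (ℕ.+-identityʳ m)
    only-multiple {m} (divides (suc (suc k)) refl) _ j<2m = contradiction j<2m
      (ℕ.≤⇒≯ (ℕ.+-monoʳ-≤ m (ℕ.m≤m+n m (k * m))))

-- Certificates for attained levels

private
  -- 0 is exempt because `level-block` yields only j ≥ 1.
  Covers : (B E : List ℕ) (n : ℕ) → Set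
  Covers B E n = All (_∈ (0 ∷ B ++ E)) (upTo n)

  covers? : ∀ B E n → Dec (Covers B E n)
  covers? B E n = All.all? (_∈? (0 ∷ B ++ E)) (upTo n)

-- Derivable r P c B: every sequence of level c has a zero-sum subsequence of length bq with
-- b ∈ B.  By Leaf, lengths jq with j in a set E of fewer than c elements can be avoided: the
-- polynomial ∏ (j − e) of degree < c vanishes on E but not at 0, as long as p ∤ P.  Remove and
-- Inside refute one further length d: delete a zero-sum subsequence of length dq, or work
-- inside it, where complements of zero-sum subsequences are zero-sum.
data Derivable (r P : ℕ) : (c : ℕ) → List ℕ → Set where
  Leaf : ∀ {c B} E → {True (length E ℕ.<? c)} → {True (All.all? (_∣? P) E)} →
    {True (covers? B E (c + r))} → Derivable r P c B
  Remove : ∀ {c B} d {B′} → Derivable r P c B′ →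
    {True (All.all? (λ b → b ∈? B ⊎-dec d + b ∈? B) B′)} →
    Derivable r P (d + c) (d ∷ B) → Derivable r P (d + c) B
  Inside : ∀ {c B} d {B′} → Derivable r P d B′ →
    {True (All.all? (λ b → b ∈? B ⊎-dec Any.any? (λ b′ → d + r ℕ.≟ b + b′) B) B′)} →
    Derivable r P c (d + r ∷ B) → Derivable r P c B

module Soundness {p : ℕ} (pp : Prime p) (a : ℕ) (r : ℕ) (1≤r : 1 ≤ r) (P : ℕ) (p∤P : ¬ p ∣ P) where
  open FiniteDifferences p
  open PrimePower pp a r 1≤r

  ∏ : List ℕ → ℕ → ℤ
  ∏ []      j = ℤ.1ℤ
  ∏ (e ∷ E) j = (+ j ℤ.- + e) ℤ.* ∏ E j

  deg-∏ : ∀ E → Deg< (λ (_ : ⊤) → suc) (suc (length E)) (∏ E)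
  deg-∏ []      _ j = ∣0
  deg-∏ (e ∷ E) = deg-* 2 (length E) {λ j → + j ℤ.- + e} {∏ E} deg-linear (deg-∏ E)
    where
    lem : ∀ x e → (+ 1 ℤ.+ (+ 1 ℤ.+ x) ℤ.- e ℤ.- (+ 1 ℤ.+ x ℤ.- e)) ℤ.- ((+ 1 ℤ.+ x ℤ.- e) ℤ.- (x ℤ.- e)) ≡ + 0
    lem = ℤ-Ring.solve-∀
    deg-linear : Deg< (λ (_ : ⊤) → suc) 2 (λ j → + j ℤ.- + e)
    deg-linear _ _ x = subst (+ p ℤ.∣_) (sym (lem (+ x) (+ e))) ∣0

  -- Up to sign the value is the product of E, and p divides no divisor of P. Sharing one P among
  -- all leaves condenses what a derivation asks of p into p ∤ P.
  ∏-0 : ∀ E → All (_∣ P) E → ¬ + p ℤ.∣ ∏ E 0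
  ∏-0 []      _           p∣1 = ℕ.<⇒≱ (ℕ.nonTrivial⇒n>1 p {{prime⇒nonTrivial pp}}) (∣⇒≤ (ℤ.∣⇒∣ᵤ p∣1))
  ∏-0 (e ∷ E) (e∣P ∷ E∣P) p∣ with euclidsLemma ℤ.∣ + 0 ℤ.- + e ∣ ℤ.∣ ∏ E 0 ∣ pp
      (subst (p ∣_) (ℤ.abs-* (+ 0 ℤ.- + e) (∏ E 0)) (ℤ.∣⇒∣ᵤ p∣))
  ... | inj₁ p∣e = p∤P (∣.∣-trans (subst (p ∣_) (trans (cong ℤ.∣_∣ (ℤ.+-identityˡ (ℤ.- + e))) (ℤ.∣-i∣≡∣i∣ (+ e))) p∣e) e∣P)
  ... | inj₂ p∣∏ = ∏-0 E E∣P (ℤ.∣ᵤ⇒∣ p∣∏)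

  ∏-root : ∀ {E j} → j ∈ E → ∏ E j ≡ + 0
  ∏-root {e ∷ E} {j} (here refl) = cong (ℤ._* ∏ E j) (ℤ.i≡j⇒i-j≡0 {+ j} refl)
  ∏-root {e ∷ E} {j} (there j∈E) = trans (cong ((+ j ℤ.- + e) ℤ.*_) (∏-root j∈E)) (ℤ.*-zeroʳ (+ j ℤ.- + e))

  sound : ∀ {c B} → Derivable r P c B → ∀ {A : Set} (w : A → Fin r → ℕ) S → Level q r c S →
    ∃[ b ] b ∈ B × HasBlock q w (b * q) S
  sound {c} {B} (Leaf E {E<c} {E∣P} {cov}) w S lev =
    let j , 1≤j , j<c+r , blk , ∏≢0 = level-block w c (∏ E)
          (deg⇒∣ c (deg-mono {F = ∏ E} (toWitness E<c) (deg-∏ E))) (∏-0 E (toWitness E∣P)) S lev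
    in j , allowed j 1≤j ∏≢0 (All.lookup (toWitness cov) (∈-upTo⁺ j<c+r)) , blk
    where
    allowed : ∀ j → 1 ≤ j → ¬ + p ℤ.∣ ∏ E j → j ∈ 0 ∷ B ++ E → j ∈ B
    allowed _ () _ (here refl)
    allowed j _ ∏≢0 (there j∈) with ∈-++⁻ B j∈
    ... | inj₁ j∈B = j∈B
    ... | inj₂ j∈E = contradiction (subst (+ p ℤ.∣_) (sym (∏-root j∈E)) ∣0) ∏≢0
  sound {B = B} (Remove {c} d D {shift} D′) w S lev with sound D′ w S lev
  ... | b , there b∈B , blk = b , b∈B , blk
  ... | _ , here refl , T , R , eq , len , z with sound D w R (level-rest c d T eq len lev)
  ...   | b′ , b′∈B′ , blk with All.lookup (toWitness shift) b′∈B′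
  ...     | inj₁ b′∈B = b′ , b′∈B , block-rest eq blk
  ...     | inj₂ d+b′∈B = d + b′ , d+b′∈B ,
    subst (λ l → HasBlock q w l S) (sym (ℕ.*-distribʳ-+ q d b′)) (block-+ eq len z blk)
  sound {B = B} (Inside d D {shift} D′) w S lev with sound D′ w S lev
  ... | b , there b∈B , blk = b , b∈B , blk
  -- T has (d + r) q terms, r more than level d asks for, so `D` applies inside T; taking b′ q terms
  -- out of it leaves (d + r - b′) q.
  ... | _ , here refl , T , R , eq , len , z
      with sound D w T (subst (λ l → (d + r) * q ≤ l + r) (sym len) (ℕ.m≤m+n _ r))
  ...   | b′ , b′∈B′ , blk with All.lookup (toWitness shift) b′∈B′
  ...     | inj₁ b′∈B = b′ , b′∈B , block-widen eq blk
  ...     | inj₂ b″∈B =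
    let b″ , b″∈ , d+r≡ = satisfied b″∈B
    in b″ , b″∈ , block-widen eq (block-complement
         (trans len (trans (cong (_* q) d+r≡) (ℕ.*-distribʳ-+ q b′ b″))) z blk)
    where
    satisfied : ∀ {B} {X : ℕ → Set} → Any X B → ∃[ b ] b ∈ B × X b
    satisfied (here x)  = _ , here refl , x
    satisfied (there x) = let b , b∈ , Xb = satisfied x in b , there b∈ , Xb

  derivable⇒attains : ∀ {k} → Derivable r P k (k ∷ []) → Attains q r k
  derivable⇒attains D w S lev with sound D w S lev
  ... | _ , here refl , blk = blk

-- The derivations were found by exhaustive search.
derivable-3-3 : Derivable 3 12 3 (3 ∷ [])
derivable-3-3 = d3-3
  where
  d1-123 : Derivable 3 12 1 (1 ∷ 2 ∷ 3 ∷ [])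
  d1-123 = Leaf []
  d2-23 : Derivable 3 12 2 (2 ∷ 3 ∷ [])
  d2-23 = Remove 1 d1-123 (Leaf (4 ∷ []))
  d2-1234 : Derivable 3 12 2 (1 ∷ 2 ∷ 3 ∷ 4 ∷ [])
  d2-1234 = Leaf []
  d3-3 : Derivable 3 12 3 (3 ∷ [])
  d3-3 = Remove 1 d2-23 (Inside 2 d2-1234 (Leaf (2 ∷ 4 ∷ [])))

-- Local names give the level and then B: `d3-34` has level 3 and B = {3, 4}. In the derivations
-- with P = 12 all roots are among 1, 2, 3, 4, 6, with least common multiple 12.
derivable-3-4 : Derivable 3 12 4 (4 ∷ [])
derivable-3-4 = d4-4
  where
  d2-234 : Derivable 3 12 2 (2 ∷ 3 ∷ 4 ∷ [])
  d2-234 = Leaf (1 ∷ [])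
  d1-123 : Derivable 3 12 1 (1 ∷ 2 ∷ 3 ∷ [])
  d1-123 = Leaf []
  d2-1234 : Derivable 3 12 2 (1 ∷ 2 ∷ 3 ∷ 4 ∷ [])
  d2-1234 = Leaf []
  d3-34 : Derivable 3 12 3 (3 ∷ 4 ∷ [])
  d3-34 = Remove 1 d2-234 (Remove 2 d1-123 (Inside 2 d2-1234 (Leaf [])))
  d2-124 : Derivable 3 12 2 (1 ∷ 2 ∷ 4 ∷ [])
  d2-124 = Leaf (3 ∷ [])
  d4-4 : Derivable 3 12 4 (4 ∷ [])
  d4-4 = Remove 1 d3-34 (Remove 2 d2-124 (Inside 2 d2-1234 (Leaf (3 ∷ 6 ∷ []))))

derivable-4-4 : Derivable 4 12 4 (4 ∷ [])
derivable-4-4 = d4-4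
  where
  d1-1234 : Derivable 4 12 1 (1 ∷ 2 ∷ 3 ∷ 4 ∷ [])
  d1-1234 = Leaf []
  d2-234 : Derivable 4 12 2 (2 ∷ 3 ∷ 4 ∷ [])
  d2-234 = Remove 1 d1-1234 (Inside 1 d1-1234 (Leaf []))
  d3-34 : Derivable 4 12 3 (3 ∷ 4 ∷ [])
  d3-34 = Remove 1 d2-234 (Remove 2 d1-1234 (Inside 1 d1-1234 (Leaf (6 ∷ []))))
  d2-124 : Derivable 4 12 2 (1 ∷ 2 ∷ 4 ∷ [])
  d2-124 = Inside 1 d1-1234 (Leaf (3 ∷ []))
  d2-1245 : Derivable 4 12 2 (1 ∷ 2 ∷ 4 ∷ 5 ∷ [])
  d2-1245 = Leaf (3 ∷ [])
  d3-123456 : Derivable 4 12 3 (1 ∷ 2 ∷ 3 ∷ 4 ∷ 5 ∷ 6 ∷ [])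
  d3-123456 = Leaf []
  d4-4 : Derivable 4 12 4 (4 ∷ [])
  d4-4 = Remove 1 d3-34 (Remove 2 d2-124 (Inside 1 d1-1234 (Inside 2 d2-1245 (Remove 3 d1-1234 (Inside 3 d3-123456 (Leaf []))))))

-- The roots are 1 to 6, 8, 9 and 10, with least common multiple 360; 5 and 10 are the ones that
-- exclude p = 5.
derivable-4-7 : Derivable 4 360 7 (7 ∷ [])
derivable-4-7 = d7-7
  where
  d4-4567 : Derivable 4 360 4 (4 ∷ 5 ∷ 6 ∷ 7 ∷ [])
  d4-4567 = Leaf (1 ∷ 2 ∷ 3 ∷ [])
  d5-567 : Derivable 4 360 5 (5 ∷ 6 ∷ 7 ∷ [])
  d5-567 = Remove 1 d4-4567 (Leaf (2 ∷ 3 ∷ 4 ∷ 8 ∷ []))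
  d4-14567 : Derivable 4 360 4 (1 ∷ 4 ∷ 5 ∷ 6 ∷ 7 ∷ [])
  d4-14567 = Leaf (2 ∷ 3 ∷ [])
  d1-1234 : Derivable 4 360 1 (1 ∷ 2 ∷ 3 ∷ 4 ∷ [])
  d1-1234 = Leaf []
  d3-12346 : Derivable 4 360 3 (1 ∷ 2 ∷ 3 ∷ 4 ∷ 6 ∷ [])
  d3-12346 = Inside 1 d1-1234 (Leaf [])
  d2-123 : Derivable 4 360 2 (1 ∷ 2 ∷ 3 ∷ [])
  d2-123 = Inside 1 d1-1234 (Leaf (4 ∷ []))
  d6-67 : Derivable 4 360 6 (6 ∷ 7 ∷ [])
  d6-67 = Remove 1 d5-567 (Remove 2 d4-14567 (Remove 3 d3-12346 (Remove 4 d2-123 (Leaf (5 ∷ 8 ∷ 9 ∷ [])))))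
  d2-1245 : Derivable 4 360 2 (1 ∷ 2 ∷ 4 ∷ 5 ∷ [])
  d2-1245 = Leaf (3 ∷ [])
  d5-157 : Derivable 4 360 5 (1 ∷ 5 ∷ 7 ∷ [])
  d5-157 = Remove 3 d2-1245 (Leaf (2 ∷ 4 ∷ 6 ∷ 8 ∷ []))
  d4-1247 : Derivable 4 360 4 (1 ∷ 2 ∷ 4 ∷ 7 ∷ [])
  d4-1247 = Inside 1 d1-1234 (Leaf (3 ∷ 6 ∷ []))
  d3-123 : Derivable 4 360 3 (1 ∷ 2 ∷ 3 ∷ [])
  d3-123 = Inside 1 d1-1234 (Leaf (4 ∷ 6 ∷ []))
  d2-1234 : Derivable 4 360 2 (1 ∷ 2 ∷ 3 ∷ 4 ∷ [])
  d2-1234 = Inside 1 d1-1234 (Leaf [])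
  d7-7 : Derivable 4 360 7 (7 ∷ [])
  d7-7 = Remove 1 d6-67 (Remove 2 d5-157 (Remove 3 d4-1247 (Remove 4 d3-123 (Remove 5 d2-1234 (Leaf (6 ∷ 8 ∷ 9 ∷ 10 ∷ []))))))

-- Removing subsequences of length q: the primes 2 and 3

forcing-trivial : ∀ {r} → Forcing 1 r 1 1
forcing-trivial w (x ∷ S) _ = [ x ] , S , ↭-refl , refl , λ i → ∣.1∣ _

-- Bounds of the shape m (q - 1) + 1 are stable under `forcing-*`: m (x - 1) p + m (p - 1) + 1 = m
-- (x p - 1) + 1.
egz-power : ∀ {p r m} → .{{NonZero p}} → Forcing p r p (suc (m * ℕ.pred p)) →
  ∀ a → Forcing (p ^ a) r (p ^ a) (suc (m * ℕ.pred (p ^ a)))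
egz-power {r = r} {m} F zero = subst (λ t → Forcing 1 r 1 (suc t)) (sym (ℕ.*-zeroʳ m)) forcing-trivial
egz-power {p} {r} {m} F (suc a) w S long =
  subst (λ l → HasBlock (p * p ^ a) w l S) (ℕ.*-comm (p ^ a) p)
    (forcing-* F (egz-power {m = m} F a) w S (ℕ.≤-trans (ℕ.≤-reflexive bound) long))
  where
  instance
    p^a≢0 : NonZero (p ^ a)
    p^a≢0 = ℕ.m^n≢0 p a
    p^1+a≢0 : NonZero (p ^ suc a)
    p^1+a≢0 = ℕ.m^n≢0 p (suc a)
  lem : ∀ m x y → m * x * suc y + suc (m * y) ≡ suc (m * (y + x * suc y))
  lem = ℕ-Ring.solve-∀
  bound : m * ℕ.pred (p ^ a) * p + suc (m * ℕ.pred p) ≡ suc (m * ℕ.pred (p ^ suc a))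
  bound = begin
    m * ℕ.pred (p ^ a) * p + suc (m * ℕ.pred p)
      ≡⟨ cong (λ x → m * ℕ.pred (p ^ a) * x + suc (m * ℕ.pred p)) (ℕ.suc-pred p) ⟨
    m * ℕ.pred (p ^ a) * suc (ℕ.pred p) + suc (m * ℕ.pred p)
      ≡⟨ lem m (ℕ.pred (p ^ a)) (ℕ.pred p) ⟩
    suc (m * (ℕ.pred p + ℕ.pred (p ^ a) * suc (ℕ.pred p)))
      ≡⟨ cong (λ x → suc (m * ℕ.pred x)) (begin
           suc (ℕ.pred (p ^ a)) * suc (ℕ.pred p)  ≡⟨ cong₂ _*_ (ℕ.suc-pred (p ^ a)) (ℕ.suc-pred p) ⟩
           p ^ a * p                             ≡⟨ ℕ.*-comm (p ^ a) p ⟩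
           p ^ suc a                             ∎) ⟩
    suc (m * ℕ.pred (p ^ suc a)) ∎
    where open ≡-Reasoning

lookup-pair-⊆ : {A : Set} (S : List A) {i j : Fin (length S)} → i Fin.< j →
  lookup S i ∷ lookup S j ∷ [] ⊆ S
lookup-pair-⊆ (x ∷ S) {zero}  {suc j} _   = refl ∷ lookup-⊆ S j
  where
  lookup-⊆ : ∀ S j → lookup S j ∷ [] ⊆ S
  lookup-⊆ (x ∷ S) zero    = refl ∷ minimum S
  lookup-⊆ (x ∷ S) (suc j) = x ∷ʳ lookup-⊆ S j
lookup-pair-⊆ (x ∷ S) {suc i} {suc j} i<j = x ∷ʳ lookup-pair-⊆ S (ℕ.s<s⁻¹ i<j)

-- Two terms with the same residues modulo 2 have sum zero, and there are 2^r residue vectors. The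
-- factor 1 is q - 1 for q = 2, as `egz-power` expects.
egz-2 : ∀ r → Forcing 2 r 2 (suc (2 ^ r * 1))
egz-2 r w S long =
  let i , j , i<j , eq = Fin.pigeonhole (subst (_< length S) (ℕ.*-identityʳ (2 ^ r)) long)
        (λ i → code 2 r (residue (lookup S i)))
  in ⊆⇒block (lookup-pair-⊆ S i<j) refl λ k → same (w (lookup S i) k) (w (lookup S j) k)
       (code-injective 2 r (residue (lookup S i)) (residue (lookup S j)) eq k)
  where
  residue : _ → Fin r → Fin 2
  residue x i = w x i mod 2
  even : ∀ (i : Fin 2) → (toℕ i + toℕ i) % 2 ≡ 0
  even zero       = refl
  even (suc zero) = refl
  same : ∀ x y → x mod 2 ≡ y mod 2 → 2 ∣ x + (y + 0)
  same x y eq = m%n≡0⇒n∣m _ 2 (begin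
    (x + (y + 0)) % 2                     ≡⟨ cong (λ z → (x + z) % 2) (ℕ.+-identityʳ y) ⟩
    (x + y) % 2                           ≡⟨ %-distribˡ-+ x y 2 ⟩
    (x % 2 + y % 2) % 2                   ≡⟨ cong₂ (λ a b → (a + b) % 2) (toℕ-mod 2 x) (toℕ-mod 2 y) ⟨
    (toℕ (x mod 2) + toℕ (y mod 2)) % 2   ≡⟨ cong (λ z → (toℕ (x mod 2) + toℕ z) % 2) eq ⟨
    (toℕ (x mod 2) + toℕ (x mod 2)) % 2   ≡⟨ even (x mod 2) ⟩
    0                                     ∎)
    where open ≡-Reasoning

-- Lines and linear functionals over 𝔽₃

infixl 6 _⊕_
infixl 7 _⊗_

_⊕_ _⊗_ : Fin 3 → Fin 3 → Fin 3
i ⊕ j = (toℕ i + toℕ j) mod 3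
i ⊗ j = (toℕ i * toℕ j) mod 3

⟦_≡_⟧ : Fin 3 → Fin 3 → ℕ
⟦ i ≡ j ⟧ = if does (i Fin.≟ j) then 1 else 0

∑₃ : (Fin 3 → ℕ) → ℕ
∑₃ f = f zero + f (suc zero) + f (suc (suc zero))

private
  all₃ : ∀ {P : Fin 3 → Set} → (∀ i → Dec (P i)) → Dec (∀ i → P i)
  all₃ = Fin.all?

⊕-assoc : ∀ i j k → i ⊕ (j ⊕ k) ≡ i ⊕ j ⊕ k
⊕-assoc = from-yes (all₃ λ i → all₃ λ j → all₃ λ k → i ⊕ (j ⊕ k) Fin.≟ i ⊕ j ⊕ k)

⊕-identityˡ : ∀ i → zero ⊕ i ≡ i
⊕-identityˡ = from-yes (all₃ λ i → zero ⊕ i Fin.≟ i)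

zero-sum-⊗⊕ : ∀ a x y z s t u → x ⊕ y ⊕ z ≡ zero → s ⊕ t ⊕ u ≡ zero →
  a ⊗ x ⊕ s ⊕ (a ⊗ y ⊕ t) ⊕ (a ⊗ z ⊕ u) ≡ zero
zero-sum-⊗⊕ = from-yes (all₃ λ a → all₃ λ x → all₃ λ y → all₃ λ z → all₃ λ s → all₃ λ t → all₃ λ u →
  (x ⊕ y ⊕ z Fin.≟ zero) →-dec ((s ⊕ t ⊕ u Fin.≟ zero) →-dec
    (a ⊗ x ⊕ s ⊕ (a ⊗ y ⊕ t) ⊕ (a ⊗ z ⊕ u) Fin.≟ zero)))

solve-coordinate : ∀ a x y s → a ≢ zero → a ⊗ x ⊕ s ≡ a ⊗ y ⊕ s → x ≡ y
solve-coordinate = from-yes (all₃ λ a → all₃ λ x → all₃ λ y → all₃ λ s →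
  ¬? (a Fin.≟ zero) →-dec ((a ⊗ x ⊕ s Fin.≟ a ⊗ y ⊕ s) →-dec (x Fin.≟ y)))

solve-zero-sum : ∀ a x y z s t u → a ≢ zero → a ⊗ x ⊕ s ≡ a ⊗ y ⊕ t → a ⊗ x ⊕ s ≡ a ⊗ z ⊕ u →
  s ⊕ t ⊕ u ≡ zero → x ⊕ y ⊕ z ≡ zero
solve-zero-sum = from-yes (all₃ λ a → all₃ λ x → all₃ λ y → all₃ λ z → all₃ λ s → all₃ λ t → all₃ λ u →
  ¬? (a Fin.≟ zero) →-dec ((a ⊗ x ⊕ s Fin.≟ a ⊗ y ⊕ t) →-dec ((a ⊗ x ⊕ s Fin.≟ a ⊗ z ⊕ u) →-dec
    ((s ⊕ t ⊕ u Fin.≟ zero) →-dec (x ⊕ y ⊕ z Fin.≟ zero)))))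

-- The equation for a reads a (x - y) = v - u.
one-slope : ∀ u v x y s → x ≢ y → ∑₃ (λ a → ⟦ u ⊕ (a ⊗ x ⊕ s) ≡ v ⊕ (a ⊗ y ⊕ s) ⟧) ≡ 1
one-slope = from-yes (all₃ λ u → all₃ λ v → all₃ λ x → all₃ λ y → all₃ λ s →
  ¬? (x Fin.≟ y) →-dec (∑₃ (λ a → ⟦ u ⊕ (a ⊗ x ⊕ s) ≡ v ⊕ (a ⊗ y ⊕ s) ⟧) ℕ.≟ 1))

distinct-zero-sum : ∀ x y z → x ≢ y → x ≢ z → y ≢ z → x ⊕ y ⊕ z ≡ zero
distinct-zero-sum = from-yes (all₃ λ x → all₃ λ y → all₃ λ z →
  ¬? (x Fin.≟ y) →-dec (¬? (x Fin.≟ z) →-dec (¬? (y Fin.≟ z) →-dec (x ⊕ y ⊕ z Fin.≟ zero))))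

𝔽₃ : ℕ → Set
𝔽₃ d = Vec (Fin 3) d

0⃗ : ∀ {d} → 𝔽₃ d
0⃗ = Vec.replicate _ zero

_∙_ : ∀ {d} → 𝔽₃ d → 𝔽₃ d → Fin 3
[]      ∙ []      = zero
(a ∷ φ) ∙ (x ∷ v) = a ⊗ x ⊕ φ ∙ v

-- Three distinct points of 𝔽₃ᵈ form an affine line exactly when their sum is 0.
Collinear : ∀ {d} → 𝔽₃ d → 𝔽₃ d → 𝔽₃ d → Set
Collinear x y z = Vec.zipWith _⊕_ (Vec.zipWith _⊕_ x y) z ≡ 0⃗

∙-collinear : ∀ {d} (φ x y z : 𝔽₃ d) → Collinear x y z → φ ∙ x ⊕ φ ∙ y ⊕ φ ∙ z ≡ zero
∙-collinear []      []      []      []      _  = refl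
∙-collinear (a ∷ φ) (x ∷ u) (y ∷ v) (z ∷ w) eq =
  let eq₁ , eq₂ = Vec.∷-injective eq
  in zero-sum-⊗⊕ a x y z (φ ∙ u) (φ ∙ v) (φ ∙ w) eq₁ (∙-collinear φ u v w eq₂)

-- On a level set of φ ≠ 0 one coordinate is determined by the others, so forgetting it embeds
-- the level set into 𝔽₃ᵈ and reflects lines.
record Projection {d} (φ : 𝔽₃ (suc d)) : Set where
  field
    π         : 𝔽₃ (suc d) → 𝔽₃ d
    injective : ∀ x y → φ ∙ x ≡ φ ∙ y → π x ≡ π y → x ≡ y
    collinear : ∀ x y z → φ ∙ x ≡ φ ∙ y → φ ∙ x ≡ φ ∙ z → Collinear (π x) (π y) (π z) → Collinear x y z

-- The coordinate forgotten is the first at which φ is nonzero.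
projection : ∀ {d} (φ : 𝔽₃ (suc d)) → φ ≢ 0⃗ → Projection φ
projection {d} (a ∷ φ) φ≢0 with a Fin.≟ zero
... | no a≢0 = record
  { π         = Vec.tail
  ; injective = λ { (x ∷ u) (y ∷ .u) eq refl → cong (_∷ u) (solve-coordinate a x y (φ ∙ u) a≢0 eq) }
  ; collinear = λ { (x ∷ u) (y ∷ v) (z ∷ w) eq₁ eq₂ l → cong₂ _∷_
      (solve-zero-sum a x y z (φ ∙ u) (φ ∙ v) (φ ∙ w) a≢0 eq₁ eq₂ (∙-collinear φ u v w l)) l }
  }
projection {zero}  (.zero ∷ []) φ≢0 | yes refl = contradiction refl φ≢0
projection {suc d} (.zero ∷ φ)  φ≢0 | yes refl = record
  { π         = λ { (x ∷ u) → x ∷ P.π u }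
  ; injective = λ { (x ∷ u) (y ∷ v) eq eq′ →
      let x≡y , πu≡πv = Vec.∷-injective eq′
      in cong₂ _∷_ x≡y (P.injective u v (drop u v eq) πu≡πv) }
  ; collinear = λ { (x ∷ u) (y ∷ v) (z ∷ w) eq₁ eq₂ l →
      let l₁ , l₂ = Vec.∷-injective l
      in cong₂ _∷_ l₁ (P.collinear u v w (drop u v eq₁) (drop u w eq₂) l₂) }
  }
  where
  module P = Projection (projection φ (φ≢0 ∘ cong (zero ∷_)))
  drop : ∀ u v → zero ⊕ φ ∙ u ≡ zero ⊕ φ ∙ v → φ ∙ u ≡ φ ∙ v
  drop u v eq = trans (sym (⊕-identityˡ (φ ∙ u))) (trans eq (⊕-identityˡ (φ ∙ v)))

-- Counting over all linear functionals

∑ᵥ : ∀ d → (𝔽₃ d → ℕ) → ℕ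
∑ᵥ zero    f = f []
∑ᵥ (suc d) f = ∑₃ λ a → ∑ᵥ d (f ∘ (a ∷_))

∑₃-cong : ∀ {f g} → (∀ a → f a ≡ g a) → ∑₃ f ≡ ∑₃ g
∑₃-cong f≡g = cong₂ _+_ (cong₂ _+_ (f≡g zero) (f≡g (suc zero))) (f≡g (suc (suc zero)))

∑ᵥ-cong : ∀ d {f g} → (∀ φ → f φ ≡ g φ) → ∑ᵥ d f ≡ ∑ᵥ d g
∑ᵥ-cong zero    f≡g = f≡g []
∑ᵥ-cong (suc d) f≡g = ∑₃-cong λ a → ∑ᵥ-cong d (f≡g ∘ (a ∷_))

∑ᵥ-+ : ∀ d f g → ∑ᵥ d (λ φ → f φ + g φ) ≡ ∑ᵥ d f + ∑ᵥ d g
∑ᵥ-+ zero    f g = refl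
∑ᵥ-+ (suc d) f g = trans (∑₃-cong λ a → ∑ᵥ-+ d (f ∘ (a ∷_)) (g ∘ (a ∷_)))
  (lem (F zero) (G zero) (F (suc zero)) (G (suc zero)) (F (suc (suc zero))) (G (suc (suc zero))))
  where
  F G : Fin 3 → ℕ
  F a = ∑ᵥ d (f ∘ (a ∷_))
  G a = ∑ᵥ d (g ∘ (a ∷_))
  lem : ∀ a b c d e f → (a + b) + (c + d) + (e + f) ≡ (a + c + e) + (b + d + f)
  lem = ℕ-Ring.solve-∀

∑ᵥ-const : ∀ d k → ∑ᵥ d (λ _ → k) ≡ 3 ^ d * k
∑ᵥ-const zero    k = sym (ℕ.+-identityʳ k)
∑ᵥ-const (suc d) k = trans (cong (λ s → s + s + s) (∑ᵥ-const d k)) (lem (3 ^ d) k)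
  where
  lem : ∀ x k → x * k + x * k + x * k ≡ 3 * x * k
  lem = ℕ-Ring.solve-∀

∑ᵥ-mono : ∀ d {f g} → (∀ φ → f φ ≤ g φ) → ∑ᵥ d f ≤ ∑ᵥ d g
∑ᵥ-mono zero    f≤g = f≤g []
∑ᵥ-mono (suc d) f≤g = ℕ.+-mono-≤ (ℕ.+-mono-≤ (part zero) (part (suc zero))) (part (suc (suc zero)))
  where
  part = λ a → ∑ᵥ-mono d (f≤g ∘ (a ∷_))

-- The value at 0 is kept and the other 3^d - 1 values are replaced by B; the extra B on the left
-- stands for the -1.
∑ᵥ-bound : ∀ d f B → (∀ φ → φ ≢ 0⃗ → f φ ≤ B) → ∑ᵥ d f + B ≤ f 0⃗ + 3 ^ d * B
∑ᵥ-bound zero    f B f≤B = ℕ.≤-reflexive (cong (f [] ℕ.+_) (sym (ℕ.+-identityʳ B)))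
∑ᵥ-bound (suc d) f B f≤B = begin
  F zero + F (suc zero) + F (suc (suc zero)) + B
    ≤⟨ ℕ.+-monoˡ-≤ B (ℕ.+-mono-≤ (ℕ.+-monoʳ-≤ (F zero) (other (suc zero) λ ())) (other (suc (suc zero)) λ ())) ⟩
  F zero + 3 ^ d * B + 3 ^ d * B + B
    ≡⟨ lem₁ (F zero) (3 ^ d * B) B ⟩
  F zero + B + (3 ^ d * B + 3 ^ d * B)
    ≤⟨ ℕ.+-monoˡ-≤ _ (∑ᵥ-bound d (f ∘ (zero ∷_)) B λ φ φ≢0 → f≤B (zero ∷ φ) (φ≢0 ∘ proj₂ ∘ Vec.∷-injective)) ⟩
  f 0⃗ + 3 ^ d * B + (3 ^ d * B + 3 ^ d * B)
    ≡⟨ lem₂ (f 0⃗) (3 ^ d) B ⟩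
  f 0⃗ + 3 ^ suc d * B ∎
  where
  open ℕ.≤-Reasoning
  F : Fin 3 → ℕ
  F a = ∑ᵥ d (f ∘ (a ∷_))
  other : ∀ a → a ≢ zero → F a ≤ 3 ^ d * B
  other a a≢0 = ℕ.≤-trans (∑ᵥ-mono d λ φ → f≤B (a ∷ φ) (a≢0 ∘ proj₁ ∘ Vec.∷-injective))
    (ℕ.≤-reflexive (∑ᵥ-const d B))
  lem₁ : ∀ x y z → x + y + y + z ≡ x + z + (y + y)
  lem₁ = ℕ-Ring.solve-∀
  lem₂ : ∀ x y z → x + y * z + (y * z + y * z) ≡ x + 3 * y * z
  lem₂ = ℕ-Ring.solve-∀

∑₃-∑ᵥ : ∀ d (f : Fin 3 → 𝔽₃ d → ℕ) → ∑₃ (λ a → ∑ᵥ d (f a)) ≡ ∑ᵥ d (λ φ → ∑₃ λ a → f a φ)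
∑₃-∑ᵥ d f = sym (trans (∑ᵥ-+ d (λ φ → f zero φ + f (suc zero) φ) (f (suc (suc zero))))
  (cong (_+ ∑ᵥ d (f (suc (suc zero)))) (∑ᵥ-+ d (f zero) (f (suc zero)))))

-- The offsets u and v make the induction work: if the tails differ, each choice of the first
-- coefficient a is absorbed into them. If the tails agree, the heads differ, and every choice of
-- the remaining coefficients admits exactly one a.
agreements-≢ : ∀ d (x y : 𝔽₃ (suc d)) u v → x ≢ y →
  ∑ᵥ (suc d) (λ φ → ⟦ u ⊕ φ ∙ x ≡ v ⊕ φ ∙ y ⟧) ≡ 3 ^ d
agreements-≢ d (x ∷ xs) (y ∷ ys) u v x≢y with Vec.≡-dec Fin._≟_ xs ys
... | yes refl = trans (∑₃-∑ᵥ d λ a φ → ⟦ u ⊕ (a ⊗ x ⊕ φ ∙ xs) ≡ v ⊕ (a ⊗ y ⊕ φ ∙ xs) ⟧)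
  (trans (∑ᵥ-cong d λ φ → one-slope u v x y (φ ∙ xs) (x≢y ∘ cong (_∷ xs)))
         (trans (∑ᵥ-const d 1) (ℕ.*-identityʳ (3 ^ d))))
agreements-≢ zero    (x ∷ []) (y ∷ []) u v x≢y | no xs≢ys = contradiction refl xs≢ys
agreements-≢ (suc d) (x ∷ xs) (y ∷ ys) u v x≢y | no xs≢ys =
  trans (∑₃-cong λ a → trans
          (∑ᵥ-cong (suc d) λ φ → cong₂ ⟦_≡_⟧ (⊕-assoc u (a ⊗ x) (φ ∙ xs)) (⊕-assoc v (a ⊗ y) (φ ∙ ys)))
          (agreements-≢ d xs ys (u ⊕ a ⊗ x) (v ⊕ a ⊗ y) xs≢ys))
    (lem (3 ^ d))
  where
  lem : ∀ k → k + k + k ≡ 3 * k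
  lem = ℕ-Ring.solve-∀

⟦≡⟧-refl : ∀ i → ⟦ i ≡ i ⟧ ≡ 1
⟦≡⟧-refl = from-yes (all₃ λ i → ⟦ i ≡ i ⟧ ℕ.≟ 1)

⟦≡⟧≤1 : ∀ i j → ⟦ i ≡ j ⟧ ≤ 1
⟦≡⟧≤1 = from-yes (all₃ λ i → all₃ λ j → ⟦ i ≡ j ⟧ ℕ.≤? 1)

agreements-≡ : ∀ d (x : 𝔽₃ d) → ∑ᵥ d (λ φ → ⟦ φ ∙ x ≡ φ ∙ x ⟧) ≡ 3 ^ d
agreements-≡ d x = trans (∑ᵥ-cong d λ φ → ⟦≡⟧-refl (φ ∙ x)) (trans (∑ᵥ-const d 1) (ℕ.*-identityʳ (3 ^ d)))

agreements-≥ : ∀ d (x y : 𝔽₃ (suc d)) → 3 ^ d ≤ ∑ᵥ (suc d) (λ φ → ⟦ φ ∙ x ≡ φ ∙ y ⟧)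
agreements-≥ d x y with Vec.≡-dec Fin._≟_ x y
... | yes refl = ℕ.≤-trans (ℕ.m≤n*m (3 ^ d) 3) (ℕ.≤-reflexive (sym (agreements-≡ (suc d) x)))
... | no x≢y   = ℕ.≤-reflexive (trans (sym (agreements-≢ d x y zero zero x≢y))
  (∑ᵥ-cong (suc d) λ φ → cong₂ ⟦_≡_⟧ (⊕-identityˡ (φ ∙ x)) (⊕-identityˡ (φ ∙ y))))

∑ₗ : {A : Set} → List A → (A → ℕ) → ℕ
∑ₗ X f = sum (map f X)

module _ {A : Set} where

  ∑ₗ-≤ : ∀ X {f : A → ℕ} {k} → (∀ x → f x ≤ k) → ∑ₗ X f ≤ length X * k
  ∑ₗ-≤ []      f≤k = z≤n
  ∑ₗ-≤ (x ∷ X) f≤k = ℕ.+-mono-≤ (f≤k x) (∑ₗ-≤ X f≤k)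

  ∑ₗ-≥ : ∀ X {f : A → ℕ} {k} → (∀ {x} → x ∈ X → k ≤ f x) → length X * k ≤ ∑ₗ X f
  ∑ₗ-≥ []      k≤f = z≤n
  ∑ₗ-≥ (x ∷ X) k≤f = ℕ.+-mono-≤ (k≤f (here refl)) (∑ₗ-≥ X (k≤f ∘ there))

  -- For the diagonal pairs: x agrees with itself under 3^(d+1) functionals, 2 · 3^d more than the
  -- 3^d guaranteed for every pair.
  ∑ₗ-≥-∈ : ∀ {X x} {f : A → ℕ} {k m} → x ∈ X → (∀ x → k ≤ f x) → k + m ≤ f x → length X * k + m ≤ ∑ₗ X f
  ∑ₗ-≥-∈ {_ ∷ X} {f = f} {k} {m} (here refl) k≤f k+m≤ = begin
    k + length X * k + m    ≡⟨ lem k (length X * k) m ⟩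
    k + m + length X * k    ≤⟨ ℕ.+-mono-≤ k+m≤ (∑ₗ-≥ X λ {x} _ → k≤f x) ⟩
    _                       ∎
    where
    open ℕ.≤-Reasoning
    lem : ∀ a b c → a + b + c ≡ a + c + b
    lem = ℕ-Ring.solve-∀
  ∑ₗ-≥-∈ {y ∷ X} {f = f} {k} {m} (there x∈X) k≤f k+m≤ =
    ℕ.≤-trans (ℕ.≤-reflexive (ℕ.+-assoc k (length X * k) m))
      (ℕ.+-mono-≤ (k≤f y) (∑ₗ-≥-∈ {f = f} x∈X k≤f k+m≤))

  ∑ᵥ-∑ₗ : ∀ d X (g : 𝔽₃ d → A → ℕ) → ∑ᵥ d (λ φ → ∑ₗ X (g φ)) ≡ ∑ₗ X (λ x → ∑ᵥ d (λ φ → g φ x))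
  ∑ᵥ-∑ₗ d []      g = trans (∑ᵥ-const d 0) (ℕ.*-zeroʳ (3 ^ d))
  ∑ᵥ-∑ₗ d (x ∷ X) g = trans (∑ᵥ-+ d (λ φ → g φ x) (λ φ → ∑ₗ X (g φ)))
    (cong (∑ᵥ d (λ φ → g φ x) ℕ.+_) (∑ᵥ-∑ₗ d X g))

  fibre : (A → Fin 3) → List A → Fin 3 → List A
  fibre f X i = filter (λ x → i Fin.≟ f x) X

  length-fibre : ∀ f X i → ∑ₗ X (λ x → ⟦ i ≡ f x ⟧) ≡ length (fibre f X i)
  length-fibre f []      i = refl
  length-fibre f (x ∷ X) i with i Fin.≟ f x
  ... | yes _ = cong suc (length-fibre f X i)
  ... | no  _ = length-fibre f X i

  -- With k = 1 it shows that the fibre sizes add up to the length; with k the fibre size itself it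
  -- turns the number of agreeing pairs into a sum of three squares.
  ∑ₗ-fibres : ∀ (f : A → Fin 3) X (k : Fin 3 → ℕ) → ∑ₗ X (k ∘ f) ≡ ∑₃ (λ i → k i * ∑ₗ X (λ x → ⟦ i ≡ f x ⟧))
  ∑ₗ-fibres f []      k = sym (lem (k zero) (k (suc zero)) (k (suc (suc zero))))
    where
    lem : ∀ a b c → a * 0 + b * 0 + c * 0 ≡ 0
    lem = ℕ-Ring.solve-∀
  ∑ₗ-fibres f (x ∷ X) k = trans (cong (k (f x) ℕ.+_) (∑ₗ-fibres f X k)) (step (f x))
    where
    h : Fin 3 → ℕ
    h i = ∑ₗ X (λ x → ⟦ i ≡ f x ⟧)
    step : ∀ j → k j + ∑₃ (λ i → k i * h i) ≡ ∑₃ (λ i → k i * (⟦ i ≡ j ⟧ + h i))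
    step zero = lem (k zero) (k (suc zero)) (k (suc (suc zero))) (h zero) (h (suc zero)) (h (suc (suc zero)))
      where
      lem : ∀ a b c x y z → a + (a * x + b * y + c * z) ≡ a * (1 + x) + b * y + c * z
      lem = ℕ-Ring.solve-∀
    step (suc zero) = lem (k zero) (k (suc zero)) (k (suc (suc zero))) (h zero) (h (suc zero)) (h (suc (suc zero)))
      where
      lem : ∀ a b c x y z → b + (a * x + b * y + c * z) ≡ a * x + b * (1 + y) + c * z
      lem = ℕ-Ring.solve-∀
    step (suc (suc zero)) = lem (k zero) (k (suc zero)) (k (suc (suc zero))) (h zero) (h (suc zero)) (h (suc (suc zero)))
      where
      lem : ∀ a b c x y z → c + (a * x + b * y + c * z) ≡ a * x + b * y + c * (1 + z)
      lem = ℕ-Ring.solve-∀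

-- Cap bounds

Triple : ∀ {d} → List (𝔽₃ d) → Set
Triple X = ∃[ x ] ∃[ y ] ∃[ z ] x ∷ y ∷ z ∷ [] ⊆ X × Collinear x y z

triple-⊆ : ∀ {d} {X Y : List (𝔽₃ d)} → X ⊆ Y → Triple X → Triple Y
triple-⊆ X⊆Y (x , y , z , ⊆X , l) = x , y , z , ⊆-trans ⊆X X⊆Y , l

three-⊆-map⁻ : {A B : Set} (f : A → B) {x y z : B} (S : List A) → x ∷ y ∷ z ∷ [] ⊆ map f S →
  ∃[ a ] ∃[ b ] ∃[ c ] a ∷ b ∷ c ∷ [] ⊆ S × f a ≡ x × f b ≡ y × f c ≡ z
three-⊆-map⁻ f S ⊆S with ⊆-map⁻ f S ⊆S
... | a ∷ b ∷ c ∷ [] , ⊆S′ , refl = a , b , c , ⊆S′ , refl , refl , refl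

CapBound : ℕ → ℕ → Set
CapBound d N = ∀ (X : List (𝔽₃ d)) → Unique X → N ≤ length X → Triple X

capBound-1 : CapBound 1 3
capBound-1 ((x ∷ []) ∷ (y ∷ []) ∷ (z ∷ []) ∷ X) ((x≢y ∷ x≢z ∷ _) ∷ (y≢z ∷ _) ∷ _) _ =
  _ , _ , _ , refl ∷ refl ∷ refl ∷ minimum X ,
  cong (_∷ []) (distinct-zero-sum x y z (x≢y ∘ cong (_∷ [])) (x≢z ∘ cong (_∷ [])) (y≢z ∘ cong (_∷ [])))
capBound-1 ([]) _ ()
capBound-1 (_ ∷ []) _ (s≤s ())
capBound-1 (_ ∷ _ ∷ []) _ (s≤s (s≤s ()))

-- A constructive form of "suppose there is no line": each case gives the wanted bound or exhibits
-- R, which will be a line.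
choose₃ : {Q : Fin 3 → Set} {R : Set} → (∀ i → Q i ⊎ R) → (∀ i → Q i) ⊎ R
choose₃ f with f zero | f (suc zero) | f (suc (suc zero))
... | inj₂ r | _      | _      = inj₂ r
... | _      | inj₂ r | _      = inj₂ r
... | _      | _      | inj₂ r = inj₂ r
... | inj₁ a | inj₁ b | inj₁ c = inj₁ λ { zero → a ; (suc zero) → b ; (suc (suc zero)) → c }

chooseᵥ : ∀ d {Q : 𝔽₃ d → Set} {R : Set} → (∀ φ → Q φ ⊎ R) → (∀ φ → Q φ) ⊎ R
chooseᵥ zero f with f []
... | inj₁ q = inj₁ λ { [] → q }
... | inj₂ r = inj₂ r
chooseᵥ (suc d) f with choose₃ (λ a → chooseᵥ d (f ∘ (a ∷_)))
... | inj₁ q = inj₁ λ { (a ∷ φ) → q a φ }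
... | inj₂ r = inj₂ r

unique-map : {A B : Set} {P : A → Set} (f : A → B) → (∀ x y → P x → P y → f x ≡ f y → x ≡ y) →
  ∀ {X} → All P X → Unique X → Unique (map f X)
unique-map f inj []       []       = []
unique-map f inj (px ∷ ps) (x∉ ∷ u) =
  All.map⁺ (All.zipWith (λ (x≢y , py) eq → x≢y (inj _ _ px py eq)) (x∉ , ps)) ∷ unique-map f inj ps u

SquareBound : (n c B : ℕ) → Set
SquareBound n c B = ∀ {i} → i < suc c → ∀ {j} → j < suc c → ∀ {k} → k < suc c →
  i + j + k ≡ n → i * i + j * j + k * k ≤ B

squareBound? : ∀ n c B → Dec (SquareBound n c B)
squareBound? n c B = ℕ.allUpTo? (λ i → ℕ.allUpTo? (λ j → ℕ.allUpTo? (λ k →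
  (i + j + k ℕ.≟ n) →-dec (i * i + j * j + k * k ℕ.≤? B)) (suc c)) (suc c)) (suc c)

-- Count the pairs of points of a cap on a common level set of φ, over all φ.  Two distinct points
-- agree for 3ᵈ of the φ.  A level set of φ ≠ 0 contains at most c points, so each φ ≠ 0 has at
-- most B pairs.
capBound-suc : ∀ d n c B → CapBound d (suc c) → SquareBound n c B →
  n * n + 3 ^ suc d * B < n * (n * 3 ^ d + 2 * 3 ^ d) + B → CapBound (suc d) n
capBound-suc d n c B cap sq big X uniq n≤ = conclude (chooseᵥ (suc d) few-pairs)
  where
  open ℕ.≤-Reasoning
  Y : List (𝔽₃ (suc d))
  Y = take n X
  length-Y : length Y ≡ n
  length-Y = trans (length-take n X) (ℕ.m≤n⇒m⊓n≡m n≤)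
  pairs : 𝔽₃ (suc d) → ℕ
  pairs φ = ∑ₗ Y λ x → ∑ₗ Y λ y → ⟦ φ ∙ x ≡ φ ∙ y ⟧

  few-points : ∀ φ → φ ≢ 0⃗ → ∀ i → length (fibre (φ ∙_) Y i) ≤ c ⊎ Triple Y
  few-points φ φ≢0 i with length (fibre (φ ∙_) Y i) ℕ.≤? c
  ... | yes ≤c = inj₁ ≤c
  ... | no ≰c =
    let _ , _ , _ , ⊆πF , l = cap (map π F) (unique-map π inj on-level (Unique.filter⁺ (λ x → i Fin.≟ φ ∙ x) (Unique.take⁺ n uniq)))
                                (ℕ.≤-trans (ℕ.≰⇒> ≰c) (ℕ.≤-reflexive (sym (length-map π F))))
        x , y , z , ⊆F , eqs = three-⊆-map⁻ π F ⊆πF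
    in inj₂ (x , y , z , ⊆-trans ⊆F (filter-⊆ (λ x → i Fin.≟ φ ∙ x) Y) , lift-line x y z (All-resp-⊆ ⊆F on-level) eqs l)
    where
    open Projection (projection φ φ≢0)
    F : List (𝔽₃ (suc d))
    F = fibre (φ ∙_) Y i
    on-level : All (λ x → i ≡ φ ∙ x) F
    on-level = All.all-filter (λ x → i Fin.≟ φ ∙ x) Y
    inj : ∀ x y → i ≡ φ ∙ x → i ≡ φ ∙ y → π x ≡ π y → x ≡ y
    inj x y ix iy = injective x y (trans (sym ix) iy)
    lift-line : ∀ x y z {x′ y′ z′} → All (λ x → i ≡ φ ∙ x) (x ∷ y ∷ z ∷ []) →
      π x ≡ x′ × π y ≡ y′ × π z ≡ z′ → Collinear x′ y′ z′ → Collinear x y z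
    lift-line x y z (ix ∷ iy ∷ iz ∷ []) (refl , refl , refl) =
      collinear x y z (trans (sym ix) iy) (trans (sym ix) iz)

  few-pairs : ∀ φ → (φ ≢ 0⃗ → pairs φ ≤ B) ⊎ Triple Y
  few-pairs φ with Vec.≡-dec Fin._≟_ φ 0⃗
  ... | yes φ≡0 = inj₁ λ φ≢0 → contradiction φ≡0 φ≢0
  ... | no φ≢0 with choose₃ (few-points φ φ≢0)
  ...   | inj₂ t  = inj₂ t
  ...   | inj₁ ≤c = inj₁ λ _ → ℕ.≤-trans (ℕ.≤-reflexive (∑ₗ-fibres (φ ∙_) Y h))
    (sq (h≤c zero) (h≤c (suc zero)) (h≤c (suc (suc zero))) ∑h≡n)
    where
    h : Fin 3 → ℕ
    h i = ∑ₗ Y λ y → ⟦ i ≡ φ ∙ y ⟧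
    h≤c : ∀ i → h i < suc c
    h≤c i = s≤s (ℕ.≤-trans (ℕ.≤-reflexive (length-fibre (φ ∙_) Y i)) (≤c i))
    ∑ₗ-1 : {A : Set} (Z : List A) → ∑ₗ Z (λ _ → 1) ≡ length Z
    ∑ₗ-1 []      = refl
    ∑ₗ-1 (_ ∷ Z) = cong suc (∑ₗ-1 Z)
    ∑h≡n : ∑₃ h ≡ n
    ∑h≡n = trans (∑₃-cong λ i → sym (ℕ.*-identityˡ (h i)))
      (trans (sym (∑ₗ-fibres (φ ∙_) Y λ _ → 1)) (trans (∑ₗ-1 Y) length-Y))

  lower : n * (n * 3 ^ d + 2 * 3 ^ d) ≤ ∑ᵥ (suc d) pairs
  lower = begin
    n * (n * 3 ^ d + 2 * 3 ^ d)
      ≡⟨ cong (λ l → l * (l * 3 ^ d + 2 * 3 ^ d)) length-Y ⟨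
    length Y * (length Y * 3 ^ d + 2 * 3 ^ d)
      ≤⟨ ∑ₗ-≥ Y (λ {x} x∈Y → ∑ₗ-≥-∈ {f = λ y → ∑ᵥ (suc d) λ φ → ⟦ φ ∙ x ≡ φ ∙ y ⟧} x∈Y
           (agreements-≥ d x) (ℕ.≤-reflexive (sym (agreements-≡ (suc d) x)))) ⟩
    ∑ₗ Y (λ x → ∑ₗ Y λ y → ∑ᵥ (suc d) λ φ → ⟦ φ ∙ x ≡ φ ∙ y ⟧)
      ≡⟨ ∑ₗ-cong Y (λ x → ∑ᵥ-∑ₗ (suc d) Y λ φ y → ⟦ φ ∙ x ≡ φ ∙ y ⟧) ⟨
    ∑ₗ Y (λ x → ∑ᵥ (suc d) λ φ → ∑ₗ Y λ y → ⟦ φ ∙ x ≡ φ ∙ y ⟧)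
      ≡⟨ ∑ᵥ-∑ₗ (suc d) Y (λ φ x → ∑ₗ Y λ y → ⟦ φ ∙ x ≡ φ ∙ y ⟧) ⟨
    ∑ᵥ (suc d) pairs ∎
    where
    ∑ₗ-cong : {A : Set} (Z : List A) {f g : A → ℕ} → (∀ x → f x ≡ g x) → ∑ₗ Z f ≡ ∑ₗ Z g
    ∑ₗ-cong []      f≡g = refl
    ∑ₗ-cong (x ∷ Z) f≡g = cong₂ _+_ (f≡g x) (∑ₗ-cong Z f≡g)

  pairs≤n² : ∀ φ → pairs φ ≤ n * n
  pairs≤n² φ = begin
    pairs φ                        ≤⟨ ∑ₗ-≤ Y (λ x → ∑ₗ-≤ Y λ y → ⟦≡⟧≤1 (φ ∙ x) (φ ∙ y)) ⟩
    length Y * (length Y * 1)      ≡⟨ cong (length Y *_) (ℕ.*-identityʳ (length Y)) ⟩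
    length Y * length Y            ≡⟨ cong (λ l → l * l) length-Y ⟩
    n * n                          ∎

  conclude : (∀ φ → φ ≢ 0⃗ → pairs φ ≤ B) ⊎ Triple Y → Triple X
  conclude (inj₂ t) = triple-⊆ (take-⊆ n X) t
  -- φ = 0 contributes at most n² pairs and each of the other 3^(d+1) - 1 functionals at most B,
  -- fewer in total than the agreements counted in `lower`.
  conclude (inj₁ ≤B) = contradiction big (ℕ.≤⇒≯ (begin
    n * (n * 3 ^ d + 2 * 3 ^ d) + B   ≤⟨ ℕ.+-monoˡ-≤ B lower ⟩
    ∑ᵥ (suc d) pairs + B              ≤⟨ ∑ᵥ-bound (suc d) pairs B ≤B ⟩
    pairs 0⃗ + 3 ^ suc d * B           ≤⟨ ℕ.+-monoˡ-≤ _ (pairs≤n² 0⃗) ⟩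
    n * n + 3 ^ suc d * B             ∎))

-- Here and in the next two bounds, B comes from the most uneven splitting into parts at most c: 5 =
-- 2 + 2 + 1, 10 = 4 + 4 + 2 and 24 = 9 + 9 + 6.
capBound-2 : CapBound 2 5
capBound-2 = capBound-suc 1 5 2 9 capBound-1 (from-yes (squareBound? 5 2 9)) (ℕ.≤ᵇ⇒≤ _ _ _)

capBound-3 : CapBound 3 10
capBound-3 = capBound-suc 2 10 4 36 capBound-2 (from-yes (squareBound? 10 4 36)) (ℕ.≤ᵇ⇒≤ _ _ _)

-- The largest caps in 𝔽₃⁴ have 20 points. At most 23 is enough for `attains-4`, since 23 = 18 + 1 +
-- 4.
capBound-4 : CapBound 4 24
capBound-4 = capBound-suc 3 24 9 198 capBound-3 (from-yes (squareBound? 24 9 198)) (ℕ.≤ᵇ⇒≤ _ _ _)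

residues-zero-sum : ∀ x y z → x mod 3 ⊕ y mod 3 ⊕ z mod 3 ≡ zero → 3 ∣ x + (y + (z + 0))
residues-zero-sum x y z eq = m%n≡0⇒n∣m _ 3 (begin
  (x + (y + (z + 0))) % 3               ≡⟨ cong (_% 3) (lem x y z) ⟩
  (x + y + z) % 3                       ≡⟨ toℕ-mod 3 (x + y + z) ⟨
  toℕ ((x + y + z) mod 3)               ≡⟨ cong toℕ (⊕-mod (x + y) z) ⟨
  toℕ ((x + y) mod 3 ⊕ z mod 3)         ≡⟨ cong (λ i → toℕ (i ⊕ z mod 3)) (⊕-mod x y) ⟨
  toℕ (x mod 3 ⊕ y mod 3 ⊕ z mod 3)     ≡⟨ cong toℕ eq ⟩
  0                                     ∎)
  where
  open ≡-Reasoning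
  lem : ∀ x y z → x + (y + (z + 0)) ≡ x + y + z
  lem = ℕ-Ring.solve-∀
  ⊕-mod : ∀ a b → a mod 3 ⊕ b mod 3 ≡ (a + b) mod 3
  ⊕-mod a b = trans (mod-+ˡ 3 a (toℕ (b mod 3))) (mod-+ʳ 3 a b)

any-⊆ : {A : Set} {P : A → Set} {X : List A} → Any P X → ∃[ x ] x ∷ [] ⊆ X × P x
any-⊆ (here px)          = _ , refl ∷ minimum _ , px
any-⊆ (there {x = y} p)  = let x , x⊆ , px = any-⊆ p in x , y ∷ʳ x⊆ , px

-- A sequence in which no element occurs three times is a union of two sets.
capBound⇒forcing : ∀ {d c} → CapBound d (suc c) → Forcing 3 d 3 (suc (c * 2))
capBound⇒forcing {d} {c} cap {A} w S long = conclude (split S)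
  where
  v : A → 𝔽₃ d
  v x = Vec.tabulate λ i → w x i mod 3

  lookup-v : ∀ x i → Vec.lookup (v x) i ≡ w x i mod 3
  lookup-v x = Vec.lookup∘tabulate λ i → w x i mod 3

  equal⇒zero-sum : ∀ {x y z} → v x ≡ v y → v x ≡ v z → ZeroSum 3 w (x ∷ y ∷ z ∷ [])
  equal⇒zero-sum {x} {y} {z} xy xz i = residues-zero-sum (w x i) (w y i) (w z i)
    (subst (λ j → w x i mod 3 ⊕ w y i mod 3 ⊕ j ≡ zero) (same xz)
      (subst (λ j → w x i mod 3 ⊕ j ⊕ w x i mod 3 ≡ zero) (same xy) (triple-zero (w x i mod 3))))
    where
    same : ∀ {u} → v x ≡ v u → w x i mod 3 ≡ w u i mod 3
    same {u} eq = trans (sym (lookup-v x i)) (trans (cong (λ s → Vec.lookup s i) eq) (lookup-v u i))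
    triple-zero : ∀ j → j ⊕ j ⊕ j ≡ zero
    triple-zero = from-yes (all₃ λ j → j ⊕ j ⊕ j Fin.≟ zero)

  collinear⇒zero-sum : ∀ {x y z} → Collinear (v x) (v y) (v z) → ZeroSum 3 w (x ∷ y ∷ z ∷ [])
  collinear⇒zero-sum {x} {y} {z} l i = residues-zero-sum (w x i) (w y i) (w z i) (begin
    w x i mod 3 ⊕ w y i mod 3 ⊕ w z i mod 3
      ≡⟨ cong₂ _⊕_ (cong₂ _⊕_ (lookup-v x i) (lookup-v y i)) (lookup-v z i) ⟨
    Vec.lookup (v x) i ⊕ Vec.lookup (v y) i ⊕ Vec.lookup (v z) i
      ≡⟨ cong (_⊕ Vec.lookup (v z) i) (Vec.lookup-zipWith _⊕_ i (v x) (v y)) ⟨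
    Vec.lookup (Vec.zipWith _⊕_ (v x) (v y)) i ⊕ Vec.lookup (v z) i
      ≡⟨ Vec.lookup-zipWith _⊕_ i (Vec.zipWith _⊕_ (v x) (v y)) (v z) ⟨
    Vec.lookup (Vec.zipWith _⊕_ (Vec.zipWith _⊕_ (v x) (v y)) (v z)) i
      ≡⟨ cong (λ s → Vec.lookup s i) l ⟩
    Vec.lookup 0⃗ i
      ≡⟨ Vec.lookup-replicate i zero ⟩
    zero ∎)
    where open ≡-Reasoning

  split : ∀ S → HasBlock 3 w 3 S ⊎ ∃[ X ] ∃[ Y ] X ++ Y ↭ S × Unique (map v X) × Unique (map v Y)
  split [] = inj₂ ([] , [] , ↭-refl , [] , [])
  split (x ∷ S) with split S
  ... | inj₁ blk = inj₁ (block-rest {T = x ∷ []} ↭-refl blk)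
  ... | inj₂ (X , Y , eq , uX , uY)
      with Any.any? (λ y → Vec.≡-dec Fin._≟_ (v x) (v y)) X
         | Any.any? (λ y → Vec.≡-dec Fin._≟_ (v x) (v y)) Y
  ...   | no x∉X | _ = inj₂ (x ∷ X , Y , ↭-prep x eq , All.map⁺ (All.¬Any⇒All¬ X x∉X) ∷ uX , uY)
  ...   | yes _ | no x∉Y = inj₂ (X , x ∷ Y , ↭-trans (↭.shift x X Y) (↭-prep x eq) , uX ,
                                 All.map⁺ (All.¬Any⇒All¬ Y x∉Y) ∷ uY)
  ...   | yes x∈X | yes x∈Y =
    let y , y⊆X , xy = any-⊆ x∈X
        z , z⊆Y , xz = any-⊆ x∈Y
        T , T⊆S , yz↭T = ⊆-↭ (++⁺ y⊆X z⊆Y) eq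
    in inj₁ (⊆⇒block (refl ∷ T⊆S) (cong suc (sym (↭.↭-length yz↭T)))
         (zeroSum-↭ {T = x ∷ y ∷ z ∷ []} (↭-prep x yz↭T) (equal⇒zero-sum xy xz)))

  from-set : ∀ X → Unique (map v X) → suc c ≤ length X → HasBlock 3 w 3 X
  from-set X uX c<X =
    let _ , _ , _ , ⊆vX , l = cap (map v X) uX (subst (suc c ≤_) (sym (length-map v X)) c<X)
        x , y , z , ⊆X , x≡ , y≡ , z≡ = three-⊆-map⁻ v X ⊆vX
    in ⊆⇒block ⊆X refl (collinear⇒zero-sum (transport x≡ y≡ z≡ l))
    where
    transport : ∀ {x y z x′ y′ z′ : 𝔽₃ d} → x ≡ x′ → y ≡ y′ → z ≡ z′ → Collinear x′ y′ z′ → Collinear x y z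
    transport refl refl refl l = l

  conclude : HasBlock 3 w 3 S ⊎ ∃[ X ] ∃[ Y ] X ++ Y ↭ S × Unique (map v X) × Unique (map v Y) →
    HasBlock 3 w 3 S
  conclude (inj₁ blk) = blk
  conclude (inj₂ (X , Y , eq , uX , uY)) with suc c ℕ.≤? length X | suc c ℕ.≤? length Y
  ... | yes c<X | _       = block-widen eq (from-set X uX c<X)
  ... | no _    | yes c<Y = block-rest eq (from-set Y uY c<Y)
  ... | no c≮X  | no c≮Y  = contradiction long (ℕ.<⇒≱ (s≤s (begin
    length S                ≡⟨ ↭.↭-length eq ⟨
    length (X ++ Y)         ≡⟨ length-++ X ⟩
    length X + length Y     ≤⟨ ℕ.+-mono-≤ (ℕ.s≤s⁻¹ (ℕ.≰⇒> c≮X)) (ℕ.s≤s⁻¹ (ℕ.≰⇒> c≮Y)) ⟩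
    c + c                   ≡⟨ lem c ⟩
    c * 2                   ∎)))
    where
    open ℕ.≤-Reasoning
    lem : ∀ c → c + c ≡ c * 2
    lem = ℕ-Ring.solve-∀

egz-3-3 : Forcing 3 3 3 (suc (9 * 2))
egz-3-3 = capBound⇒forcing capBound-3

egz-3-4 : Forcing 3 4 3 (suc (23 * 2))
egz-3-4 = capBound⇒forcing capBound-4

-- All lengths in ranks 3 and 4

module _ {q r m : ℕ} .{{_ : NonZero q}} (F : Forcing q r q (suc (m * ℕ.pred q))) (r<m : r < m) where

  -- A sequence of level k + 1 is long enough for a block of length q, as m (q - 1) + 1 + r ≤ m q ≤
  -- (k + 1 + r) q; removing it leaves level k.
  attains-suc : ∀ k → m ≤ suc k + r → Attains q r k → Attains q r (suc k)
  attains-suc k m≤ Ak w S lev = attains-remove 1 k lev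
    (subst (λ l → HasBlock q w l S) (sym (ℕ.+-identityʳ q)) (F w S (ℕ.+-cancelʳ-≤ r _ _ (begin
      suc (m * ℕ.pred q) + r     ≡⟨ ℕ.+-suc (m * ℕ.pred q) r ⟨
      m * ℕ.pred q + suc r       ≤⟨ ℕ.+-monoʳ-≤ (m * ℕ.pred q) r<m ⟩
      m * ℕ.pred q + m           ≡⟨ ℕ.+-comm (m * ℕ.pred q) m ⟩
      m + m * ℕ.pred q           ≡⟨ ℕ.*-suc m (ℕ.pred q) ⟨
      m * suc (ℕ.pred q)         ≡⟨ cong (m *_) (ℕ.suc-pred q) ⟩
      m * q                      ≤⟨ ℕ.*-monoˡ-≤ q m≤ ⟩
      (suc k + r) * q            ≤⟨ lev ⟩
      length S + r               ∎)))) Ak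
    where open ℕ.≤-Reasoning

  attains-≥ : ∀ k → m ≤ suc k + r → Attains q r k → ∀ {l} → k ≤ l → Attains q r l
  attains-≥ k m≤ Ak {l} k≤l = subst (Attains q r) (ℕ.m∸n+n≡m k≤l) (go (l ∸ k))
    where
    go : ∀ j → Attains q r (j + k)
    go zero    = Ak
    go (suc j) = attains-suc (j + k)
      (ℕ.≤-trans m≤ (s≤s (ℕ.+-monoˡ-≤ r (ℕ.m≤n+m k j)))) (go j)

prime-∣-prime : ∀ {p q} → Prime p → Prime q → p ∣ q → p ≡ q
prime-∣-prime {p} pp pq p∣q with prime⇒irreducible pq p∣q
... | inj₁ p≡1 = contradiction (subst Prime p≡1 pp) ¬prime[1]
... | inj₂ p≡q = p≡q

prime∤12 : ∀ {p} → Prime p → p ≢ 2 → p ≢ 3 → ¬ p ∣ 12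
prime∤12 pp p≢2 p≢3 p∣12 with euclidsLemma 4 3 pp p∣12
... | inj₂ p∣3 = p≢3 (prime-∣-prime pp (from-yes (prime? 3)) p∣3)
... | inj₁ p∣4 with euclidsLemma 2 2 pp p∣4
...   | inj₁ p∣2 = p≢2 (prime-∣-prime pp prime[2] p∣2)
...   | inj₂ p∣2 = p≢2 (prime-∣-prime pp prime[2] p∣2)

prime∤360 : ∀ {p} → Prime p → p ≢ 2 → p ≢ 3 → p ≢ 5 → ¬ p ∣ 360
prime∤360 pp p≢2 p≢3 p≢5 p∣360 with euclidsLemma 12 30 pp p∣360
... | inj₁ p∣12 = prime∤12 pp p≢2 p≢3 p∣12
... | inj₂ p∣30 with euclidsLemma 6 5 pp p∣30
...   | inj₁ p∣6 = prime∤12 pp p≢2 p≢3 (∣.∣-trans p∣6 (divides 2 refl))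
...   | inj₂ p∣5 = p≢5 (prime-∣-prime pp (from-yes (prime? 5)) p∣5)

-- For p = 2 steps of one q start at 4, the first power of 2 that is at least 3, where 8 = 4 + 1 +
-- 3. For p = 3 they start at 6 = 2 · 3, where 9 ≤ 6 + 1 + 3.
attains-3 : ∀ {p} → Prime p → ∀ a k → 6 ≤ k → Attains (p ^ a) 3 k
attains-3 {p} pp a k 6≤k with p ℕ.≟ 2 | p ℕ.≟ 3
... | yes refl | _ = attains-≥ {{ℕ.m^n≢0 2 a}} (egz-power {m = 8} (egz-2 3) a) (ℕ.≤ᵇ⇒≤ 4 8 _) 4 ℕ.≤-refl
  (PrimePower.attains-p^ pp a 3 (s≤s z≤n) 2 (ℕ.≤ᵇ⇒≤ 3 4 _)) (ℕ.≤-trans (ℕ.≤ᵇ⇒≤ 4 6 _) 6≤k)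
... | no _ | yes refl = attains-≥ {{ℕ.m^n≢0 3 a}} (egz-power {m = 9} egz-3-3 a) (ℕ.≤ᵇ⇒≤ 4 9 _) 6 (ℕ.≤ᵇ⇒≤ 9 10 _)
  (attains-* {k = 3} (PrimePower.attains-p^ pp a 3 (s≤s z≤n) 1 ℕ.≤-refl) 1) 6≤k
... | no p≢2 | no p≢3 = subst (Attains (p ^ a) 3) (ℕ.m∸n+n≡m 6≤k) (go (k ∸ 6))
  where
  open Soundness pp a 3 (s≤s z≤n) 12 (prime∤12 pp p≢2 p≢3)
  A₃ : Attains (p ^ a) 3 3
  A₃ = derivable⇒attains derivable-3-3
  A₄ : Attains (p ^ a) 3 4
  A₄ = derivable⇒attains derivable-3-4
  go : ∀ j → Attains (p ^ a) 3 (j + 6)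
  go 0 = attains-+ 3 3 A₃ A₃
  go 1 = attains-+ 3 4 A₃ A₄
  go 2 = attains-+ 4 4 A₄ A₄
  go (suc (suc (suc j))) = attains-+ 3 (j + 6) A₃ (go j)

-- For p = 2 steps of one q start at 12, the first multiple of 4 with 16 ≤ k + 1 + 4; for p = 3 at
-- 18 = 2 · 9. For p ≥ 5, steps of 4 start from one number in each residue class: 18, 19, 20, 21.
attains-4 : ∀ {p} → Prime p → ∀ a k → 18 ≤ k → Attains (p ^ a) 4 k
attains-4 {p} pp a k 18≤k with p ℕ.≟ 2 | p ℕ.≟ 3
... | yes refl | _ = attains-≥ {{ℕ.m^n≢0 2 a}} (egz-power {m = 16} (egz-2 4) a) (ℕ.≤ᵇ⇒≤ 5 16 _) 12 (ℕ.≤ᵇ⇒≤ 16 17 _)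
  (attains-* {k = 4} (PrimePower.attains-p^ pp a 4 (s≤s z≤n) 2 ℕ.≤-refl) 2) (ℕ.≤-trans (ℕ.≤ᵇ⇒≤ 12 18 _) 18≤k)
... | no _ | yes refl = attains-≥ {{ℕ.m^n≢0 3 a}} (egz-power {m = 23} egz-3-4 a) (ℕ.≤ᵇ⇒≤ 5 23 _) 18 ℕ.≤-refl
  (attains-* {k = 9} (PrimePower.attains-p^ pp a 4 (s≤s z≤n) 2 (ℕ.≤ᵇ⇒≤ 4 9 _)) 1) 18≤k
... | no p≢2 | no p≢3 = subst (Attains (p ^ a) 4) (ℕ.m∸n+n≡m 18≤k) (go (k ∸ 18))
  where
  A₄ : Attains (p ^ a) 4 4
  A₄ = Soundness.derivable⇒attains pp a 4 (s≤s z≤n) 12 (prime∤12 pp p≢2 p≢3) derivable-4-4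
  base : Attains (p ^ a) 4 18 × Attains (p ^ a) 4 19 × Attains (p ^ a) 4 21
  base with p ℕ.≟ 5
  ... | yes refl =
    let A₅ = PrimePower.attains-p^ pp a 4 (s≤s z≤n) 1 (ℕ.≤ᵇ⇒≤ 4 5 _)
    in attains-+ 8 10 (attains-* {k = 4} A₄ 1) (attains-* {k = 5} A₅ 1) ,
       attains-+ 4 15 A₄ (attains-* {k = 5} A₅ 2) ,
       attains-+ 16 5 (attains-* {k = 4} A₄ 3) A₅
  ... | no p≢5 =
    let A₇ = Soundness.derivable⇒attains pp a 4 (s≤s z≤n) 360 (prime∤360 pp p≢2 p≢3 p≢5) derivable-4-7
    in attains-+ 4 14 A₄ (attains-* {k = 7} A₇ 1) ,
       attains-+ 12 7 (attains-* {k = 4} A₄ 2) A₇ ,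
       attains-* {k = 7} A₇ 2
  go : ∀ j → Attains (p ^ a) 4 (j + 18)
  go 0 = proj₁ base
  go 1 = proj₁ (proj₂ base)
  go 2 = attains-* {k = 4} A₄ 4
  go 3 = proj₂ (proj₂ base)
  go (suc (suc (suc (suc j)))) = attains-+ 4 (j + 18) A₄ (go j)

-- From prime powers to n

𝗌-forces : ∀ k n r .{{_ : NonZero n}} → Forces (C^ n r) (k * n) (𝗌 k n r)
𝗌-forces k n r = proj₁ (proj₂ (proj₂ (𝗌-exists n r k)))

1≤𝗌 : ∀ k n r .{{_ : NonZero n}} → 1 ≤ 𝗌 k n r
1≤𝗌 k n r = proj₁ (proj₂ (𝗌-exists n r k))

𝗌-least : ∀ k n r .{{_ : NonZero n}} {t} → 1 ≤ t → Forces (C^ n r) (k * n) t → 𝗌 k n r ≤ t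
𝗌-least k n r {t} = proj₂ (proj₂ (proj₂ (𝗌-exists n r k))) t

-- With L = (k + r) q - r blocks of n′ terms, (L - 1) n′ + s(C_{n′}^r) terms suffice; the -r in L
-- becomes the -r n′ that is later merged into a_r.
𝗌-attains : ∀ {k n n′ q r} .{{_ : NonZero n}} .{{n′≢0 : NonZero n′}} .{{_ : NonZero q}} →
  n ≡ n′ * q → Attains q r k → 𝗌 k n r + r * n′ ≤ (k + r) * n + 𝗌 1 n′ r
𝗌-attains {k} {n} {n′} {q} {r} n≡ Ak = begin
  𝗌 k n r + r * n′
    ≤⟨ ℕ.+-monoˡ-≤ (r * n′) (𝗌-least k n r (ℕ.≤-trans (1≤𝗌 1 n′ r) (ℕ.m≤n+m _ _)) forces) ⟩
  ℕ.pred L * (1 * n′) + 𝗌 1 n′ r + r * n′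
    ≡⟨ lem (ℕ.pred L) n′ (𝗌 1 n′ r) r ⟩
  (ℕ.pred L + r) * n′ + 𝗌 1 n′ r
    ≤⟨ ℕ.+-monoˡ-≤ (𝗌 1 n′ r) (ℕ.*-monoˡ-≤ n′ (ℕ.+-monoˡ-≤ r (ℕ.pred[n]≤n {L}))) ⟩
  (L + r) * n′ + 𝗌 1 n′ r
    ≡⟨ cong (λ l → l * n′ + 𝗌 1 n′ r) (ℕ.m∸n+n≡m (ℕ.≤-trans (ℕ.m≤n+m r k) (ℕ.m≤m*n (k + r) q))) ⟩
  (k + r) * q * n′ + 𝗌 1 n′ r
    ≡⟨ cong (_+ 𝗌 1 n′ r) (trans (ℕ.*-assoc (k + r) q n′) (cong ((k + r) *_) (trans (ℕ.*-comm q n′) (sym n≡)))) ⟩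
  (k + r) * n + 𝗌 1 n′ r ∎
  where
  open ℕ.≤-Reasoning
  L : ℕ
  L = (k + r) * q ∸ r
  lem : ∀ l m s r → l * (1 * m) + s + r * m ≡ (l + r) * m + s
  lem = ℕ-Ring.solve-∀
  L≤ : ∀ l → l ≤ suc (ℕ.pred l)
  L≤ zero    = z≤n
  L≤ (suc l) = ℕ.≤-refl
  lem′ : ∀ k q m → k * q * (1 * m) ≡ k * (m * q)
  lem′ = ℕ-Ring.solve-∀
  forces : Forces (C^ n r) (k * n) (ℕ.pred L * (1 * n′) + 𝗌 1 n′ r)
  forces = forcing⇒forces λ w S long →
    subst (λ m → HasBlock m w (k * m) S) (sym n≡)
      (subst (λ l → HasBlock (n′ * q) w l S) (lem′ k q n′)
        (forcing-* (forces⇒forcing (𝗌-forces 1 n′ r))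
          (forcing-mono (L≤ L) (attains⇒forcing {k = k} Ak)) w S long))

-- A prime power q dividing n with n ≤ q^ω(n)

split-prime : ∀ {p} → Prime p → ∀ n → .{{NonZero n}} → ∃[ v ] ∃[ m ] n ≡ p ^ v * m × ¬ p ∣ m
split-prime {p} pp = <-rec _ go
  where
  go : ∀ n → (∀ {m} → m < n → .{{NonZero m}} → ∃[ v ] ∃[ m′ ] m ≡ p ^ v * m′ × ¬ p ∣ m′) →
    .{{NonZero n}} → ∃[ v ] ∃[ m ] n ≡ p ^ v * m × ¬ p ∣ m
  go n rec with p ∣? n
  ... | no p∤n = 0 , n , sym (ℕ.+-identityʳ n) , p∤n
  ... | yes (divides (suc m) refl) =
    let v , m′ , eq , p∤m′ = rec (ℕ.m<m*n (suc m) p (ℕ.nonTrivial⇒n>1 p {{prime⇒nonTrivial pp}}))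
    in suc v , m′ , trans (ℕ.*-comm (suc m) p) (trans (cong (p *_) eq) (sym (ℕ.*-assoc p (p ^ v) m′))) , p∤m′

no-prime-divisor : ∀ n → .{{NonZero n}} → (∀ p → Prime p → ¬ p ∣ n) → n ≡ 1
no-prime-divisor n none = go factors isFactorisation factorsPrime
  where
  open PrimeFactorisation (factorise n)
  go : ∀ ps → n ≡ product ps → All Prime ps → n ≡ 1
  go []       eq _        = eq
  go (p ∷ ps) eq (pp ∷ _) = contradiction (subst (p ∣_) (sym eq) (∣.m∣m*n (product ps))) (none p pp)

-- Split off the p-part of n for the head p of L and recurse on the rest; the larger of the two
-- prime powers serves for both factors.
largest-prime-power : ∀ L → All Prime L → ∀ n → .{{NonZero n}} → (∀ p → Prime p → p ∣ n → p ∈ L) →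
  ∃[ p ] ∃[ a ] Prime p × p ^ a ∣ n × n ≤ (p ^ a) ^ length L
largest-prime-power [] _ n ∈L =
  -- Here n = 1, and the prime 2 is a placeholder for the power 2^0 = 1.
  2 , 0 , prime[2] , ∣.1∣ n , ℕ.≤-reflexive (no-prime-divisor n λ p pp p∣n → case (∈L p pp p∣n))
  where
  case : ∀ {p} → ¬ p ∈ []
  case ()
largest-prime-power (p ∷ L) (pp ∷ pL) n {{n≢0}} ∈L with split-prime pp n
... | v , m , refl , p∤m
  with largest-prime-power L pL m {{ℕ.m*n≢0⇒n≢0 (p ^ v)}} (λ p′ pp′ p′∣m →
         rest p′∣m (∈L p′ pp′ (∣.∣n⇒∣m*n (p ^ v) p′∣m)))
  where
  rest : ∀ {p′} → p′ ∣ m → p′ ∈ p ∷ L → p′ ∈ L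
  rest p′∣m (here refl) = contradiction p′∣m p∤m
  rest p′∣m (there p′∈) = p′∈
... | p′ , a , pp′ , p′^a∣m , m≤ with ℕ.≤-total (p ^ v) (p′ ^ a)
...   | inj₁ p^v≤ = p′ , a , pp′ , ∣.∣n⇒∣m*n (p ^ v) p′^a∣m , ℕ.*-mono-≤ p^v≤ m≤
...   | inj₂ ≤p^v = p , v , pp , ∣.m∣m*n m ,
  ℕ.*-monoʳ-≤ (p ^ v) (ℕ.≤-trans m≤ (ℕ.^-monoˡ-≤ (length L) ≤p^v))

n≤q^ω : ∀ n → .{{NonZero n}} → ∃[ p ] ∃[ a ] Prime p × p ^ a ∣ n × n ≤ (p ^ a) ^ ω n
n≤q^ω n = largest-prime-power (filter P? (upTo (suc n))) (All.map proj₁ (All.all-filter P? (upTo (suc n)))) n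
  λ p pp p∣n → ∈-filter⁺ P? (∈-upTo⁺ (s≤s (∣⇒≤ p∣n))) (pp , p∣n)
  where
  P? : ∀ p → Dec (Prime p × p ∣ n)
  P? p = prime? p ×-dec p ∣? n

-- Maximality of M compares it with proper prime powers only, so the exponent 0 is treated apart,
-- through 1 ≤ M.
n≤𝖬^ω : ∀ n M → .{{NonZero n}} → Is𝖬 n M → n ≤ M ^ ω n
n≤𝖬^ω n M ((_ , M∣n) , max) with n≤q^ω n
... | p , zero  , pp , _   , n≤ = ℕ.≤-trans n≤ (ℕ.^-monoˡ-≤ (ω n) 1≤M)
  where
  1≤M : 1 ≤ M
  1≤M = ℕ.n≢0⇒n>0 λ { refl → ℕ.≢-nonZero⁻¹ n (∣.0∣⇒≡0 M∣n) }
... | p , suc a , pp , q∣n , n≤ = ℕ.≤-trans n≤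
  (ℕ.^-monoˡ-≤ (ω n) (max (p ^ suc a) (p , suc a , pp , s≤s z≤n , refl) q∣n))

-- n / q ≤ n^(1 − 1/m), raised to the power m.
cofactor-^≤ : ∀ {n n′ q} m → .{{NonZero n}} → n ≡ n′ * q → n ≤ q ^ suc m → n′ ^ suc m ≤ n ^ m
cofactor-^≤ {n} {n′} {q} m n≡ n≤ = ℕ.*-cancelˡ-≤ n (begin
  n * n′ ^ suc m             ≤⟨ ℕ.*-monoˡ-≤ (n′ ^ suc m) n≤ ⟩
  q ^ suc m * n′ ^ suc m     ≡⟨ ℕ.*-comm (q ^ suc m) _ ⟩
  n′ ^ suc m * q ^ suc m     ≡⟨ ^-distribʳ-* (suc m) n′ q ⟨
  (n′ * q) ^ suc m           ≡⟨ cong (_^ suc m) n≡ ⟨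
  n ^ suc m                  ∎)
  where open ℕ.≤-Reasoning

2r≤2^r : ∀ r → 1 ≤ r → 2 * r ≤ 2 ^ r
2r≤2^r 1             _ = ℕ.≤-refl
2r≤2^r (suc (suc r)) _ = begin
  2 * suc (suc r)           ≡⟨ ℕ.*-suc 2 (suc r) ⟩
  2 + 2 * suc r             ≤⟨ ℕ.+-mono-≤ (ℕ.m≤m*n 2 (2 ^ r) {{ℕ.m^n≢0 2 r}}) (2r≤2^r (suc r) (s≤s z≤n)) ⟩
  2 ^ suc r + 2 ^ suc r     ≡⟨ cong (λ x → 2 ^ suc r + x) (ℕ.+-identityʳ (2 ^ suc r)) ⟨
  2 ^ suc (suc r)           ∎
  where open ℕ.≤-Reasoning

-- The 2ʳ distinct elements of C₂ʳ contain no zero-sum subsequence of length 2.  (n stays a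
-- variable because 𝗌 1 2 r would unfold into the search defining 𝗌.)
2r<𝗌 : ∀ {n} .{{_ : NonZero n}} → n ≡ 2 → ∀ r → 1 ≤ r → 2 * r < 𝗌 1 n r
2r<𝗌 refl r 1≤r = ℕ.≰⇒> λ 𝗌≤2r → no-block (forces⇒forcing (𝗌-forces 1 2 r) elements (allFin (2 ^ r))
  (ℕ.≤-trans 𝗌≤2r (ℕ.≤-trans (2r≤2^r r 1≤r) (ℕ.≤-reflexive (sym (length-tabulate {n = 2 ^ r} (λ i → i)))))))
  where
  elements : Fin (2 ^ r) → Fin r → ℕ
  elements i k = toℕ (finToFun {2} {r} i k)
  even-sum : ∀ (a b : Fin 2) → 2 ∣ toℕ a + (toℕ b + 0) → a ≡ b
  even-sum zero       zero       _    = refl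
  even-sum (suc zero) (suc zero) _    = refl
  even-sum zero       (suc zero) 2∣1 = contradiction 2∣1 (from-no (2 ∣? 1))
  even-sum (suc zero) zero       2∣1 = contradiction 2∣1 (from-no (2 ∣? 1))
  funToFin-cong : ∀ {r} {f g : Fin r → Fin 2} → (∀ k → f k ≡ g k) → funToFin f ≡ funToFin g
  funToFin-cong {zero}  f≗g = refl
  funToFin-cong {suc r} f≗g = cong₂ combine (f≗g zero) (funToFin-cong (f≗g ∘ suc))
  distinct : ∀ {X : List (Fin (2 ^ r))} {i j} → Unique X → i ∷ j ∷ [] ⊆ X → i ≢ j
  distinct (_ ∷ u)   (_ ∷ʳ ij⊆)  = distinct u ij⊆
  distinct (x∉ ∷ _) (refl ∷ j⊆) = All.head (All-resp-⊆ j⊆ x∉)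
  no-block : ¬ HasBlock 2 elements (1 * 2) (allFin (2 ^ r))
  no-block blk with block-⊆ blk
  ... | i ∷ j ∷ [] , ij⊆ , refl , z = distinct (Unique.allFin⁺ (2 ^ r)) ij⊆ (begin
    i                              ≡⟨ Fin.funToFin-finToFin {r} {2} i ⟨
    funToFin (finToFun {2} {r} i)  ≡⟨ funToFin-cong (λ k → even-sum (finToFun {2} {r} i k) (finToFun {2} {r} j k) (z k)) ⟩
    funToFin (finToFun {2} {r} j)  ≡⟨ Fin.funToFin-finToFin {r} {2} j ⟩
    j                              ∎)
    where open ≡-Reasoning

-- Estimates for real numbers

ι : ℕ → ℚ
ι n = + n /ℚ 1

ι-+ : ∀ a b → ι (a + b) ≡ ι a ℚ.+ ι b
ι-+ zero    b = sym (ℚ.+-identityˡ (ι b))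
ι-+ (suc a) b = begin
  ι (suc (a + b))            ≡⟨ suc-/ (a + b) 0 ⟩
  ι (a + b) ℚ.+ 1ℚ           ≡⟨ cong (ℚ._+ 1ℚ) (ι-+ a b) ⟩
  ι a ℚ.+ ι b ℚ.+ 1ℚ         ≡⟨ lem (ι a) (ι b) ⟩
  ι a ℚ.+ 1ℚ ℚ.+ ι b         ≡⟨ cong (ℚ._+ ι b) (suc-/ a 0) ⟨
  ι (suc a) ℚ.+ ι b          ∎
  where
  open ≡-Reasoning
  open +-*-Solver
  lem : ∀ x y → x ℚ.+ y ℚ.+ 1ℚ ≡ x ℚ.+ 1ℚ ℚ.+ y
  lem = solve 2 (λ x y → x :+ y :+ con 1ℚ := x :+ con 1ℚ :+ y) refl

ι-* : ∀ a b → ι (a * b) ≡ ι a ℚ.* ι b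
ι-* zero    b = sym (ℚ.*-zeroˡ (ι b))
ι-* (suc a) b = begin
  ι (b + a * b)              ≡⟨ ι-+ b (a * b) ⟩
  ι b ℚ.+ ι (a * b)          ≡⟨ cong (λ x → ι b ℚ.+ x) (ι-* a b) ⟩
  ι b ℚ.+ ι a ℚ.* ι b        ≡⟨ lem (ι a) (ι b) ⟩
  (ι a ℚ.+ 1ℚ) ℚ.* ι b       ≡⟨ cong (ℚ._* ι b) (suc-/ a 0) ⟨
  ι (suc a) ℚ.* ι b          ∎
  where
  open ≡-Reasoning
  open +-*-Solver
  lem : ∀ x y → y ℚ.+ x ℚ.* y ≡ (x ℚ.+ 1ℚ) ℚ.* y
  lem = solve 2 (λ x y → y :+ x :* y := (x :+ con 1ℚ) :* y) refl

ι-mono : ∀ {a b} → a ≤ b → ι a ℚ.≤ ι b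
ι-mono {a} {b} a≤b = /-≤ a 0 b 0 (ℕ.*-monoˡ-≤ 1 a≤b)

-- Every approximant, not just the limit, is at least b, because b (i + 1) is among the candidates
-- of the root search.
root-≥ : ∀ m a b → .{{_ : NonZero m}} → b ^ m ≤ a → ∀ i → ι b ℚ.≤ seq (root m a) i
root-≥ m a b b^m≤a i = /-≤ b 0 (⌊root⌋ m (a * suc i ^ m)) i
  (ℕ.≤-trans (searchRoot-max m (a * suc i ^ m) (a * suc i ^ m) (b * suc i) (ℕ.≤-trans (m≤m^n (b * suc i) m) ^≤) ^≤)
             (ℕ.≤-reflexive (sym (ℕ.*-identityʳ _))))
  where
  ^≤ : (b * suc i) ^ m ≤ a * suc i ^ m
  ^≤ = ℕ.≤-trans (ℕ.≤-reflexive (^-distribʳ-* m b (suc i))) (ℕ.*-monoˡ-≤ (suc i ^ m) b^m≤a)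

module _ where
  open ℚ.≤-Reasoning
  open +-*-Solver

  -- The slack 1 in the hypothesis is absorbed by the strict inequality 2r < s between integers, so
  -- A ≥ r holds without an ε.
  half-bound : ∀ {n r s A} → n ≡ 2 → 2 * r < s → ι s ℚ.≤ A ℚ.* ι n ℚ.+ 1ℚ → ι r ℚ.≤ A
  half-bound {_} {r} {s} {A} refl 2r<s s≤ = ℚ.*-cancelʳ-≤-pos (ι 2) (begin
    ι r ℚ.* ι 2                    ≡⟨ ι-* r 2 ⟨
    ι (r * 2)                      ≡⟨ lem (ι (r * 2)) ⟩
    ι (r * 2) ℚ.+ 1ℚ ℚ.- 1ℚ        ≡⟨ cong (ℚ._- 1ℚ) (suc-/ (r * 2) 0) ⟨
    ι (suc (r * 2)) ℚ.- 1ℚ         ≤⟨ ℚ.+-monoˡ-≤ (ℚ.- 1ℚ) (ι-mono (subst (_< s) (ℕ.*-comm 2 r) 2r<s)) ⟩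
    ι s ℚ.- 1ℚ                     ≤⟨ ℚ.+-monoˡ-≤ (ℚ.- 1ℚ) s≤ ⟩
    A ℚ.* ι 2 ℚ.+ 1ℚ ℚ.- 1ℚ        ≡⟨ lem (A ℚ.* ι 2) ⟨
    A ℚ.* ι 2                      ∎)
    where
    lem : ∀ x → x ≡ x ℚ.+ 1ℚ ℚ.- 1ℚ
    lem = solve 1 (λ x → x := x :+ con 1ℚ :- con 1ℚ) refl

  -- A ≥ r makes the coefficient A - r nonnegative, which allows n to be enlarged to ρ.
  linear-bound : ∀ {s s′ r n X A ρ ε} → s + r * n ≤ X + s′ → ι s′ ℚ.≤ A ℚ.* ι n ℚ.+ ε →
    ι r ℚ.≤ A → ι n ℚ.≤ ρ → ι s ℚ.≤ ι X ℚ.+ (A ℚ.- ι r) ℚ.* ρ ℚ.+ ε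
  linear-bound {s} {s′} {r} {n} {X} {A} {ρ} {ε} s≤ s′≤ r≤A n≤ρ = begin
    ι s
      ≡⟨ lem₁ (ι s) (ι r ℚ.* ι n) ⟩
    ι s ℚ.+ ι r ℚ.* ι n ℚ.- ι r ℚ.* ι n
      ≡⟨ cong (λ x → x ℚ.- ι r ℚ.* ι n) (trans (ι-+ s (r * n)) (cong (λ x → ι s ℚ.+ x) (ι-* r n))) ⟨
    ι (s + r * n) ℚ.- ι r ℚ.* ι n
      ≤⟨ ℚ.+-monoˡ-≤ _ (ι-mono s≤) ⟩
    ι (X + s′) ℚ.- ι r ℚ.* ι n
      ≡⟨ cong (λ x → x ℚ.- ι r ℚ.* ι n) (ι-+ X s′) ⟩
    ι X ℚ.+ ι s′ ℚ.- ι r ℚ.* ι n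
      ≤⟨ ℚ.+-monoˡ-≤ _ (ℚ.+-monoʳ-≤ (ι X) s′≤) ⟩
    ι X ℚ.+ (A ℚ.* ι n ℚ.+ ε) ℚ.- ι r ℚ.* ι n
      ≡⟨ lem₂ (ι X) A (ι n) ε (ι r) ⟩
    ι X ℚ.+ (A ℚ.- ι r) ℚ.* ι n ℚ.+ ε
      ≤⟨ ℚ.+-monoˡ-≤ ε (ℚ.+-monoʳ-≤ (ι X) (ℚ.*-monoˡ-≤-nonNeg (A ℚ.- ι r) {{A-r≥0}} n≤ρ)) ⟩
    ι X ℚ.+ (A ℚ.- ι r) ℚ.* ρ ℚ.+ ε ∎
    where
    A-r≥0 : ℚ.NonNegative (A ℚ.- ι r)
    A-r≥0 = ℚ.nonNegative (subst (ℚ._≤ A ℚ.- ι r) (ℚ.+-inverseʳ (ι r)) (ℚ.+-monoˡ-≤ (ℚ.- ι r) r≤A))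
    lem₁ : ∀ x y → x ≡ x ℚ.+ y ℚ.- y
    lem₁ = solve 2 (λ x y → x := x :+ y :- y) refl
    lem₂ : ∀ x a n e r → x ℚ.+ (a ℚ.* n ℚ.+ e) ℚ.- r ℚ.* n ≡ x ℚ.+ (a ℚ.- r) ℚ.* n ℚ.+ e
    lem₂ = solve 5 (λ x a n e r → x :+ (a :* n :+ e) :- r :* n := x :+ (a :- r) :* n :+ e) refl

-- That is a_r ≥ 0, from Alon-Dubiner for C_2^r with ε = 1.
𝖠≥r : ∀ c → IsAlonDubinerConstant c → ∀ r → 2 ≤ r → ∃[ N ] ∀ i → N ≤ i → ι r ℚ.≤ seq (𝖠 c r) i
𝖠≥r c (_ , alonDubiner) r 2≤r = at refl
  where
  at : ∀ {n} .{{_ : NonZero n}} → n ≡ 2 → ∃[ N ] ∀ i → N ≤ i → ι r ℚ.≤ seq (𝖠 c r) i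
  at {n} n≡2 =
    let N , bound = alonDubiner n r 2≤r 1ℚ
    in N , λ i N≤i → half-bound {n} {r} {𝗌 1 n r} {seq (𝖠 c r) i} n≡2 (2r<𝗌 n≡2 r (ℕ.<⇒≤ 2≤r)) (bound i N≤i)

attains⇒bound : ∀ c → IsAlonDubinerConstant c → ∀ {n m} .{{_ : NonZero n}} .{{_ : NonZero m}} → ω n ≡ m →
  ∀ {q k r} .{{q≢0 : NonZero q}} → 2 ≤ r → q ∣ n → n ≤ q ^ ω n → Attains q r k →
  fromℕ (𝗌 k n r) ≤ℝ fromℕ ((k + r) * n) +ℝ 𝖺 c r *ℝ n ^[1-1/ m ]
attains⇒bound c AD {n} {suc m} ω≡ {q} {k} {r} 2≤r (divides n′ n≡) n≤ Ak ε =
  let N₁ , ad  = proj₂ AD n′ r {{n′≢0}} 2≤r ε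
      N₂ , r≤A = 𝖠≥r c AD r 2≤r
  in N₁ ℕ.⊔ N₂ , λ i N≤i →
    linear-bound {𝗌 k n r} {𝗌 1 n′ r {{n′≢0}}} {r} {n′} {(k + r) * n} {seq (𝖠 c r) i} {seq (n ^[1-1/ suc m ]) i} {ε}
      (𝗌-attains {k} {n′ = n′} {q} {{n′≢0 = n′≢0}} n≡ Ak)
      (ad i (ℕ.m⊔n≤o⇒m≤o N₁ N₂ N≤i))
      (r≤A i (ℕ.m⊔n≤o⇒n≤o N₁ N₂ N≤i))
      (root-≥ (suc m) (n ^ m) n′ (cofactor-^≤ {n} {n′} {q} m n≡ (subst (λ l → n ≤ q ^ l) ω≡ n≤)) i)
  where
  n′≢0 : NonZero n′
  n′≢0 = ℕ.≢-nonZero λ { refl → ℕ.≢-nonZero⁻¹ n n≡ }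

theorem4p5 : (c : ℝ) → IsAlonDubinerConstant c →
    (n m : ℕ) .{{_ : NonZero n}} .{{_ : NonZero m}} → ω n ≡ m →
    (∀ k → 6 ≤ k →
    fromℕ (𝗌 k n 3) ≤ℝ fromℕ ((k + 3) * n) +ℝ 𝖺 c 3 *ℝ n ^[1-1/ m ])
    × (∀ k → 18 ≤ k →
    fromℕ (𝗌 k n 4) ≤ℝ fromℕ ((k + 4) * n) +ℝ 𝖺 c 4 *ℝ n ^[1-1/ m ])
    × (∀ k r → 1 ≤ k → 5 ≤ r → ∀ q → Is𝗉 n r q →
    fromℕ (𝗌 (k * q) n r) ≤ℝ fromℕ ((k * q + r) * n) +ℝ 𝖺 c r *ℝ n ^[1-1/ m ])
theorem4p5 c AD n m ω≡ = rank-3 , rank-4 , rank-≥5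
  where
  q≢0 : ∀ {p} → Prime p → ∀ a → NonZero (p ^ a)
  q≢0 {p} pp a = ℕ.m^n≢0 p a {{prime⇒nonZero pp}}
  rank-3 : ∀ k → 6 ≤ k → fromℕ (𝗌 k n 3) ≤ℝ fromℕ ((k + 3) * n) +ℝ 𝖺 c 3 *ℝ n ^[1-1/ m ]
  rank-3 k 6≤k =
    let p , a , pp , q∣n , n≤ = n≤q^ω n
    in attains⇒bound c AD {n} {m} ω≡ {p ^ a} {k} {3} {{q≢0 = q≢0 pp a}} (ℕ.≤ᵇ⇒≤ 2 3 _) q∣n n≤ (attains-3 pp a k 6≤k)
  rank-4 : ∀ k → 18 ≤ k → fromℕ (𝗌 k n 4) ≤ℝ fromℕ ((k + 4) * n) +ℝ 𝖺 c 4 *ℝ n ^[1-1/ m ]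
  rank-4 k 18≤k =
    let p , a , pp , q∣n , n≤ = n≤q^ω n
    in attains⇒bound c AD {n} {m} ω≡ {p ^ a} {k} {4} {{q≢0 = q≢0 pp a}} (ℕ.≤ᵇ⇒≤ 2 4 _) q∣n n≤ (attains-4 pp a k 18≤k)
  rank-≥5 : ∀ k r → 1 ≤ k → 5 ≤ r → ∀ q → Is𝗉 n r q →
    fromℕ (𝗌 (k * q) n r) ≤ℝ fromℕ ((k * q + r) * n) +ℝ 𝖺 c r *ℝ n ^[1-1/ m ]
  rank-≥5 (suc k) r _ 5≤r _ (p , a , pp , _ , is𝖬 , t , _ , refl , r≤ , _) =
    attains⇒bound c AD {n} {m} ω≡ {p ^ a} {suc k * p ^ t} {r} {{q≢0 = q≢0 pp a}}
      (ℕ.≤-trans (ℕ.≤ᵇ⇒≤ 2 5 _) 5≤r) (proj₂ (proj₁ is𝖬)) (n≤𝖬^ω n (p ^ a) is𝖬)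
      (attains-* {k = p ^ t} (PrimePower.attains-p^ pp a r (ℕ.≤-trans (ℕ.≤ᵇ⇒≤ 1 5 _) 5≤r) t r≤) k)
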